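{- Let $\Sigma$ be a signed graph and $v$ a vertex such that every block of $\Sigma$ containing $v$ contains a circle, and let $C$ be a circle containing $v$. Then $[v,C,+]$ is a positive vertex battery (i.e. $C$ is positive and is the only positive circle of $\Sigma$ containing $v$) if and only if: (1) the block $B_0$ containing $C$ is the unique block containing $v$ in which $v$ lies in exactly one positive circle, and $B_0$, $v$, $C$ satisfy one of: (a) $B_0=C$ is a positive circle; (b) $B_0$ is unbalanced, $\deg_{B_0}(v)=2$, $B_0{\downarrow}v$ is $(C{\downarrow}v)$-layered and $e_v$ lies in exactly one positive circle of $B_0{\downarrow}v$, namely $C{\downarrow}v$; (c) $B_0$ is unbalanced, $\deg_{B_0}(v)=3$, $B_0$ is $C$-layered with exactly one bridge of $C$, $v$ is a vertex of attachment of that bridge, and every edge of $C$ lies in exactly one positive circle of $B_0$; and (2) for every other block $B$ containing $v$, $\deg_B(v)=2$ and $e_v$ is a balancing edge of $B{\downarrow}v$.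
   Context: A signed graph $\Sigma=(G,\sigma)$ is a finite graph $G$ with signature $\sigma:E(G)\to\{+,-\}$. A circle is a connected 2-regular subgraph; its sign is the product of its edge signs. A subgraph is balanced if all its circles are positive, unbalanced otherwise. A block is a maximal subgraph without a cutpoint; $\deg_B(v)$ is the number of edges of $B$ incident with $v$. Switching by $\zeta:V\to\{+,-\}$ replaces $\sigma(f)$ by $\zeta(u)\sigma(f)\zeta(w)$; an edge $b$ is a balancing edge if the signed graph can be switched so that $b$ is the only negative edge. If $\deg_B(v)=2$ with incident edges $vv_1,vv_2$, $B{\downarrow}v$ is obtained by deleting $v$ and these edges and adding a new edge $e_v$ joining $v_1,v_2$ with sign $\sigma(vv_1)\sigma(vv_2)$; $C{\downarrow}v$ is the corresponding circle through $e_v$. For a circle $C$, a chord is an edge not in $C$ joining two distinct vertices of $C$; a bridge of $C$ is a chord or a connected component $D$ of $G\setminus V(C)$ together with all edges joining $D$ to $C$; its vertices of attachment are its vertices on $C$. Two chords cross if together with $C$ they form a subdivision of $K_4$. Endpoints of chords partition $C$ into segments; a segment is a handle if its endpoints are joined by a chord. If every bridge of $C$ has exactly two vertices of attachment, $C^*$ is obtained from $C$ by adding, for each bridge, one chord joining its vertices of attachment; handles are those determined by $C^*$. The graph is $C$-layered if every bridge of $C$ has exactly two vertices of attachment and in $C^*$ no two chords cross and there are exactly two handles.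
   Formalization: The formal theorem additionally assumes that there is no negative loop at v; with one (e.g. a positive triangle C through v plus a negative loop at v) C is a positive vertex battery, but the loop is another block with deg_B(v)=1, so (2) fails. -}

module Defs where

open import Data.Nat.Base using (ℕ; _+_)
open import Data.Fin.Base using (Fin; zero; splitAt; _<_)
open import Data.Fin.Properties using (_≟_)
open import Data.Fin.Subset
  using (Subset; _∈_; _∉_; _⊆_; _∩_; _∪_; _-_; ⁅_⁆; ⊤; ⊥; Nonempty)
open import Data.Fin.Subset.Properties using (_∈?_)
open import Data.List.Base using (List; []; _∷_; length; filter; allFin; foldr)
open import Data.Vec.Base using (_++_)
import Data.Sign.Base as Sign
open Sign using (Sign)
open import Data.Product
  using (Σ-syntax; ∃; ∃-syntax; ∃₂; ∃!; _×_; _,_; proj₁; proj₂)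
open import Data.Sum.Base using (_⊎_; [_,_]′)
open import Function.Base using (_∘_)
open import Function.Bundles using (_⇔_)
open import Function.Definitions using (Injective)
open import Relation.Nullary using (¬_; Dec; yes; no)
open import Relation.Nullary.Decidable using (_×-dec_; _⊎-dec_)
open import Relation.Binary.PropositionalEquality using (_≡_; _≢_)
open import Relation.Binary.Construct.Closure.ReflexiveTransitive using (Star)

-- Finite graphs; loops and multiple edges are allowed.  The order in which
-- `ends` lists the two ends of an edge carries no meaning.

record Graph : Set where
  field
    #V #E : ℕ
    ends  : Fin #E → Fin #V × Fin #V

-- `Enumerates f P`: f lists the elements satisfying P without repetition.

Enumerates : {A : Set} {k : ℕ} → (Fin k → A) → (A → Set) → Set
Enumerates f P =
  Injective _≡_ _≡_ f × (∀ i → P (f i)) × (∀ x → P x → ∃[ i ] f i ≡ x)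

Exactly : {A : Set} → ℕ → (A → Set) → Set
Exactly k P = ∃[ f ] Enumerates {k = k} f P

-- k new edges; they come first in the edge set Fin (k + #E).

addEdges : (G : Graph) (k : ℕ) → (Fin k → Fin (Graph.#V G) × Fin (Graph.#V G)) →
           Graph
addEdges G k new = record
  { #V   = #V
  ; #E   = k + #E
  ; ends = [ new , ends ]′ ∘ splitAt k
  }
  where open Graph G

module _ (G : Graph) where
  open Graph G

  -- A set of vertices and a set of edges, not necessarily closed under taking
  -- ends; see IsSubgraph.

  record Sub : Set where
    constructor ⟨_,_⟩
    field
      V : Subset #V
      E : Subset #E

open Sub public

module _ {G : Graph} where
  open Graph G

  infix 4 _⊑_

  _⊑_ : Sub G → Sub G → Set
  H ⊑ K = V H ⊆ V K × E H ⊆ E K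

  Incident : Fin #E → Fin #V → Set
  Incident e x = proj₁ (ends e) ≡ x ⊎ proj₂ (ends e) ≡ x

  incident? : ∀ e x → Dec (Incident e x)
  incident? e x = (proj₁ (ends e) ≟ x) ⊎-dec (proj₂ (ends e) ≟ x)

  IsLoop : Fin #E → Set
  IsLoop e = proj₁ (ends e) ≡ proj₂ (ends e)

  isLoop? : ∀ e → Dec (IsLoop e)
  isLoop? e = proj₁ (ends e) ≟ proj₂ (ends e)

  Joins : Fin #E → Fin #V → Fin #V → Set
  Joins e x y = ends e ≡ (x , y) ⊎ ends e ≡ (y , x)

  -- For e incident with x, the other end of e (x itself if e is a loop).

  otherEnd : Fin #E → Fin #V → Fin #V
  otherEnd e x with proj₁ (ends e) ≟ x
  ... | yes _ = proj₂ (ends e)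
  ... | no  _ = proj₁ (ends e)

  IsSubgraph : Sub G → Set
  IsSubgraph H = ∀ e → e ∈ E H → proj₁ (ends e) ∈ V H × proj₂ (ends e) ∈ V H

  edges : Sub G → List (Fin #E)
  edges H = filter (_∈? E H) (allFin #E)

  edgesAt : Sub G → Fin #V → List (Fin #E)
  edgesAt H x = filter (λ e → incident? e x) (edges H)

  deg : Sub G → Fin #V → ℕ
  deg H x = length (edgesAt H x)

  -- Loops count twice, so that a loop is a circle.

  valency : Sub G → Fin #V → ℕ
  valency H x = deg H x + length (filter isLoop? (edgesAt H x))

  IsConnected : Sub G → Set
  IsConnected H =
    IsSubgraph H × Nonempty (V H) ×
    (∀ x y → x ∈ V H → y ∈ V H → Star (λ a b → ∃[ e ] e ∈ E H × Joins e a b) x y)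

  IsCircle : Sub G → Set
  IsCircle C = IsConnected C × (∀ x → x ∈ V C → valency C x ≡ 2)

  IsPath : Sub G → Fin #V → Fin #V → Set
  IsPath P x y =
    IsConnected P × x ≢ y × x ∈ V P × y ∈ V P ×
    valency P x ≡ 1 × valency P y ≡ 1 ×
    (∀ z → z ∈ V P → z ≢ x → z ≢ y → valency P z ≡ 2)

  -- x is a cutpoint of H if H is the union of two subgraphs, each with an
  -- edge, which have x and nothing else in common.  With this convention a
  -- loop is always a block by itself; for a connected loopless H it says
  -- that deleting x disconnects H.

  IsCutpoint : Sub G → Fin #V → Set
  IsCutpoint H x =
    ∃₂ λ H₁ H₂ →
      IsSubgraph H₁ × IsSubgraph H₂ × Nonempty (E H₁) × Nonempty (E H₂) ×
      H ≡ ⟨ V H₁ ∪ V H₂ , E H₁ ∪ E H₂ ⟩ ×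
      V H₁ ∩ V H₂ ≡ ⁅ x ⁆ × E H₁ ∩ E H₂ ≡ ⊥

  Nonseparable : Sub G → Set
  Nonseparable H = IsConnected H × ¬ ∃ (IsCutpoint H)

  IsBlock : Sub G → Set
  IsBlock B = Nonseparable B × (∀ B′ → Nonseparable B′ → B ⊑ B′ → B′ ≡ B)

  -- b lists the branch vertices; P i j, for i < j, is the path replacing the
  -- edge ij of K₄.

  IsK₄Subdivision : Sub G → Set
  IsK₄Subdivision H =
    Σ[ b ∈ (Fin 4 → Fin #V) ] Σ[ P ∈ (Fin 4 → Fin 4 → Sub G) ]
      Injective _≡_ _≡_ b ×
      (∀ i j → i < j → IsPath (P i j) (b i) (b j)) ×
      (∀ i j k l → i < j → k < l → (i , j) ≢ (k , l) →
         ∀ x → x ∈ V (P i j) → x ∈ V (P k l) →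
         (x ≡ b i ⊎ x ≡ b j) × (x ≡ b k ⊎ x ≡ b l)) ×
      (∀ x → x ∈ V H ⇔ (∃₂ λ i j → i < j × x ∈ V (P i j))) ×
      (∀ e → e ∈ E H ⇔ (∃₂ λ i j → i < j × e ∈ E (P i j)))

  -- Below, H is the graph under consideration and C a circle in it.

  IsChord : Sub G → Sub G → Fin #E → Set
  IsChord H C e =
    e ∈ E H × e ∉ E C × ¬ IsLoop e ×
    proj₁ (ends e) ∈ V C × proj₂ (ends e) ∈ V C

  AvoidsCircle : Sub G → Sub G → Sub G → Set
  AvoidsCircle H C K = K ⊑ H × (∀ x → x ∈ V K → x ∉ V C)

  -- K is a connected component of H \ V(C).

  IsComponentOff : Sub G → Sub G → Sub G → Set
  IsComponentOff H C K =
    IsConnected K × AvoidsCircle H C K ×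
    (∀ K′ → IsConnected K′ → AvoidsCircle H C K′ → K ⊑ K′ → K′ ≡ K)

  -- An edge of H joining K to C.

  Joining : Sub G → Sub G → Sub G → Fin #E → Set
  Joining H C K e =
    e ∈ E H × (∃₂ λ x y → x ∈ V K × y ∈ V C × Joins e x y)

  IsBridge : Sub G → Sub G → Sub G → Set
  IsBridge H C D =
    (∃[ e ] IsChord H C e ×
       D ≡ ⟨ ⁅ proj₁ (ends e) ⁆ ∪ ⁅ proj₂ (ends e) ⁆ , ⁅ e ⁆ ⟩)
    ⊎
    (∃[ K ] IsComponentOff H C K ×
       (∀ x → x ∈ V D ⇔
          (x ∈ V K ⊎ (x ∈ V C × (∃[ e ] Joining H C K e × Incident e x)))) ×
       (∀ e → e ∈ E D ⇔ (e ∈ E K ⊎ Joining H C K e)))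

  attachments : Sub G → Sub G → Subset #V
  attachments C D = V D ∩ V C

  Cross : Sub G → Fin #E → Fin #E → Set
  Cross C e f = IsK₄Subdivision ⟨ V C , E C ∪ (⁅ e ⁆ ∪ ⁅ f ⁆) ⟩

  ChordEndpoint : Sub G → Sub G → Fin #V → Set
  ChordEndpoint H C x = ∃[ e ] IsChord H C e × Incident e x

  IsSegment : Sub G → Sub G → Sub G → Fin #V → Fin #V → Set
  IsSegment H C S x y =
    IsPath S x y × S ⊑ C × ChordEndpoint H C x × ChordEndpoint H C y ×
    (∀ z → z ∈ V S → ChordEndpoint H C z → z ≡ x ⊎ z ≡ y)

  IsHandle : Sub G → Sub G → Sub G → Set
  IsHandle H C S =
    ∃₂ λ x y → IsSegment H C S x y × (∃[ e ] IsChord H C e × Joins e x y)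

-- The conditions on C*, which is C together with the new edges given by
-- `chords`.

module _ (G : Graph) (C : Sub G) {k : ℕ}
         (chords : Fin k → Fin (Graph.#V G) × Fin (Graph.#V G)) where

  G* : Graph
  G* = addEdges G k chords

  C° C* : Sub G*
  C° = ⟨ V C , ⊥ {k} ++ E C ⟩      -- C itself
  C* = ⟨ V C , ⊤ {k} ++ E C ⟩

  LayeredChords : Set
  LayeredChords =
    (∀ e f → IsChord C* C° e → IsChord C* C° f → e ≢ f → ¬ Cross C° e f) ×
    Exactly 2 (IsHandle C* C°)

-- H is C-layered.  The bridges D and, up to the order of each pair, the chords
-- of C* are determined by H and C.

Layered : {G : Graph} → Sub G → Sub G → Set
Layered {G} H C =
  ∃[ k ] Σ[ D ∈ (Fin k → Sub G) ] Σ[ chords ∈ (Fin k → Fin #V × Fin #V) ]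
    Enumerates D (IsBridge H C) ×
    (∀ i → proj₁ (chords i) ≢ proj₂ (chords i) ×
           attachments C (D i) ≡ ⁅ proj₁ (chords i) ⁆ ∪ ⁅ proj₂ (chords i) ⁆) ×
    LayeredChords G C chords
  where open Graph G

theTwo : {A : Set} (xs : List A) → length xs ≡ 2 → A × A
theTwo (x ∷ y ∷ []) _ = x , y

record SignedGraph : Set where
  field
    graph : Graph
  open Graph graph public
  field
    σ : Fin #E → Sign

module _ (S : SignedGraph) where
  open SignedGraph S

  signOf : Sub graph → Sign
  signOf H = foldr (λ e s → σ e Sign.* s) Sign.+ (edges H)

  PositiveCircle : Sub graph → Set
  PositiveCircle C = IsCircle C × signOf C ≡ Sign.+

  Balanced : Sub graph → Set
  Balanced H = ∀ D → IsCircle D → D ⊑ H → signOf D ≡ Sign.+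

  Unbalanced : Sub graph → Set
  Unbalanced H = ¬ Balanced H

  switch : (Fin #V → Sign) → Fin #E → Sign
  switch ζ e = ζ (proj₁ (ends e)) Sign.* σ e Sign.* ζ (proj₂ (ends e))

  IsBalancingEdge : Sub graph → Fin #E → Set
  IsBalancingEdge H b =
    b ∈ E H × (∃[ ζ ] ∀ e → e ∈ E H → switch ζ e ≡ Sign.- ⇔ e ≡ b)

  IsPositiveVertexBattery : Fin #V → Sub graph → Set
  IsPositiveVertexBattery v C =
    PositiveCircle C × v ∈ V C ×
    (∀ D → PositiveCircle D → v ∈ V D → D ≡ C)

  -- H contains exactly one positive circle through v (resp. e).

  UniquePositiveAt : Sub graph → Fin #V → Set
  UniquePositiveAt H v = ∃! _≡_ λ D → PositiveCircle D × D ⊑ H × v ∈ V D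

  UniquePositiveThrough : Sub graph → Fin #E → Set
  UniquePositiveThrough H e = ∃! _≡_ λ D → PositiveCircle D × D ⊑ H × e ∈ E D

  -- B↓v is a subgraph of the signed graph S↓ obtained from S by adding e_v.

  module Suppress (B : Sub graph) (v : Fin #V) (two : deg {graph} B v ≡ 2) where

    e₁ e₂ : Fin #E
    e₁ = proj₁ (theTwo (edgesAt B v) two)
    e₂ = proj₂ (theTwo (edgesAt B v) two)

    S↓ : SignedGraph
    S↓ = record
      { graph = addEdges graph 1 (λ _ → otherEnd {graph} e₁ v , otherEnd {graph} e₂ v)
      ; σ     = [ (λ _ → σ e₁ Sign.* σ e₂) , σ ]′ ∘ splitAt 1
      }

    eᵥ : Fin (1 + #E)
    eᵥ = zero

    -- For H = B this is B↓v, and for a circle H of B through v it is H↓v.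

    ↓ : Sub graph → Sub (SignedGraph.graph S↓)
    ↓ H = ⟨ V H - v , ⊤ {1} ++ (E H - e₁ - e₂) ⟩

module _ (S : SignedGraph) where
  open SignedGraph S

  -- The degree of v counts edges, and B↓v is formed from two edges joining v
  -- to other vertices.  A negative loop at v lies in no positive circle but is
  -- a block in which v has degree 1, so the characterization of vertex
  -- batteries needs this condition; positive loops at v do no harm.

  NoNegativeLoopAt : Fin #V → Set
  NoNegativeLoopAt v = ∀ e → Incident {graph} e v → IsLoop {graph} e → σ e ≡ Sign.+

  module _ (v : Fin #V) (C B₀ : Sub graph) where

    ConditionA : Set
    ConditionA = B₀ ≡ C × PositiveCircle S C

    ConditionB : Set
    ConditionB =
      Unbalanced S B₀ ×
      Σ[ two ∈ deg B₀ v ≡ 2 ]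
        let open Suppress S B₀ v two in
        Layered (↓ B₀) (↓ C) ×
        UniquePositiveThrough S↓ (↓ B₀) eᵥ ×
        PositiveCircle S↓ (↓ C) × ↓ C ⊑ ↓ B₀ × eᵥ ∈ E (↓ C)

    ConditionC : Set
    ConditionC =
      Unbalanced S B₀ × deg B₀ v ≡ 3 ×
      Layered B₀ C × ∃! _≡_ (IsBridge B₀ C) ×
      (∀ D → IsBridge B₀ C D → v ∈ attachments C D) ×
      (∀ e → e ∈ E C → UniquePositiveThrough S B₀ e)

    Condition1 : Set
    Condition1 =
      UniquePositiveAt S B₀ v ×
      (∀ B → IsBlock B → v ∈ V B → UniquePositiveAt S B v → B ≡ B₀) ×
      (ConditionA ⊎ ConditionB ⊎ ConditionC)

    Condition2 : Set
    Condition2 =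
      ∀ B → IsBlock B → v ∈ V B → B ≢ B₀ →
      Σ[ two ∈ deg B v ≡ 2 ]
        let open Suppress S B v two in
        IsBalancingEdge S↓ (↓ B) eᵥ

-- All circles are produced from switching potentials.  If U is a set of edges
-- that are positive after switching by ζ, and U connects the ends of an edge
-- e not in U, then a simple walk in U closes up with e to a circle whose sign
-- is that of e after switching.  So to exhibit a positive circle it suffices
-- to choose U and ζ; nothing has to be checked about simple paths.
--
-- Let C be the only positive circle through its edge e in a block B, switched
-- to be all positive.  Spanning trees of the components of B \ V(C) show that
-- any two attachments of a bridge are joined by a negative detour.  Three
-- attachments would give three pairwise opposite signs, and two detours that
-- are not nested (seen from e) combine to a positive circle; this is the
-- layered structure.  If v is a vertex and two edges at v are not on C, or v
-- has degree 3 and there is a second bridge, the same construction gives a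
-- second positive circle through v.
--
-- In a block B without positive circles through v, deg v = 2 and an
-- st-numbering of B - v (with s and t the neighbours of v) is grown by ears.
-- Choose a potential making the edges to lower neighbours positive.  A
-- negative edge with highest upper end could be completed downwards to s and
-- upwards to t, so that one of the two circles through v is positive.  Hence
-- B - v is balanced.
module Submission where

open import Defs
open import Data.Bool.Base using (true; false; if_then_else_)
open import Data.Empty using (⊥-elim) renaming (⊥ to Absurd)
open import Data.Fin.Base using (Fin; zero; suc; _↑ˡ_; _↑ʳ_; splitAt; punchIn; punchOut)
open import Data.Fin.Properties
  using (_≟_; any?; all?; splitAt-↑ˡ; splitAt-↑ʳ; splitAt⁻¹-↑ˡ; splitAt⁻¹-↑ʳ;
         ↑ʳ-injective; punchInᵢ≢i; punchIn-injective; punchOut-injective;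
         injective⇒≤; <-cmp)
open import Data.Fin.Subset
  using (Subset; _∈_; _∉_; _⊆_; _∩_; _∪_; _-_; ⁅_⁆; ⊤; ⊥; Nonempty; ∣_∣)
open import Data.Fin.Subset.Properties
  using (_∈?_; x∈⁅x⁆; x∈⁅y⁆⇒x≡y; ⊆-antisym; nonempty?; anySubset?; x∈p∩q⁺; x∈p∩q⁻;
         x∈p∪q⁺; x∈p∪q⁻; ∉⊥; p─q⊆p; x∈p∧x≢y⇒x∈p-y; p⊂q⇒∣p∣<∣q∣; ∣p∣≤n;
         p⊆q⇒∣p∣≤∣q∣; _⊆?_)
open import Data.List.Base
  using (List; []; _∷_; length; filter; allFin; foldr; map; lookup; deduplicate;
         cartesianProductWith)
  renaming (_++_ to _++ˡ_)
open import Data.List.Membership.Propositional using () renaming (_∈_ to _∈ˡ_; _∉_ to _∉ˡ_)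
open import Data.List.Membership.Propositional.Properties
  using (∈-filter⁺; ∈-filter⁻; ∈-allFin; ∈-∃++; ∈-lookup; ∈-cartesianProductWith⁺)
  renaming (∈-map⁺ to ∈-mapˡ⁺; ∈-++⁺ˡ to ∈-++ˡ⁺ˡ; ∈-++⁺ʳ to ∈-++ˡ⁺ʳ; ∈-++⁻ to ∈-++ˡ⁻)
open import Data.List.Membership.Propositional.Properties.WithK using (unique∧set⇒bag)
open import Data.List.Relation.Binary.BagAndSetEquality using (∼bag⇒↭)
open import Data.List.Relation.Binary.Permutation.Propositional
  using (_↭_; ↭-sym; ↭-trans; ↭-refl)
open import Data.List.Relation.Binary.Permutation.Propositional.Properties
  using (shift; ∈-resp-↭)
open import Data.List.Relation.Unary.All using ([]; _∷_)
open import Data.List.Relation.Unary.All.Properties using (¬Any⇒All¬; All¬⇒¬Any)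
open import Data.List.Relation.Unary.AllPairs using ([]; _∷_)
open import Data.List.Relation.Unary.Any using (here; there; index)
open import Data.List.Relation.Unary.Any.Properties using (lookup-index)
open import Data.List.Relation.Unary.Unique.Propositional using (Unique)
import Data.List.Relation.Unary.Unique.Propositional.Properties as Uniq
open import Data.Nat.Base
  using (ℕ; zero; suc; _+_; _*_; _∸_; _≤_; _<_; z≤n; s≤s; s≤s⁻¹; _≤‴_; ≤‴-reflexive; ≤‴-step)
open import Data.Nat.Properties
  using (≤-refl; ≤-trans; ≤-reflexive; ≤-antisym; <⇒≤; ≤-<-trans; <-≤-trans; <-trans; <-irrefl;
         n≤1+n; n<1+n; m≤m+n; ≤∧≢⇒<; ≮⇒≥; ≰⇒>; <⇒≱; <⇒≢; +-suc; +-comm; +-assoc;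
         +-identityʳ; +-cancelˡ-≡; +-cancelʳ-≡; ≤⇒≤‴; ≤‴⇒≤; ≤-total; +-monoˡ-≤; +-monoʳ-≤;
         +-mono-≤; +-monoˡ-<; +-monoʳ-<; +-cancelˡ-≤; suc-injective; 1+n≰n; m≤n⇒m<n∨m≡n;
         ≤-irrelevant; <-≤-connex; m+n∸n≡m)
  renaming (_≟_ to _≟ⁿ_; _≤?_ to _≤?ⁿ_; <-cmp to <-cmpⁿ)
open import Data.Nat.Tactic.RingSolver using (solve-∀)
open import Data.Product
  using (Σ-syntax; ∃; ∃-syntax; ∃₂; _×_; _,_; proj₁; proj₂; uncurry)
open import Data.Product.Properties using (,-injective; ≡-dec)
import Data.Sign.Base as Sign
open Sign using (Sign) renaming (+ to ⊕; - to ⊖; _*_ to _·_; opposite to opp)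
open import Data.Sign.Properties using () renaming (_≟_ to _≟ˢ_)
open import Data.Sum.Base using (_⊎_; inj₁; inj₂; [_,_]′) renaming (map to map⊎; swap to swap⊎)
open import Data.Vec.Base using ([]; _∷_; tabulate; here; there) renaming (_++_ to _++ᵛ_)
open import Data.Vec.Properties using (lookup⇒[]=; []=⇒lookup; lookup∘tabulate)
  renaming (≡-dec to ≡-decᵛ)
import Data.Bool.Properties as Boolₚ
open import Function.Base using (_∘_; id; case_of_; flip)
open import Function.Bundles using (_⇔_; mk⇔; module Equivalence)
open import Function.Definitions using (Injective)
open import Relation.Binary.Construct.Closure.ReflexiveTransitive
  using (Star; ε; _◅_; _◅◅_; gmap; reverse)
open import Relation.Binary.Definitions using (DecidableEquality; tri<; tri≈; tri>)
open import Relation.Binary.PropositionalEquality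
  using (_≡_; _≢_; refl; sym; trans; cong; cong₂; subst; subst₂)
open import Relation.Nullary using (¬_; Dec; yes; no; does)
open import Relation.Nullary.Decidable
  using (_×-dec_; _⊎-dec_; _→-dec_; ¬?; dec-true; dec-false; map′; decidable-stable; from-yes)


-- Lists

-- A circle obtained from `U` and a potential is known only by its sign, its root edge and the edges
-- that it may use. Hence uniqueness of `C` is contradicted in one way throughout: `U` is chosen to
-- miss some edge of `C`, so the positive circle that it yields cannot be `C`. Nonseparability is
-- used in a form that speaks of no disjoint paths: if the edges of a block get two colours and both
-- occur, the colours meet at a vertex other than any prescribed one. Suitable colourings (the edges
-- touching a component, the edges of `C`, a single edge) give second attachments, bridges, the
-- absence of loops and connectedness after deletion of a vertex. The property also passes to `B↓v`,
-- where the layered structure for degree 2 is proved. Cut open at its root edge, `C` is a linear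
-- sequence, and a bridge with two attachments is an interval. No two intervals cross or lie side by
-- side, so they form a chain under inclusion; its least and greatest members give the two handles.
-- In the converse direction the sign of `C` is not given in case (c); it is recovered because a
-- circle through an edge of `C` has to follow `C` as far as `v`.

module _ {A : Set} where

  Unique-∷⁺ : {x : A} {xs : List A} → x ∉ˡ xs → Unique xs → Unique (x ∷ xs)
  Unique-∷⁺ x∉ u = ¬Any⇒All¬ _ x∉ ∷ u

  Unique-∷⁻ : {x : A} {xs : List A} → Unique (x ∷ xs) → x ∉ˡ xs
  Unique-∷⁻ (p ∷ _) = All¬⇒¬Any p

  Unique-tail : {x : A} {xs : List A} → Unique (x ∷ xs) → Unique xs
  Unique-tail (_ ∷ u) = u

  abstract
    complement-↭ : {xs ys : List A} → Unique xs → (∀ {x} → x ∈ˡ xs → x ∈ˡ ys) →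
                   ∃[ zs ] ys ↭ xs ++ˡ zs
    complement-↭ {[]}     {ys} _ _ = ys , ↭-refl
    complement-↭ {x ∷ xs} {ys} u sub with ∈-∃++ (sub (here refl))
    ... | as , bs , refl with complement-↭ {xs} {as ++ˡ bs} (Unique-tail u) sub′
      where
      sub′ : ∀ {z} → z ∈ˡ xs → z ∈ˡ as ++ˡ bs
      sub′ z∈ with ∈-resp-↭ (shift x as bs) (sub (there z∈))
      ... | here refl = ⊥-elim (Unique-∷⁻ u z∈)
      ... | there q   = q
    ... | zs , p = zs , ↭-trans (shift x as bs) (_↭_.prep x p)

  Unique-++-disjoint : (xs : List A) {zs : List A} → Unique (xs ++ˡ zs) →
                       ∀ {x} → x ∈ˡ xs → x ∉ˡ zs
  Unique-++-disjoint (y ∷ xs) u (here refl) q = Unique-∷⁻ u (∈-++ˡ⁺ʳ xs q)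
  Unique-++-disjoint (y ∷ xs) u (there p)   q = Unique-++-disjoint xs (Unique-tail u) p q

  Unique-resp-↭ : {xs ys : List A} → xs ↭ ys → Unique xs → Unique ys
  Unique-resp-↭ _↭_.refl u = u
  Unique-resp-↭ (_↭_.prep x p) u =
    Unique-∷⁺ (Unique-∷⁻ u ∘ ∈-resp-↭ (↭-sym p)) (Unique-resp-↭ p (Unique-tail u))
  Unique-resp-↭ (_↭_.swap x y p) (a ∷ b ∷ u) =
    Unique-∷⁺ (λ { (here refl) → All¬⇒¬Any a (here refl)
                 ; (there q) → All¬⇒¬Any b (∈-resp-↭ (↭-sym p) q) })
      (Unique-∷⁺ (All¬⇒¬Any a ∘ there ∘ ∈-resp-↭ (↭-sym p)) (Unique-resp-↭ p u))
  Unique-resp-↭ (_↭_.trans p q) u = Unique-resp-↭ q (Unique-resp-↭ p u)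

  abstract
    sameMembers-↭ : {xs ys : List A} → Unique xs → Unique ys →
                    (∀ x → x ∈ˡ xs ⇔ x ∈ˡ ys) → xs ↭ ys
    sameMembers-↭ u v e = ∼bag⇒↭ (unique∧set⇒bag u v (λ {x} → e x))

  Unique-lookup : {xs : List A} → Unique xs → Injective _≡_ _≡_ (lookup xs)
  Unique-lookup {x ∷ xs} u {zero}  {zero}  _ = refl
  Unique-lookup {x ∷ xs} u {zero}  {suc j} e = ⊥-elim (Unique-∷⁻ u (subst (_∈ˡ xs) (sym e) (∈-lookup j)))
  Unique-lookup {x ∷ xs} u {suc i} {zero}  e = ⊥-elim (Unique-∷⁻ u (subst (_∈ˡ xs) e (∈-lookup i)))
  Unique-lookup {x ∷ xs} u {suc i} {suc j} e = cong suc (Unique-lookup (Unique-tail u) e)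

-- Finite sets

module _ {n : ℕ} {P : Fin n → Set} (P? : ∀ x → Dec (P x)) where

  ⟦_⟧ : Subset n
  ⟦_⟧ = tabulate (does ∘ P?)

  abstract
    ∈⟦⟧⁺ : ∀ {x} → P x → x ∈ ⟦_⟧
    ∈⟦⟧⁺ {x} p = lookup⇒[]= x _ (trans (lookup∘tabulate _ x) (dec-true (P? x) p))

    ∈⟦⟧⁻ : ∀ {x} → x ∈ ⟦_⟧ → P x
    ∈⟦⟧⁻ {x} q with P? x | trans (sym (lookup∘tabulate (does ∘ P?) x)) ([]=⇒lookup q)
    ... | yes p | _ = p

_⇔-dec_ : {A B : Set} → Dec A → Dec B → Dec (A ⇔ B)
a? ⇔-dec b? = map′ (λ (f , g) → mk⇔ f g)
  (λ e → Equivalence.to e , Equivalence.from e) ((a? →-dec b?) ×-dec (b? →-dec a?))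

ends⁺ : ∀ {n} {x y : Fin n} {z} → z ≡ x ⊎ z ≡ y → z ∈ ⁅ x ⁆ ∪ ⁅ y ⁆
ends⁺ (inj₁ refl) = x∈p∪q⁺ (inj₁ (x∈⁅x⁆ _))
ends⁺ (inj₂ refl) = x∈p∪q⁺ (inj₂ (x∈⁅x⁆ _))

ends⁻ : ∀ {n} {x y : Fin n} {z} → z ∈ ⁅ x ⁆ ∪ ⁅ y ⁆ → z ≡ x ⊎ z ≡ y
ends⁻ {x = x} {y} z∈ = map⊎ (x∈⁅y⁆⇒x≡y x) (x∈⁅y⁆⇒x≡y y) (x∈p∪q⁻ ⁅ x ⁆ ⁅ y ⁆ z∈)

∈-⁻ : ∀ {n} {p : Subset n} {x y} → x ∈ p - y → x ∈ p × x ≢ y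
∈-⁻ {p = p} {x} {y} q = p─q⊆p p ⁅ y ⁆ q , λ { refl → x∉p-x p x q }
  where
  x∉p-x : ∀ {n} (p : Subset n) x → x ∉ p - x
  x∉p-x (true  ∷ p) zero ()
  x∉p-x (false ∷ p) zero ()
  x∉p-x (_ ∷ p) (suc x) (there q) = x∉p-x p x q

Sub-ext : ∀ {G} {H K : Sub G} → H ⊑ K → K ⊑ H → H ≡ K
Sub-ext (a , b) (c , d) = cong₂ ⟨_,_⟩ (⊆-antisym a c) (⊆-antisym b d)

_≟ₛ_ : ∀ {G} → DecidableEquality (Sub G)
H ≟ₛ K = map′ (λ (p , q) → cong₂ ⟨_,_⟩ p q) (λ { refl → refl , refl })
  (≡-decᵛ Boolₚ._≟_ (V H) (V K) ×-dec ≡-decᵛ Boolₚ._≟_ (E H) (E K))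

_⊑?_ : ∀ {G} (H K : Sub G) → Dec (H ⊑ K)
H ⊑? K = (V H ⊆? V K) ×-dec (E H ⊆? E K)

_⊔_ : ∀ {G} → Sub G → Sub G → Sub G
H ⊔ K = ⟨ V H ∪ V K , E H ∪ E K ⟩

abstract
  anySub? : ∀ {G} {P : Sub G → Set} → (∀ H → Dec (P H)) → Dec (∃ P)
  anySub? P? = map′ (λ (a , b , p) → ⟨ a , b ⟩ , p) (λ (H , p) → V H , E H , p)
    (anySubset? λ a → anySubset? λ b → P? ⟨ a , b ⟩)

abstract
  allSub? : ∀ {G} {P : Sub G → Set} → (∀ H → Dec (P H)) → Dec (∀ H → P H)
  allSub? P? with anySub? (λ H → ¬? (P? H))
  ... | yes (H , ¬p) = no λ f → ¬p (f H)
  ... | no  ¬∃       = yes λ H → decidable-stable (P? H) λ ¬p → ¬∃ (H , ¬p)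

subsets : ∀ n → List (Subset n)
subsets zero    = [] ∷ []
subsets (suc n) = map (true ∷_) (subsets n) ++ˡ map (false ∷_) (subsets n)

∈-subsets : ∀ {n} (p : Subset n) → p ∈ˡ subsets n
∈-subsets []          = here refl
∈-subsets (true ∷ p)  = ∈-++ˡ⁺ˡ (∈-mapˡ⁺ (true ∷_) (∈-subsets p))
∈-subsets (false ∷ p) = ∈-++ˡ⁺ʳ (map (true ∷_) (subsets _)) (∈-mapˡ⁺ (false ∷_) (∈-subsets p))

abstract
  -- `Layered` asks for a list of all bridges without repetition. Being a bridge is decidable, so
  -- the bridges can be filtered from all pairs of subsets; `deduplicate` supplies injectivity.
  enumerateSubs : ∀ {G} {P : Sub G → Set} → (∀ H → Dec (P H)) →
                  ∃[ k ] Exactly k P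
  enumerateSubs {G} {P} P? = length xs , lookup xs ,
      Unique-lookup (deduplicate-! _≟ₛ_ ys) , sound ,
      (λ H p → index (mem H p) , sym (lookup-index (mem H p)))
    where
    open import Data.List.Relation.Unary.Unique.DecPropositional.Properties using (deduplicate-!)
    open import Data.List.Membership.Propositional.Properties using (∈-deduplicate⁺; ∈-deduplicate⁻)
    ys xs : List (Sub G)
    ys = filter P? (cartesianProductWith ⟨_,_⟩ (subsets _) (subsets _))
    xs = deduplicate _≟ₛ_ ys
    mem : ∀ H → P H → H ∈ˡ xs
    mem H p = ∈-deduplicate⁺ _≟ₛ_
      (∈-filter⁺ P? (∈-cartesianProductWith⁺ ⟨_,_⟩ (∈-subsets (V H)) (∈-subsets (E H))) p)
    sound : ∀ i → P (lookup xs i)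
    sound i = proj₂ (∈-filter⁻ P? {xs = cartesianProductWith ⟨_,_⟩ (subsets _) (subsets _)}
      (∈-deduplicate⁻ _≟ₛ_ ys (∈-lookup i)))

abstract
  -- Applied to inclusion of chord intervals and to its converse, this gives the innermost and the
  -- outermost chord. The relation is only a total preorder, since several chords may have the same
  -- ends.
  leastOf : ∀ {n} {R : Fin (suc n) → Fin (suc n) → Set} →
            (∀ i → R i i) → (∀ {i j k} → R i j → R j k → R i k) →
            (∀ i j → R i j ⊎ R j i) → ∃[ i ] ∀ j → R i j
  leastOf {zero} r t c = zero , λ { zero → r zero }
  leastOf {suc n} r t c with leastOf (λ i → r (suc i)) t (λ i j → c (suc i) (suc j))
  ... | i , m with c zero (suc i)
  ... | inj₁ p = zero , λ { zero → r zero ; (suc j) → t p (m j) }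
  ... | inj₂ p = suc i , λ { zero → p ; (suc j) → m j }

-- Signs

∀ˢ : {P : Sign → Set} → (∀ s → Dec (P s)) → Dec (∀ s → P s)
∀ˢ P? = map′ (λ { (p , m) ⊕ → p ; (p , m) ⊖ → m }) (λ f → f ⊕ , f ⊖) (P? ⊕ ×-dec P? ⊖)

·-same : {s t : Sign} → s ≡ t → s · t ≡ ⊕
·-same {⊕} refl = refl
·-same {⊖} refl = refl

-- Three attachments of a bridge, or three edges at `v`, always include two of equal sign, and equal
-- signs close up to a positive circle.
sign-pigeonhole : (r s t : Sign) → r ≡ s ⊎ r ≡ t ⊎ s ≡ t
sign-pigeonhole = from-yes (∀ˢ λ r → ∀ˢ λ s → ∀ˢ λ t → (r ≟ˢ s) ⊎-dec (r ≟ˢ t) ⊎-dec (s ≟ˢ t))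


-- Walks and valencies

module Walks (G : Graph) where
  open Graph G
  open import Data.List.Membership.DecPropositional (_≟_ {#V}) using () renaming (_∈?_ to _∈ᵛ?_) public
  open import Data.List.Membership.DecPropositional (_≟_ {#E}) using () renaming (_∈?_ to _∈ᵉ?_) public

  Jn : Fin #E → Fin #V → Fin #V → Set
  Jn = Joins {G}

  Inc : Fin #E → Fin #V → Set
  Inc = Incident {G}

  Loop : Fin #E → Set
  Loop = IsLoop {G}

  Jn-sym : ∀ {e x y} → Jn e x y → Jn e y x
  Jn-sym = swap⊎

  Jn-Inc : ∀ {e x y} → Jn e x y → Inc e x
  Jn-Inc (inj₁ refl) = inj₁ refl
  Jn-Inc (inj₂ refl) = inj₂ refl

  Jn-Incʳ : ∀ {e x y} → Jn e x y → Inc e y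
  Jn-Incʳ j = Jn-Inc (Jn-sym j)

  Inc-Jn : ∀ {e x} → Inc e x → ∃[ y ] Jn e x y
  Inc-Jn (inj₁ refl) = _ , inj₁ refl
  Inc-Jn (inj₂ refl) = _ , inj₂ refl

  Jn-ends : ∀ e → Jn e (proj₁ (ends e)) (proj₂ (ends e))
  Jn-ends e = inj₁ refl

  Jn-only : ∀ {e x y u} → Jn e x y → Inc e u → u ≡ x ⊎ u ≡ y
  Jn-only (inj₁ refl) (inj₁ refl) = inj₁ refl
  Jn-only (inj₁ refl) (inj₂ refl) = inj₂ refl
  Jn-only (inj₂ refl) (inj₁ refl) = inj₂ refl
  Jn-only (inj₂ refl) (inj₂ refl) = inj₁ refl

  Jn-end : ∀ {e x y z} → Jn e x y → Jn e x z → y ≡ z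
  Jn-end (inj₁ p) (inj₁ q) = proj₂ (,-injective (trans (sym p) q))
  Jn-end (inj₂ p) (inj₂ q) = proj₁ (,-injective (trans (sym p) q))
  Jn-end (inj₁ p) (inj₂ q) with ,-injective (trans (sym p) q)
  ... | a , b = trans b a
  Jn-end (inj₂ p) (inj₁ q) with ,-injective (trans (sym p) q)
  ... | a , b = trans a b

  Loop-Jn : ∀ {e x} → Jn e x x → Loop e
  Loop-Jn j with ,-injective ([ id , id ]′ j)
  ... | a , b = trans a (sym b)

  Jn-Loop : ∀ {e x y} → Loop e → Jn e x y → x ≡ y
  Jn-Loop l (inj₁ refl) = l
  Jn-Loop l (inj₂ refl) = sym l

  otherEnd-Jn : ∀ {e x} → Inc e x → Jn e x (otherEnd {G} e x)
  otherEnd-Jn {e} {x} i with proj₁ (ends e) ≟ x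
  ... | yes refl = inj₁ refl
  ... | no ¬p with i
  ...   | inj₁ p    = ⊥-elim (¬p p)
  ...   | inj₂ refl = inj₂ refl

  ends∈ : ∀ {H} → IsSubgraph H → ∀ {e x} → e ∈ E H → Inc e x → x ∈ V H
  ends∈ s {e} e∈ (inj₁ refl) = proj₁ (s e e∈)
  ends∈ s {e} e∈ (inj₂ refl) = proj₂ (s e e∈)

  Linked : (Fin #E → Set) → Fin #V → Fin #V → Set
  Linked U x y = ∃[ e ] U e × Jn e x y

  Connects : (Fin #E → Set) → Fin #V → Fin #V → Set
  Connects U = Star (Linked U)

  Connects-sym : ∀ {U x y} → Connects U x y → Connects U y x
  Connects-sym = reverse λ (e , u , j) → e , u , Jn-sym j

  Connects-mono : ∀ {U U′ : Fin #E → Set} {x y} → (∀ {e} → U e → U′ e) → Connects U x y → Connects U′ x y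
  Connects-mono f = gmap id λ (e , u , j) → e , f u , j

  edge : ∀ {U : Fin #E → Set} {e x y} → U e → Jn e x y → Connects U x y
  edge u j = (_ , u , j) ◅ ε

  Connects-invariant : ∀ {U} (Q : Fin #V → Set) →
    (∀ {e x y} → U e → Jn e x y → Q x → Q y) → ∀ {x y} → Connects U x y → Q x → Q y
  Connects-invariant Q f ε q = q
  Connects-invariant Q f ((e , u , j) ◅ s) q = Connects-invariant Q f s (f u j q)

  δ : Fin #V → Fin #V → ℕ
  δ x u = if does (x ≟ u) then 1 else 0

  δ-refl : ∀ x → δ x x ≡ 1
  δ-refl x rewrite dec-true (x ≟ x) refl = refl

  δ-≢ : ∀ {x u} → x ≢ u → δ x u ≡ 0
  δ-≢ {x} {u} n rewrite dec-false (x ≟ u) n = refl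

  -- Ends rather than incident edges are counted, so that a loop contributes 2 and the counts along
  -- walks treat loops like other edges.
  ends# : Fin #E → Fin #V → ℕ
  ends# e u = δ (proj₁ (ends e)) u + δ (proj₂ (ends e)) u

  ends#-Jn : ∀ {e x y} u → Jn e x y → ends# e u ≡ δ x u + δ y u
  ends#-Jn u (inj₁ refl) = refl
  ends#-Jn {x = x} {y} u (inj₂ refl) = +-comm (δ y u) (δ x u)

  ends#-Inc : ∀ {e u} → Inc e u → 1 ≤ ends# e u
  ends#-Inc {e} {u} i with Inc-Jn i
  ... | y , j rewrite ends#-Jn u j | δ-refl u = s≤s z≤n

  Inc-ends# : ∀ {e u} → 1 ≤ ends# e u → Inc e u
  Inc-ends# {e} {u} p with proj₁ (ends e) ≟ u | proj₂ (ends e) ≟ u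
  ... | yes a | _     = inj₁ a
  ... | no _  | yes b = inj₂ b
  Inc-ends# () | no _  | no _

  val : List (Fin #E) → Fin #V → ℕ
  val []       u = 0
  val (e ∷ es) u = ends# e u + val es u

  val-++ : ∀ xs ys u → val (xs ++ˡ ys) u ≡ val xs u + val ys u
  val-++ []       ys u = refl
  val-++ (x ∷ xs) ys u = trans (cong (ends# x u +_) (val-++ xs ys u))
                               (sym (+-assoc (ends# x u) (val xs u) (val ys u)))

  val-↭ : ∀ {xs ys} u → xs ↭ ys → val xs u ≡ val ys u
  val-↭ u _↭_.refl = refl
  val-↭ u (_↭_.prep x p) = cong (ends# x u +_) (val-↭ u p)
  val-↭ {_ ∷ _ ∷ xs} {_ ∷ _ ∷ ys} u (_↭_.swap x y p) rewrite val-↭ u p = lem (ends# x u) (ends# y u) (val ys u)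
    where
    lem : ∀ a b c → a + (b + c) ≡ b + (a + c)
    lem = solve-∀
  val-↭ u (_↭_.trans p q) = trans (val-↭ u p) (val-↭ u q)

  val-positive : ∀ xs {u} → 1 ≤ val xs u → ∃[ e ] e ∈ˡ xs × Inc e u
  val-positive (x ∷ xs) {u} p with ends# x u in eq
  ... | suc _ = x , here refl , Inc-ends# (subst (1 ≤_) (sym eq) (s≤s z≤n))
  ... | zero  with val-positive xs p
  ...   | e , e∈ , i = e , there e∈ , i

  abstract
    -- Links `valency`, which counts a loop among the incident edges and once more among the loops,
    -- with the additive count of ends.
    valencyOf-list : ∀ xs u →
      length (filter (λ e → incident? {G} e u) xs) +
      length (filter (isLoop? {G}) (filter (λ e → incident? {G} e u) xs)) ≡ val xs u
    valencyOf-list []       u = refl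
    valencyOf-list (x ∷ xs) u with proj₁ (ends x) ≟ u | proj₂ (ends x) ≟ u
    ... | no _ | no _ = valencyOf-list xs u
    ... | yes a | yes b with proj₁ (ends x) ≟ proj₂ (ends x)
    ...   | yes _ rewrite +-suc (length (filter (λ e → incident? {G} e u) xs))
                                (length (filter (isLoop? {G}) (filter (λ e → incident? {G} e u) xs)))
                  = cong (2 +_) (valencyOf-list xs u)
    ...   | no c = ⊥-elim (c (trans a (sym b)))
    valencyOf-list (x ∷ xs) u | yes a | no b with proj₁ (ends x) ≟ proj₂ (ends x)
    ...   | yes c = ⊥-elim (b (trans (sym c) a))
    ...   | no _ = cong suc (valencyOf-list xs u)
    valencyOf-list (x ∷ xs) u | no a | yes b with proj₁ (ends x) ≟ proj₂ (ends x)
    ...   | yes c = ⊥-elim (a (trans c b))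
    ...   | no _ = cong suc (valencyOf-list xs u)

  valency-val : ∀ H u → valency {G} H u ≡ val (edges H) u
  valency-val H u = valencyOf-list (edges H) u

  edges-Unique : ∀ H → Unique (edges {G} H)
  edges-Unique H = Uniq.filter⁺ (_∈? E H) (Uniq.allFin⁺ #E)

  ∈-edges⁺ : ∀ {H e} → e ∈ E H → e ∈ˡ edges {G} H
  ∈-edges⁺ {H} {e} p = ∈-filter⁺ (_∈? E H) (∈-allFin e) p

  ∈-edges⁻ : ∀ {H e} → e ∈ˡ edges {G} H → e ∈ E H
  ∈-edges⁻ {H} p = proj₂ (∈-filter⁻ (_∈? E H) {xs = allFin #E} p)

  edgesAt-Unique : ∀ H u → Unique (edgesAt {G} H u)
  edgesAt-Unique H u = Uniq.filter⁺ (λ e → incident? {G} e u) (edges-Unique H)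

  ∈-edgesAt⁺ : ∀ {H e u} → e ∈ E H → Inc e u → e ∈ˡ edgesAt {G} H u
  ∈-edgesAt⁺ {H} {e} {u} p i = ∈-filter⁺ (λ e → incident? {G} e u) (∈-edges⁺ {H} p) i

  ∈-edgesAt⁻ : ∀ {H e u} → e ∈ˡ edgesAt {G} H u → e ∈ E H × Inc e u
  ∈-edgesAt⁻ {H} {e} {u} p with ∈-filter⁻ (λ e → incident? {G} e u) {xs = edges H} p
  ... | q , i = ∈-edges⁻ {H} q , i

  abstract
    edges-↭ : ∀ {H xs} → Unique xs → (∀ {e} → e ∈ˡ xs → e ∈ E H) → (∀ {e} → e ∈ E H → e ∈ˡ xs) →
              edges {G} H ↭ xs
    edges-↭ {H} u f g = sameMembers-↭ (edges-Unique H) u λ e → mk⇔ (g ∘ ∈-edges⁻ {H}) (∈-edges⁺ {H} ∘ f)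

  abstract
    edges-split : ∀ {H xs} → Unique xs → (∀ {e} → e ∈ˡ xs → e ∈ E H) → ∃[ zs ] edges {G} H ↭ xs ++ˡ zs
    edges-split {H} u f = complement-↭ u (∈-edges⁺ {H} ∘ f)

  abstract
    val≤valency : ∀ {H xs} u → Unique xs → (∀ {e} → e ∈ˡ xs → e ∈ E H) → val xs u ≤ valency {G} H u
    val≤valency {H} {xs} u q f with edges-split {H} q f
    ... | zs , p rewrite valency-val H u | val-↭ u p | val-++ xs zs u = m≤m+n _ _

  abstract
    -- The list `edges H` is a permutation of `xs` followed by the remaining edges, and `val` is
    -- additive, so the surplus comes from a remaining edge. This is how a walk inside a circle is
    -- prolonged.
    val<valency : ∀ {H xs} u → Unique xs → (∀ {e} → e ∈ˡ xs → e ∈ E H) → val xs u < valency {G} H u →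
                  ∃[ h ] h ∈ E H × h ∉ˡ xs × Inc h u
    val<valency {H} {xs} u q f l with edges-split {H} q f
    ... | zs , p rewrite valency-val H u | val-↭ u p | val-++ xs zs u
      with val-positive zs {u} (+-cancelˡ-≤ (val xs u) _ _ (subst (_≤ val xs u + val zs u) (+-comm 1 (val xs u)) l))
    ... | h , h∈ , i = h , ∈-edges⁻ {H} (∈-resp-↭ (↭-sym p) (∈-++ˡ⁺ʳ xs h∈)) ,
                       (λ h∈xs → Unique-++-disjoint xs (Unique-resp-↭ p (edges-Unique H)) h∈xs h∈) , i

  valency-exact : ∀ {H xs} u → Unique xs → (∀ {e} → e ∈ˡ xs → e ∈ E H) → (∀ {e} → e ∈ E H → e ∈ˡ xs) →
                  valency {G} H u ≡ val xs u
  valency-exact {H} u q f g = trans (valency-val H u) (val-↭ u (edges-↭ {H} q f g))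

  valency-edge : ∀ {H u} → 1 ≤ valency {G} H u → ∃[ h ] h ∈ E H × Inc h u
  valency-edge {H} {u} l with val<valency {H} {[]} u [] (λ ()) l
  ... | h , h∈ , _ , i = h , h∈ , i

  data W : Fin #V → Fin #V → Set where
    nil  : ∀ x → W x x
    step : ∀ {x y z} e → Jn e x y → W y z → W x z

  vs : ∀ {x y} → W x y → List (Fin #V)
  vs (nil x)            = x ∷ []
  vs (step {x} e j P) = x ∷ vs P

  es : ∀ {x y} → W x y → List (Fin #E)
  es (nil x)      = []
  es (step e j P) = e ∷ es P

  source∈ : ∀ {x y} (P : W x y) → x ∈ˡ vs P
  source∈ (nil x)      = here refl
  source∈ (step e j P) = here refl

  target∈ : ∀ {x y} (P : W x y) → y ∈ˡ vs P
  target∈ (nil x)      = here refl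
  target∈ (step e j P) = there (target∈ P)

  es-Inc : ∀ {x y} (P : W x y) {e u} → e ∈ˡ es P → Inc e u → u ∈ˡ vs P
  es-Inc (step e j P) (here refl) i with Jn-only j i
  ... | inj₁ refl = here refl
  ... | inj₂ refl = there (source∈ P)
  es-Inc (step e j P) (there p) i = there (es-Inc P p i)

  es-Unique : ∀ {x y} (P : W x y) → Unique (vs P) → Unique (es P)
  es-Unique (nil x) u = []
  es-Unique (step e j P) u =
    Unique-∷⁺ (λ e∈ → Unique-∷⁻ u (es-Inc P e∈ (Jn-Inc j))) (es-Unique P (Unique-tail u))

  walk-Connects : ∀ {U x y} (P : W x y) → (∀ {e} → e ∈ˡ es P → U e) → ∀ {u} → u ∈ˡ vs P → Connects U x u
  walk-Connects (nil x) f (here refl) = ε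
  walk-Connects (step e j P) f (here refl) = ε
  walk-Connects (step e j P) f (there p) = (e , f (here refl) , j) ◅ walk-Connects P (f ∘ there) p

  abstract
    suffix : ∀ {x y u} (P : W x y) → u ∈ˡ vs P → Σ[ Q ∈ W u y ]
      (∀ {e} → e ∈ˡ es Q → e ∈ˡ es P) × (∀ {z} → z ∈ˡ vs Q → z ∈ˡ vs P) × (Unique (vs P) → Unique (vs Q))
    suffix (nil x) (here refl) = nil x , id , id , id
    suffix P@(step e j P′) (here refl) = P , id , id , id
    suffix (step e j P) (there p) with suffix P p
    ... | Q , f , g , h = Q , there ∘ f , there ∘ g , h ∘ Unique-tail

  abstract
    -- Loop erasure: if the new first vertex already lies on the simple walk built for the rest, the
    -- suffix from that occurrence is taken.
    simpleWalk : ∀ {U x y} → Connects U x y → Σ[ P ∈ W x y ] Unique (vs P) × (∀ {e} → e ∈ˡ es P → U e)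
    simpleWalk {x = x} ε = nil x , [] ∷ [] , λ ()
    simpleWalk {x = x} ((e , u , j) ◅ s) with simpleWalk s
    ... | P , q , f with x ∈ᵛ? vs P
    ... | no x∉ = step e j P , Unique-∷⁺ x∉ q , λ { (here refl) → u ; (there p) → f p }
    ... | yes x∈ with suffix P x∈
    ... | Q , g , _ , h = Q , h q , f ∘ g

  cnt : List (Fin #V) → Fin #V → ℕ
  cnt []       u = 0
  cnt (x ∷ xs) u = δ x u + cnt xs u

  cnt-∉ : ∀ {xs u} → u ∉ˡ xs → cnt xs u ≡ 0
  cnt-∉ {[]}     p = refl
  cnt-∉ {x ∷ xs} p rewrite δ-≢ (p ∘ here ∘ sym) = cnt-∉ (p ∘ there)

  cnt-∈ : ∀ {xs u} → Unique xs → u ∈ˡ xs → cnt xs u ≡ 1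
  cnt-∈ {x ∷ xs} q (here refl) rewrite δ-refl x = cong suc (cnt-∉ (Unique-∷⁻ q))
  cnt-∈ {x ∷ xs} {u} q (there p)
    rewrite δ-≢ {x} {u} (λ { refl → Unique-∷⁻ q p }) = cnt-∈ (Unique-tail q) p

  -- Each occurrence of `u` on the walk has two sides. Every side carries an end of a walk edge,
  -- except the outer sides at the two ends of the walk, which `δ x u` and `δ y u` count.
  walk-val : ∀ {x y} (P : W x y) u → 2 * cnt (vs P) u ≡ val (es P) u + δ x u + δ y u
  walk-val (nil x) u = lem (δ x u)
    where
    lem : ∀ a → 2 * (a + 0) ≡ 0 + a + a
    lem = solve-∀
  walk-val {x} {z} (step {y = y} e j P) u rewrite ends#-Jn u j =
    trans (lem₁ (δ x u) (cnt (vs P) u))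
      (trans (cong (2 * δ x u +_) (walk-val P u)) (lem₂ (δ x u) (val (es P) u) (δ y u) (δ z u)))
    where
    lem₁ : ∀ a c → 2 * (a + c) ≡ 2 * a + 2 * c
    lem₁ = solve-∀
    lem₂ : ∀ a v b c → 2 * a + (v + b + c) ≡ (a + b + v) + a + c
    lem₂ = solve-∀

  -- Here `e` continues the walk beyond `y` to `x`. For `x ≡ z` the closed walk has two ends per
  -- visit; for `x ≢ z` an end is missing at `z`, and there the walk has to go on.
  closed-val : ∀ {z y e x} (P : W z y) → Jn e y x → ∀ u →
               val (e ∷ es P) u + δ z u ≡ 2 * cnt (vs P) u + δ x u
  closed-val {z} {y} {e} {x} P j u rewrite ends#-Jn u j | walk-val P u =
    lem (δ y u) (δ x u) (val (es P) u) (δ z u)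
    where
    lem : ∀ y x v z → (y + x + v) + z ≡ (v + z + y) + x
    lem = solve-∀

  mkSub : List (Fin #V) → List (Fin #E) → Sub G
  mkSub xs ys = ⟨ ⟦ _∈ᵛ? xs ⟧ , ⟦ _∈ᵉ? ys ⟧ ⟩

  trail : ∀ {x y} → W x y → Sub G
  trail P = mkSub (vs P) (es P)

  closed : ∀ {x y} → Fin #E → W x y → Sub G
  closed e P = mkSub (vs P) (e ∷ es P)

  ∈V-mk⁺ : ∀ {xs ys u} → u ∈ˡ xs → u ∈ V (mkSub xs ys)
  ∈V-mk⁺ {xs} = ∈⟦⟧⁺ (_∈ᵛ? xs)
  ∈V-mk⁻ : ∀ {xs ys u} → u ∈ V (mkSub xs ys) → u ∈ˡ xs
  ∈V-mk⁻ {xs} = ∈⟦⟧⁻ (_∈ᵛ? xs)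
  ∈E-mk⁺ : ∀ {xs ys e} → e ∈ˡ ys → e ∈ E (mkSub xs ys)
  ∈E-mk⁺ {xs} {ys} = ∈⟦⟧⁺ (_∈ᵉ? ys)
  ∈E-mk⁻ : ∀ {xs ys e} → e ∈ E (mkSub xs ys) → e ∈ˡ ys
  ∈E-mk⁻ {xs} {ys} = ∈⟦⟧⁻ (_∈ᵉ? ys)

  mkSub-⊑ : ∀ {xs ys H} → (∀ {u} → u ∈ˡ xs → u ∈ V H) → (∀ {e} → e ∈ˡ ys → e ∈ E H) → mkSub xs ys ⊑ H
  mkSub-⊑ {xs} {ys} f g = f ∘ ∈V-mk⁻ {xs} {ys} , g ∘ ∈E-mk⁻ {xs} {ys}

  abstract
    walk-connected : ∀ {x y} (P : W x y) ys → (∀ {e} → e ∈ˡ es P → e ∈ˡ ys) →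
                     (∀ {e u} → e ∈ˡ ys → Inc e u → u ∈ˡ vs P) → IsConnected (mkSub (vs P) ys)
    walk-connected {x} P ys f g =
      (λ e e∈ → let e∈′ = ∈E-mk⁻ {vs P} {ys} e∈ in
         ∈V-mk⁺ {vs P} {ys} (g e∈′ (inj₁ refl)) , ∈V-mk⁺ {vs P} {ys} (g e∈′ (inj₂ refl))) ,
      (x , ∈V-mk⁺ {vs P} {ys} (source∈ P)) ,
      λ a b a∈ b∈ → Connects-sym (to a∈) ◅◅ to b∈
      where
      to : ∀ {a} → a ∈ V (mkSub (vs P) ys) → Connects (_∈ E (mkSub (vs P) ys)) x a
      to a∈ = walk-Connects P (∈E-mk⁺ {vs P} {ys} ∘ f) (∈V-mk⁻ {vs P} {ys} a∈)

  mkSub-valency : ∀ xs {ys} u → Unique ys → valency {G} (mkSub xs ys) u ≡ val ys u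
  mkSub-valency xs {ys} u q = valency-exact {mkSub xs ys} u q (∈E-mk⁺ {xs} {ys}) (∈E-mk⁻ {xs} {ys})

  closed-Unique : ∀ {x y e} (P : W x y) → Unique (vs P) → e ∉ˡ es P → Unique (e ∷ es P)
  closed-Unique P q e∉ = Unique-∷⁺ e∉ (es-Unique P q)

  closed-val-2 : ∀ {x y e} (P : W x y) → Unique (vs P) → Jn e y x → ∀ {u} → u ∈ˡ vs P →
                 val (e ∷ es P) u ≡ 2
  closed-val-2 {x} {y} {e} P q j {u} u∈ = +-cancelʳ-≡ (δ x u) _ _
    (trans (closed-val P j u) (cong (λ c → 2 * c + δ x u) (cnt-∈ q u∈)))

  abstract
    closed-circle : ∀ {x y e} (P : W x y) → Unique (vs P) → Jn e y x → e ∉ˡ es P → IsCircle (closed e P)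
    closed-circle {x} {y} {e} P q j e∉ =
      walk-connected P (e ∷ es P) there
        (λ { (here refl) i → [ (λ { refl → target∈ P }) , (λ { refl → source∈ P }) ]′ (Jn-only j i)
           ; (there p) i → es-Inc P p i }) ,
      λ u u∈ → trans (mkSub-valency (vs P) u (closed-Unique P q e∉))
                 (closed-val-2 P q j (∈V-mk⁻ {vs P} {e ∷ es P} u∈))

  abstract
    trail-path : ∀ {x y} (P : W x y) → Unique (vs P) → x ≢ y → IsPath (trail P) x y
    trail-path {x} {y} P q x≢y =
      walk-connected P (es P) id (es-Inc P) , x≢y , ∈V-mk⁺ {vs P} {es P} (source∈ P) ,
      ∈V-mk⁺ {vs P} {es P} (target∈ P) ,
      at 1 (source∈ P) (cong₂ _+_ (δ-refl x) (δ-≢ (x≢y ∘ sym))) ,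
      at 1 (target∈ P) (cong₂ _+_ (δ-≢ x≢y) (δ-refl y)) ,
      λ z z∈ z≢x z≢y → at 0 (∈V-mk⁻ {vs P} {es P} z∈) (cong₂ _+_ (δ-≢ (z≢x ∘ sym)) (δ-≢ (z≢y ∘ sym)))
      where
      at : ∀ {u} k → u ∈ˡ vs P → δ x u + δ y u ≡ k → valency {G} (trail P) u ≡ 2 ∸ k
      at {u} k u∈ refl = trans (mkSub-valency (vs P) u (es-Unique P q)) (lem _ _ (sym
        (trans (cong (2 *_) (sym (cnt-∈ q u∈))) (trans (walk-val P u) (+-assoc (val (es P) u) (δ x u) (δ y u))))))
        where
        lem : ∀ a b → a + b ≡ 2 → a ≡ 2 ∸ b
        lem a b p = trans (sym (m+n∸n≡m a b)) (cong (_∸ b) p)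

  Unique-length≤ : ∀ {xs : List (Fin #V)} → Unique xs → length xs ≤ #V
  Unique-length≤ q = injective⇒≤ (Unique-lookup q)

  abstract
    circle-maximal : ∀ {C es} → Unique es → (∀ {e} → e ∈ˡ es → e ∈ E C) → ∀ {u} → valency {G} C u ≡ 2 →
                     2 ≤ val es u → ∀ {h} → h ∈ E C → Inc h u → h ∈ˡ es
    circle-maximal {C} {es} q f {u} v2 l {h} h∈ i with h ∈ᵉ? es
    ... | yes p = p
    ... | no ¬p = ⊥-elim (1+n≰n (≤-trans (+-mono-≤ (ends#-Inc i) l)
      (≤-trans (val≤valency {C} {h ∷ es} u (Unique-∷⁺ ¬p q) λ { (here refl) → h∈ ; (there p) → f p })
        (≤-reflexive v2))))

  abstract
    -- A simple walk ending in `y` is prolonged at its first vertex `z`. While `z ≢ x`, the walk and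
    -- `e` use only one end at `z`, so `C` has a further edge there, and it leads to a new vertex.
    -- Once `x` is reached every vertex of the walk is saturated, and connectedness of `C` leaves
    -- nothing else.
    circle-closed : ∀ {C e x y} → IsCircle C → e ∈ E C → Jn e y x →
                    Σ[ P ∈ W x y ] Unique (vs P) × e ∉ˡ es P × C ≡ closed e P
    circle-closed {C} {e} {x} {y} ((sub , _ , conn) , v2) e∈ j =
      finish (grow (#V) (nil y) ([] ∷ []) (λ ()) (λ ()) (+-comm #V 1))
      where
      Grown : Fin #V → Set
      Grown z = Σ[ P ∈ W z y ] Unique (vs P) × (∀ {h} → h ∈ˡ es P → h ∈ E C) × e ∉ˡ es P

      vs⊆ : ∀ {z} (P : W z y) → (∀ {h} → h ∈ˡ es P → h ∈ E C) → ∀ {u} → u ∈ˡ vs P → u ∈ V C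
      vs⊆ (nil _) f (here refl) = ends∈ sub e∈ (Jn-Inc j)
      vs⊆ (step h k P) f (here refl) = ends∈ sub (f (here refl)) (Jn-Inc k)
      vs⊆ (step h k P) f (there p) = vs⊆ P (f ∘ there) p

      all : ∀ {z} {P : W z y} → (∀ {h} → h ∈ˡ es P → h ∈ E C) → ∀ {h} → h ∈ˡ e ∷ es P → h ∈ E C
      all f (here refl) = e∈
      all f (there p)   = f p

      -- `k` is fuel: the walk repeats no vertex, so its number of vertices cannot reach `suc #V`,
      -- the value forced by `k ≡ 0`.
      grow : ∀ k {z} (P : W z y) → Unique (vs P) → (∀ {h} → h ∈ˡ es P → h ∈ E C) → e ∉ˡ es P →
             k + length (vs P) ≡ suc #V → Grown x
      grow k {z} P q f e∉ fuel with z ≟ x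
      ... | yes refl = P , q , f , e∉
      ... | no z≢x with val<valency {C} z (closed-Unique P q e∉) (all {P = P} f)
             (≤-reflexive (trans (cong suc one) (sym (v2 z (vs⊆ P f (source∈ P))))))
        where
        one : val (e ∷ es P) z ≡ 1
        one = +-cancelʳ-≡ 1 _ _ (trans (cong (val (e ∷ es P) z +_) (sym (δ-refl z)))
          (trans (closed-val P j z)
            (trans (cong₂ (λ c d → 2 * c + d) (cnt-∈ q (source∈ P)) (δ-≢ (z≢x ∘ sym))) refl)))
      ... | h , h∈ , h∉ , i with Inc-Jn i
      ... | z′ , k′ with z′ ∈ᵛ? vs P
      ... | no z′∉ = continue k fuel
        where
        continue : ∀ k → k + length (vs P) ≡ suc #V → Grown x
        continue zero fuel = ⊥-elim (1+n≰n (≤-trans (≤-reflexive (sym fuel)) (Unique-length≤ q)))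
        continue (suc k) fuel = grow k (step h (Jn-sym k′) P) (Unique-∷⁺ z′∉ q)
          (λ { (here refl) → h∈ ; (there p) → f p })
          (λ { (here refl) → h∉ (here refl) ; (there p) → e∉ p })
          (trans (+-suc k (length (vs P))) fuel)
      -- An old vertex `z′` cannot take up `h`: if it differs from `z`, two ends are already used
      -- there; if it is `z`, the loop `h` would bring the count at `z` to three.
      ... | yes z′∈ = ⊥-elim (h∉ (circle-maximal {C} (closed-Unique P q e∉) (all {P = P} f) (v2 z′ (vs⊆ P f z′∈)) two h∈ (Jn-Incʳ k′)))
        where
        two : 2 ≤ val (e ∷ es P) z′
        two with z′ ≟ z
        ... | no n = ≤-trans (m≤m+n 2 (δ x z′)) (≤-reflexive (sym (trans (sym (trans (cong (val (e ∷ es P) z′ +_) (δ-≢ (n ∘ sym))) (+-identityʳ _)))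
                     (trans (closed-val P j z′) (cong (λ c → 2 * c + δ x z′) (cnt-∈ q z′∈))))))
        ... | yes refl = ⊥-elim (1+n≰n (≤-trans (≤-trans (+-mono-≤ {2} two′ (≤-reflexive (sym one))) 
                   (val≤valency {C} {h ∷ e ∷ es P} z (Unique-∷⁺ h∉ (closed-Unique P q e∉))
                      λ { (here refl) → h∈ ; (there p) → all {P = P} f p }))
                   (≤-reflexive (v2 z (vs⊆ P f z′∈)))))
          where
          two′ : 2 ≤ ends# h z
          two′ rewrite ends#-Jn z k′ | δ-refl z = ≤-refl
          one : val (e ∷ es P) z ≡ 1
          one = +-cancelʳ-≡ 1 _ _ (trans (cong (val (e ∷ es P) z +_) (sym (δ-refl z)))
            (trans (closed-val P j z)
              (trans (cong₂ (λ c d → 2 * c + d) (cnt-∈ q (source∈ P)) (δ-≢ (z≢x ∘ sym))) refl)))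

      finish : Grown x → Σ[ P ∈ W x y ] Unique (vs P) × e ∉ˡ es P × C ≡ closed e P
      finish (P , q , f , e∉) = P , q , e∉ ,
        Sub-ext ((λ u∈ → ∈V-mk⁺ {vs P} {e ∷ es P} (inP u∈)) , (λ {h} h∈ → ∈E-mk⁺ {vs P} {e ∷ es P} (at h∈ (inP (proj₁ (sub h h∈))) (inj₁ refl))))
                (mkSub-⊑ {vs P} {e ∷ es P} (vs⊆ P f) (all {P = P} f))
        where
        at : ∀ {h u} → h ∈ E C → u ∈ˡ vs P → Inc h u → h ∈ˡ e ∷ es P
        at h∈ u∈ i = circle-maximal {C} (closed-Unique P q e∉) (all {P = P} f) (v2 _ (vs⊆ P f u∈))
          (≤-reflexive (sym (closed-val-2 P q j u∈))) h∈ i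
        incs : ∀ {h u} → h ∈ˡ e ∷ es P → Inc h u → u ∈ˡ vs P
        incs (here refl) i = [ (λ { refl → target∈ P }) , (λ { refl → source∈ P }) ]′ (Jn-only j i)
        incs (there p) i = es-Inc P p i
        inP : ∀ {u} → u ∈ V C → u ∈ˡ vs P
        inP {u} u∈ = Connects-invariant (_∈ˡ vs P)
          (λ h∈ k x∈ → incs (at h∈ x∈ (Jn-Inc k)) (Jn-Incʳ k))
          (conn y u (ends∈ sub e∈ (Jn-Inc j)) u∈) (target∈ P)


-- Saturation and reachability

abstract
  -- Reachable sets, blocks, spanning potentials and st-numberings all arise by enlarging a partial
  -- object until no step applies; the bound on the size makes this end.
  saturate : {A : Set} {Done : A → Set} (size : A → ℕ) (N : ℕ) → (∀ a → size a ≤ N) →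
             (∀ a → Done a ⊎ ∃[ b ] size a < size b) → A → ∃ Done
  saturate {A} {Done} size N bound next a = go (suc N) a (m≤m+n (suc N) (size a))
    where
    go : ∀ k a → suc N ≤ k + size a → ∃ Done
    go zero    a l = ⊥-elim (1+n≰n (≤-trans l (bound a)))
    go (suc k) a l with next a
    ... | inj₁ d = a , d
    ... | inj₂ (b , a<b) = go k b (≤-trans l (≤-trans (≤-reflexive (sym (+-suc k (size a)))) (+-monoʳ-≤ k a<b)))

∣∪⁅⁆∣ : ∀ {n} (p : Subset n) {x} → x ∉ p → ∣ p ∣ < ∣ p ∪ ⁅ x ⁆ ∣
∣∪⁅⁆∣ p {x} x∉ = p⊂q⇒∣p∣<∣q∣ (x∈p∪q⁺ ∘ inj₁ , x , x∈p∪q⁺ (inj₂ (x∈⁅x⁆ x)) , x∉)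

∈∪⁅⁆⁻ : ∀ {n} {p : Subset n} {x y} → y ∈ p ∪ ⁅ x ⁆ → y ∈ p ⊎ y ≡ x
∈∪⁅⁆⁻ {p = p} {x} q = map⊎ id (x∈⁅y⁆⇒x≡y x) (x∈p∪q⁻ p ⁅ x ⁆ q)

⊈-witness : ∀ {n} {p q : Subset n} → ¬ (p ⊆ q) → ∃[ x ] x ∈ p × x ∉ q
⊈-witness {p = p} {q} n with any? (λ x → (x ∈? p) ×-dec ¬? (x ∈? q))
... | yes r = r
... | no r = ⊥-elim (n λ {x} x∈ → decidable-stable (x ∈? q) λ x∉ → r (x , x∈ , x∉))

module _ {n} {R : Fin n → Fin n → Set} (R? : ∀ x y → Dec (R x y)) (x : Fin n) where

  abstract
    reachableSet : ∃[ S ] (x ∈ S × (∀ y → y ∈ S → Star R x y)) × (∀ {y z} → y ∈ S → R y z → z ∈ S)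
    reachableSet with saturate {A = ∃[ S ] x ∈ S × (∀ y → y ∈ S → Star R x y)}
        {Done = λ (S , _) → ∀ {y z} → y ∈ S → R y z → z ∈ S} (λ (S , _) → ∣ S ∣) n (λ (S , _) → ∣p∣≤n S) next
        (⁅ x ⁆ , x∈⁅x⁆ x , λ y y∈ → subst (Star R x) (sym (x∈⁅y⁆⇒x≡y x y∈)) ε)
      where
      next : ((S , _) : ∃[ S ] x ∈ S × (∀ y → y ∈ S → Star R x y)) → (∀ {y z} → y ∈ S → R y z → z ∈ S) ⊎
             Σ[ b ∈ (∃[ S ] x ∈ S × (∀ y → y ∈ S → Star R x y)) ] ∣ S ∣ < ∣ proj₁ b ∣
      next (S , x∈ , sound) with any? (λ y → any? λ z → (y ∈? S) ×-dec (R? y z) ×-dec ¬? (z ∈? S))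
      ... | yes (y , z , y∈ , r , z∉) = inj₂ ((S ∪ ⁅ z ⁆ , x∈p∪q⁺ (inj₁ x∈) ,
              λ w w∈ → [ sound w , (λ { refl → sound y y∈ ◅◅ (r ◅ ε) }) ]′ (∈∪⁅⁆⁻ w∈)) , ∣∪⁅⁆∣ S z∉)
      ... | no ¬any = inj₁ λ {y} {z} y∈ r → decidable-stable (z ∈? S) λ z∉ → ¬any (y , z , y∈ , r , z∉)
    ... | (S , inv) , done = S , inv , done

  abstract
    Star? : ∀ y → Dec (Star R x y)
    Star? y with reachableSet
    ... | S , (x∈ , sound) , cl = map′ (sound y) (λ s → follow s x∈) (y ∈? S)
      where
      follow : ∀ {a b} → Star R a b → a ∈ S → b ∈ S
      follow ε a∈ = a∈
      follow (r ◅ s) a∈ = follow s (cl a∈ r)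

-- Blocks

module Blocks (G : Graph) where
  open Graph G
  open Walks G public

  Jn? : ∀ e x y → Dec (Jn e x y)
  Jn? e x y = ≡-dec _≟_ _≟_ (ends e) (x , y) ⊎-dec ≡-dec _≟_ _≟_ (ends e) (y , x)

  Linked? : ∀ {U : Fin #E → Set} → (∀ e → Dec (U e)) → ∀ x y → Dec (Linked U x y)
  Linked? U? x y = any? λ e → U? e ×-dec Jn? e x y

  abstract
    IsConnected? : ∀ H → Dec (IsConnected {G} H)
    IsConnected? H =
      (all? λ e → (e ∈? E H) →-dec ((proj₁ (ends e) ∈? V H) ×-dec (proj₂ (ends e) ∈? V H))) ×-dec
      nonempty? (V H) ×-dec
      (all? λ x → all? λ y → (x ∈? V H) →-dec ((y ∈? V H) →-dec Star? (Linked? (_∈? E H)) x y))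

  abstract
    IsSubgraph? : ∀ H → Dec (IsSubgraph {G} H)
    IsSubgraph? H = all? λ e → (e ∈? E H) →-dec ((proj₁ (ends e) ∈? V H) ×-dec (proj₂ (ends e) ∈? V H))

  abstract
    Nonseparable? : ∀ H → Dec (Nonseparable {G} H)
    Nonseparable? H = IsConnected? H ×-dec ¬? (any? λ x → anySub? λ H₁ → anySub? λ H₂ →
      IsSubgraph? H₁ ×-dec IsSubgraph? H₂ ×-dec nonempty? (E H₁) ×-dec nonempty? (E H₂) ×-dec
      (H ≟ₛ ⟨ V H₁ ∪ V H₂ , E H₁ ∪ E H₂ ⟩) ×-dec (≡-decᵛ Boolₚ._≟_ (V H₁ ∩ V H₂) ⁅ x ⁆) ×-dec
      (≡-decᵛ Boolₚ._≟_ (E H₁ ∩ E H₂) ⊥))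

  Covered : Sub G → Set
  Covered B = ∀ {u} → u ∈ V B → ∃[ g ] g ∈ E B × Inc g u

  -- Nonseparability in terms of edge colourings: two nonempty colour classes
  -- X and not X always meet in a vertex other than a prescribed x.

  Mixed : Sub G → Subset #E → Fin #V → Set
  Mixed B X y = (∃[ g ] (g ∈ E B × g ∈ X) × Inc g y) × (∃[ h ] (h ∈ E B × h ∉ X) × Inc h y)

  Mixing : Sub G → Set
  Mixing B = ∀ x X {g h} → g ∈ E B → g ∈ X → h ∈ E B → h ∉ X → ∃[ y ] y ≢ x × Mixed B X y

  -- What the later arguments use of a nonseparable graph with an edge. Unlike the definition by
  -- pairs of subgraphs, the colouring form can be pulled back along a map of edges, which is how it
  -- reaches `B↓v`.
  record Tight (B : Sub G) : Set where
    field
      subgraph : IsSubgraph {G} B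
      covered  : Covered B
      mixing   : Mixing B

  abstract
    connected-Covered : ∀ {B g} → IsConnected {G} B → g ∈ E B → Covered B
    connected-Covered {B} {g} (s , _ , conn) g∈ {u} u∈ with conn u (proj₁ (ends g)) u∈ (proj₁ (s g g∈))
    ... | ε = g , g∈ , inj₁ refl
    ... | (h , h∈ , j) ◅ _ = h , h∈ , Jn-Inc j

  abstract
    -- If the colours met at most in `x`, the edges of each colour with their ends, and `x` added to
    -- both, would exhibit `x` as a cutpoint.
    nonseparable-Mixing : ∀ {B} → Nonseparable {G} B → Mixing B
    nonseparable-Mixing {B} (con@(s , _) , ¬cut) x X {g} {h} g∈ gX h∈ hX
      with any? (λ y → ¬? (y ≟ x) ×-dec
             (any? λ g → ((g ∈? E B) ×-dec (g ∈? X)) ×-dec incident? {G} g y) ×-dec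
             (any? λ h → ((h ∈? E B) ×-dec ¬? (h ∈? X)) ×-dec incident? {G} h y))
    ... | yes (y , n , a , b) = y , n , a , b
    ... | no none = ⊥-elim (¬cut (cut (x ∈? V B)))
      where
      module _ (x₀ : Fin #V) (x₀∈ : x₀ ∈ V B) (x₀-only : ∀ {u} → u ∈ V B → u ≢ x₀ → u ≢ x) where
        E₁? : ∀ e → Dec (e ∈ E B × e ∈ X)
        E₁? e = (e ∈? E B) ×-dec (e ∈? X)
        E₂? : ∀ e → Dec (e ∈ E B × e ∉ X)
        E₂? e = (e ∈? E B) ×-dec ¬? (e ∈? X)
        V₁? : ∀ u → Dec (u ≡ x₀ ⊎ ∃[ g ] (g ∈ E B × g ∈ X) × Inc g u)
        V₁? u = (u ≟ x₀) ⊎-dec (any? λ g → E₁? g ×-dec incident? {G} g u)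
        V₂? : ∀ u → Dec (u ≡ x₀ ⊎ ∃[ g ] (g ∈ E B × g ∉ X) × Inc g u)
        V₂? u = (u ≟ x₀) ⊎-dec (any? λ g → E₂? g ×-dec incident? {G} g u)
        H₁ H₂ : Sub G
        H₁ = ⟨ ⟦ V₁? ⟧ , ⟦ E₁? ⟧ ⟩
        H₂ = ⟨ ⟦ V₂? ⟧ , ⟦ E₂? ⟧ ⟩

        V⊆ : ∀ {u} {Q : Fin #E → Set} → u ≡ x₀ ⊎ ∃[ g ] (g ∈ E B × Q g) × Inc g u → u ∈ V B
        V⊆ (inj₁ refl) = x₀∈
        V⊆ (inj₂ (g , (g∈ , _) , i)) = ends∈ s g∈ i

        isCut : ∃ (IsCutpoint {G} B)
        isCut = x₀ , H₁ , H₂ ,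
          (λ e e∈ → let q = ∈⟦⟧⁻ E₁? e∈ in ∈⟦⟧⁺ V₁? (inj₂ (e , q , inj₁ refl)) , ∈⟦⟧⁺ V₁? (inj₂ (e , q , inj₂ refl))) ,
          (λ e e∈ → let q = ∈⟦⟧⁻ E₂? e∈ in ∈⟦⟧⁺ V₂? (inj₂ (e , q , inj₁ refl)) , ∈⟦⟧⁺ V₂? (inj₂ (e , q , inj₂ refl))) ,
          (g , ∈⟦⟧⁺ E₁? (g∈ , gX)) , (h , ∈⟦⟧⁺ E₂? (h∈ , hX)) ,
          Sub-ext ((λ {u} u∈ → cover u∈) ,
                   (λ {e} e∈ → x∈p∪q⁺ (case e ∈? X of λ { (yes p) → inj₁ (∈⟦⟧⁺ E₁? (e∈ , p)) ; (no p) → inj₂ (∈⟦⟧⁺ E₂? (e∈ , p)) })))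
                  ((λ u∈ → [ V⊆ ∘ ∈⟦⟧⁻ V₁? , V⊆ ∘ ∈⟦⟧⁻ V₂? ]′ (x∈p∪q⁻ _ _ u∈)) ,
                   (λ e∈ → [ proj₁ ∘ ∈⟦⟧⁻ E₁? , proj₁ ∘ ∈⟦⟧⁻ E₂? ]′ (x∈p∪q⁻ _ _ e∈))) ,
          ⊆-antisym (λ {u} u∈ → only u∈) (λ u∈ → x∈p∩q⁺ (∈⟦⟧⁺ V₁? (inj₁ (x∈⁅y⁆⇒x≡y _ u∈)) , ∈⟦⟧⁺ V₂? (inj₁ (x∈⁅y⁆⇒x≡y _ u∈)))) ,
          ⊆-antisym (λ e∈ → ⊥-elim (proj₂ (∈⟦⟧⁻ E₂? (proj₂ (x∈p∩q⁻ _ _ e∈))) (proj₂ (∈⟦⟧⁻ E₁? (proj₁ (x∈p∩q⁻ _ _ e∈)))))) (⊥-elim ∘ ∉⊥)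
          where
          cover : ∀ {u} → u ∈ V B → u ∈ V H₁ ∪ V H₂
          cover {u} u∈ with connected-Covered con g∈ u∈
          ... | e , e∈ , i with e ∈? X
          ... | yes p = x∈p∪q⁺ (inj₁ (∈⟦⟧⁺ V₁? (inj₂ (e , (e∈ , p) , i))))
          ... | no p  = x∈p∪q⁺ (inj₂ (∈⟦⟧⁺ V₂? (inj₂ (e , (e∈ , p) , i))))
          only : ∀ {u} → u ∈ V H₁ ∩ V H₂ → u ∈ ⁅ x₀ ⁆
          only {u} u∈ with x∈p∩q⁻ _ _ u∈
          ... | a , b with ∈⟦⟧⁻ V₁? a | ∈⟦⟧⁻ V₂? b
          ... | inj₁ refl | _ = x∈⁅x⁆ u
          ... | inj₂ _ | inj₁ refl = x∈⁅x⁆ u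
          ... | inj₂ p@(g , (g∈ , _) , i) | inj₂ q with u ≟ x₀
          ... | yes refl = x∈⁅x⁆ u
          ... | no n = ⊥-elim (none (u , x₀-only (ends∈ s g∈ i) n , p , q))

      cut : Dec (x ∈ V B) → ∃ (IsCutpoint {G} B)
      cut (yes x∈) = isCut x x∈ λ _ n → n
      -- With `x` outside `B` the colours would not meet at all, so any vertex of `B` can be added
      -- to both sides as the common one.
      cut (no x∉)  = isCut (proj₁ (ends g)) (proj₁ (s g g∈)) λ { u∈ _ refl → x∉ u∈ }

  abstract
    Mixing-nonseparable : ∀ {B} → IsConnected {G} B → Mixing B → Nonseparable {G} B
    Mixing-nonseparable con mix = con , λ { (x , H₁ , H₂ , s₁ , s₂ , (g , g∈) , (h , h∈) , refl , eqV , eqE) →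
      let y , y≢x , (g′ , (_ , g′∈) , i) , (h′ , (h′∈ , h′∉) , i′) =
            mix x (E H₁) (x∈p∪q⁺ (inj₁ g∈)) g∈ (x∈p∪q⁺ (inj₂ h∈)) (λ h∈₁ → ∉⊥ (subst (h ∈_) eqE (x∈p∩q⁺ (h∈₁ , h∈))))
      in y≢x (x∈⁅y⁆⇒x≡y x (subst (y ∈_) eqV (x∈p∩q⁺ (ends∈ s₁ g′∈ i ,
           ends∈ s₂ ([ ⊥-elim ∘ h′∉ , id ]′ (x∈p∪q⁻ _ _ h′∈)) i′)))) }

  nonseparable-Tight : ∀ {B g} → Nonseparable {G} B → g ∈ E B → Tight B
  nonseparable-Tight n@(con@(s , _) , _) g∈ = record
    { subgraph = s ; covered = connected-Covered con g∈ ; mixing = nonseparable-Mixing n }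

  abstract
    -- The common edge `e` has one of the colours. An edge of the other colour lies in `B` or `B′`;
    -- that subgraph also contains `e`, so the colours meet inside it.
    ⊔-nonseparable : ∀ {B B′ e} → Nonseparable {G} B → Nonseparable {G} B′ → e ∈ E B → e ∈ E B′ →
                     Nonseparable {G} (B ⊔ B′)
    ⊔-nonseparable {B} {B′} {e} n@((s , _ , c) , _) n′@((s′ , _ , c′) , _) e∈ e∈′ =
      Mixing-nonseparable (sub , (w , x∈p∪q⁺ (inj₁ (proj₁ (s e e∈)))) ,
                           λ x y x∈ y∈ → Connects-sym (to x∈) ◅◅ to y∈) mix
      where
      w : Fin #V
      w = proj₁ (ends e)
      sub : IsSubgraph {G} (B ⊔ B′)
      sub g g∈ with x∈p∪q⁻ (E B) (E B′) g∈
      ... | inj₁ p = x∈p∪q⁺ (inj₁ (proj₁ (s g p))) , x∈p∪q⁺ (inj₁ (proj₂ (s g p)))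
      ... | inj₂ p = x∈p∪q⁺ (inj₂ (proj₁ (s′ g p))) , x∈p∪q⁺ (inj₂ (proj₂ (s′ g p)))
      to : ∀ {x} → x ∈ V (B ⊔ B′) → Connects (_∈ E (B ⊔ B′)) w x
      to {x} x∈ with x∈p∪q⁻ (V B) (V B′) x∈
      ... | inj₁ p = Connects-mono (x∈p∪q⁺ ∘ inj₁) (c w x (proj₁ (s e e∈)) p)
      ... | inj₂ p = Connects-mono (x∈p∪q⁺ ∘ inj₂) (c′ w x (proj₁ (s′ e e∈′)) p)
      liftˡ : ∀ {X y} → Mixed B X y → Mixed (B ⊔ B′) X y
      liftˡ ((g , (a , b) , i) , (h , (a′ , b′) , i′)) = (g , (x∈p∪q⁺ (inj₁ a) , b) , i) , (h , (x∈p∪q⁺ (inj₁ a′) , b′) , i′)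
      liftʳ : ∀ {X y} → Mixed B′ X y → Mixed (B ⊔ B′) X y
      liftʳ ((g , (a , b) , i) , (h , (a′ , b′) , i′)) = (g , (x∈p∪q⁺ (inj₂ a) , b) , i) , (h , (x∈p∪q⁺ (inj₂ a′) , b′) , i′)
      mix : Mixing (B ⊔ B′)
      mix x X g∈ gX h∈ hX with e ∈? X | x∈p∪q⁻ (E B) (E B′) g∈ | x∈p∪q⁻ (E B) (E B′) h∈
      ... | yes eX | _ | inj₁ p = let y , n , m = nonseparable-Mixing n x X e∈ eX p hX in y , n , liftˡ m
      ... | yes eX | _ | inj₂ p = let y , n , m = nonseparable-Mixing n′ x X e∈′ eX p hX in y , n , liftʳ m
      ... | no eX | inj₁ p | _  = let y , n , m = nonseparable-Mixing n x X p gX e∈ eX in y , n , liftˡ m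
      ... | no eX | inj₂ p | _  = let y , n , m = nonseparable-Mixing n′ x X p gX e∈′ eX in y , n , liftʳ m

  abstract
    block-unique : ∀ {B B′ e} → IsBlock {G} B → IsBlock {G} B′ → e ∈ E B → e ∈ E B′ → B ≡ B′
    block-unique {B} {B′} (n , max) (n′ , max′) e∈ e∈′ =
      trans (sym (max (B ⊔ B′) u (x∈p∪q⁺ ∘ inj₁ , x∈p∪q⁺ ∘ inj₁)))
            (max′ (B ⊔ B′) u (x∈p∪q⁺ ∘ inj₂ , x∈p∪q⁺ ∘ inj₂))
      where
      u : Nonseparable {G} (B ⊔ B′)
      u = ⊔-nonseparable n n′ e∈ e∈′

  abstract
    blockAbove : ∀ {C} → Nonseparable {G} C → ∃[ B ] IsBlock {G} B × C ⊑ B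
    blockAbove {C} n with saturate {A = ∃[ B ] Nonseparable {G} B × C ⊑ B} {Done = λ (B , _) → IsBlock {G} B}
        (λ (B , _) → ∣ V B ∣ + ∣ E B ∣) (#V + #E) (λ (B , _) → +-mono-≤ (∣p∣≤n (V B)) (∣p∣≤n (E B))) next
        (C , n , id , id)
      where
      next : ((B , _) : ∃[ B ] Nonseparable {G} B × C ⊑ B) → IsBlock {G} B ⊎
             Σ[ (B′ , _) ∈ (∃[ B ] Nonseparable {G} B × C ⊑ B) ] ∣ V B ∣ + ∣ E B ∣ < ∣ V B′ ∣ + ∣ E B′ ∣
      next (B , n , C⊑) with anySub? (λ B′ → Nonseparable? B′ ×-dec (B ⊑? B′) ×-dec ¬? (B′ ≟ₛ B))
      ... | no none = inj₁ (n , λ B′ n′ s → decidable-stable (B′ ≟ₛ B) λ ne → none (B′ , n′ , s , ne))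
      ... | yes (B′ , n′ , s , ne) = inj₂ ((B′ , n′ , (λ x∈ → proj₁ s (proj₁ C⊑ x∈)) , (λ x∈ → proj₂ s (proj₂ C⊑ x∈))) , bigger)
        where
        bigger : ∣ V B ∣ + ∣ E B ∣ < ∣ V B′ ∣ + ∣ E B′ ∣
        bigger with V B′ ⊆? V B | E B′ ⊆? E B
        ... | yes p | yes q = ⊥-elim (ne (Sub-ext (p , q) s))
        ... | no p | _ = +-mono-≤ {suc _} (p⊂q⇒∣p∣<∣q∣ {p = V B} {q = V B′} (proj₁ s , ⊈-witness p)) (p⊆q⇒∣p∣≤∣q∣ {p = E B} {q = E B′} (proj₂ s))
        ... | yes p | no q = subst (_≤ ∣ V B′ ∣ + ∣ E B′ ∣) (+-suc ∣ V B ∣ ∣ E B ∣)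
                               (+-mono-≤ (p⊆q⇒∣p∣≤∣q∣ (proj₁ s)) (p⊂q⇒∣p∣<∣q∣ (proj₂ s , ⊈-witness q)))
    ... | (B , _ , C⊑) , b = B , b , C⊑

  module _ (C : Sub G) (X : Subset #E) where

    private
      HasX Has¬X : Fin #V → Set
      HasX  y = ∃[ g ] (g ∈ E C × g ∈ X) × Inc g y
      Has¬X y = ∃[ h ] (h ∈ E C × h ∉ X) × Inc h y

    abstract
      lastMixed : ∀ {a b} (P : W a b) → (∀ {e} → e ∈ˡ es P → e ∈ E C) → Has¬X a → HasX b →
                  ∃[ y ] y ∈ˡ vs P × Mixed C X y
      lastMixed (nil a) f p q = a , here refl , q , p
      lastMixed {a} (step e j P) f p q with e ∈? X
      ... | yes eX = a , here refl , (e , (f (here refl) , eX) , Jn-Inc j) , p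
      ... | no eX with lastMixed P (f ∘ there) (e , (f (here refl) , eX) , Jn-Incʳ j) q
      ... | y , y∈ , m = y , there y∈ , m

    abstract
      twoMixed : ∀ {a b} (P : W a b) → Unique (vs P) → (∀ {e} → e ∈ˡ es P → e ∈ E C) →
                 (∃[ h ] h ∈ˡ es P × h ∉ X) → HasX a → HasX b →
                 ∃₂ λ y z → y ≢ z × Mixed C X y × Mixed C X z
      twoMixed {a} (step e j P) u f (h , h∈ , hX) p q with e ∈? X
      ... | no eX with lastMixed P (f ∘ there) (e , (f (here refl) , eX) , Jn-Incʳ j) q
      ...   | z , z∈ , m = a , z , (λ { refl → Unique-∷⁻ u z∈ }) , (p , (e , (f (here refl) , eX) , Jn-Inc j)) , m
      twoMixed (step e j P) u f (h , here refl , hX) p q | yes eX = ⊥-elim (hX eX)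
      twoMixed (step e j P) u f (h , there h∈ , hX) p q | yes eX =
        twoMixed P (Unique-tail u) (f ∘ there) (h , h∈ , hX) (e , (f (here refl) , eX) , Jn-Incʳ j) q

  abstract
    -- Removing `g` leaves a path both of whose ends see the colour of `g`. An edge of the other
    -- colour on it forces two changes of colour, at different vertices, and at most one of these is
    -- `x`.
    circle-Mixing : ∀ {C} → IsCircle {G} C → Mixing C
    circle-Mixing {C} c x X {g} {h} g∈ gX h∈ hX
      with circle-closed {C} c g∈ (Jn-sym (Jn-ends g))
    ... | P , u , g∉ , refl with ∈E-mk⁻ {vs P} {g ∷ es P} h∈
    ... | here refl = ⊥-elim (hX gX)
    ... | there h∈P with twoMixed C X P u (∈E-mk⁺ {vs P} {g ∷ es P} ∘ there) (h , h∈P , hX)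
                           (g , (g∈ , gX) , inj₁ refl) (g , (g∈ , gX) , inj₂ refl)
    ... | y , z , y≢z , m , m′ with y ≟ x
    ... | no n = y , n , m
    ... | yes refl = z , y≢z ∘ sym , m′

  circle-nonseparable : ∀ {C} → IsCircle {G} C → Nonseparable {G} C
  circle-nonseparable c = Mixing-nonseparable (proj₁ c) (circle-Mixing c)

  abstract
    -- A loop meets other edges only at its one vertex. Colouring `ℓ` alone and prescribing that
    -- vertex therefore rules out a second edge.
    loop-only : ∀ {B ℓ} → Tight B → ℓ ∈ E B → Loop ℓ → ∀ {g} → g ∈ E B → g ≡ ℓ
    loop-only {B} {ℓ} t ℓ∈ l {g} g∈ = decidable-stable (g ≟ ℓ) λ g≢ →
      let y , y≢ , (ℓ′ , (_ , ℓ′∈) , i) , _ =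
            Tight.mixing t (proj₁ (ends ℓ)) ⁅ ℓ ⁆ ℓ∈ (x∈⁅x⁆ ℓ) g∈ (g≢ ∘ x∈⁅y⁆⇒x≡y ℓ)
      in y≢ (at (subst (λ e → Inc e y) (x∈⁅y⁆⇒x≡y ℓ ℓ′∈) i))
      where
      at : ∀ {y} → Inc ℓ y → y ≡ proj₁ (ends ℓ)
      at (inj₁ p) = sym p
      at (inj₂ p) = trans (sym p) (sym l)

  -- Edges that meet S and edges that do not could only meet in v.
  closed-impossible : ∀ {B v x y} {S : Subset #V} → Tight B → v ∉ S →
    (∀ {u z g} → u ∈ S → g ∈ E B → ¬ Inc g v → Jn g u z → z ∈ S) →
    x ∈ V B → x ∈ S → y ∈ V B → y ≢ v → y ∉ S → Absurd
  closed-impossible {B} {v} {x} {y} {S} t v∉ cl x∈ x∈S y∈ y≢v y∉S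
    with Tight.covered t x∈ | Tight.covered t y∈
  ... | gx , gx∈ , ix | gy , gy∈ , iy = finish
      (Tight.mixing t v ⟦ X? ⟧ gx∈ (∈⟦⟧⁺ X? (x , x∈S , ix)) gy∈ λ q → untouched (∈⟦⟧⁻ X? q))
    where
    X? : ∀ g → Dec (∃[ u ] u ∈ S × Inc g u)
    X? g = any? λ u → (u ∈? S) ×-dec incident? {G} g u
    inS : ∀ {u g z} → u ∈ S → Inc g u → g ∈ E B → z ≢ v → Inc g z → z ∈ S
    inS {u} {g} {z} u∈ i g∈ z≢ i′ with Inc-Jn i
    ... | w , j with Jn-only j i′
    ... | inj₁ refl = u∈
    ... | inj₂ refl = cl u∈ g∈ (λ iv → [ (λ { refl → v∉ u∈ }) , z≢ ∘ sym ]′ (Jn-only j iv)) j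
    untouched : ¬ (∃[ u ] u ∈ S × Inc gy u)
    untouched (u , u∈ , i) = y∉S (inS u∈ i gy∈ y≢v iy)
    finish : ¬ (∃[ z ] z ≢ v × Mixed B ⟦ X? ⟧ z)
    finish (z , z≢v , (g , (g∈ , g∈X) , ig) , h , (_ , h∉) , ih) with ∈⟦⟧⁻ X? g∈X
    ... | u , u∈ , iu = h∉ (∈⟦⟧⁺ X? (z , inS u∈ iu g∈ z≢v ig , ih))

  abstract
    remove-connected : ∀ {B v x y} → Tight B → x ∈ V B → x ≢ v → y ∈ V B → y ≢ v →
                       Connects (λ g → g ∈ E B × ¬ Inc g v) x y
    remove-connected {B} {v} {x} {y} t x∈ x≢v y∈ y≢v
      with reachableSet (Linked? (λ g → (g ∈? E B) ×-dec ¬? (incident? {G} g v))) x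
    ... | S , (x∈S , sound) , cl with y ∈? S
    ... | yes y∈S = sound y y∈S
    ... | no y∉S = ⊥-elim (closed-impossible {S = S} t
            (λ v∈ → Connects-invariant (_≢ v) (λ { (_ , n) j _ refl → n (Jn-Incʳ j) }) (sound v v∈) x≢v refl)
            (λ u∈ g∈ n j → cl u∈ (_ , (g∈ , n) , j)) x∈ x∈S y∈ y≢v y∉S)


-- Switching potentials

module Signed (S : SignedGraph) where
  open SignedGraph S
  open Blocks graph public

  Good : (Fin #V → Sign) → Fin #E → Set
  Good ζ e = switch S ζ e ≡ ⊕

  abstract
    switch-Jn : ∀ ζ {e x y} → Jn e x y → switch S ζ e ≡ ζ x · σ e · ζ y
    switch-Jn ζ (inj₁ refl) = refl
    switch-Jn ζ {e} {x} {y} (inj₂ refl) = lem (ζ y) (σ e) (ζ x)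
      where
      lem : ∀ a b c → a · b · c ≡ c · b · a
      lem = from-yes (∀ˢ λ a → ∀ˢ λ b → ∀ˢ λ c → a · b · c ≟ˢ c · b · a)

  abstract
    Good-σ : ∀ {ζ e x y} → Jn e x y → Good ζ e → σ e ≡ ζ x · ζ y
    Good-σ {ζ} {e} {x} {y} j g = lem (ζ x) (σ e) (ζ y) (trans (sym (switch-Jn ζ j)) g)
      where
      lem : ∀ a b c → a · b · c ≡ ⊕ → b ≡ a · c
      lem = from-yes (∀ˢ λ a → ∀ˢ λ b → ∀ˢ λ c → (a · b · c ≟ˢ ⊕) →-dec (b ≟ˢ a · c))

  abstract
    σ-Good : ∀ {ζ e x y} → Jn e x y → σ e ≡ ζ x · ζ y → Good ζ e
    σ-Good {ζ} {e} {x} {y} j g = trans (switch-Jn ζ j) (trans (cong (λ s → ζ x · s · ζ y) g) (lem (ζ x) (ζ y)))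
      where
      lem : ∀ a b → a · (a · b) · b ≡ ⊕
      lem = from-yes (∀ˢ λ a → ∀ˢ λ b → a · (a · b) · b ≟ˢ ⊕)

  switch-cong : ∀ {ζ ξ e} → (∀ {u} → Inc e u → ζ u ≡ ξ u) → switch S ζ e ≡ switch S ξ e
  switch-cong {e = e} f = cong₂ (λ a b → a · σ e · b) (f (inj₁ refl)) (f (inj₂ refl))

  abstract
    switch-scale : ∀ s ζ e → switch S (λ u → s · ζ u) e ≡ switch S ζ e
    switch-scale ⊕ ζ e = refl
    switch-scale ⊖ ζ e = lem (ζ (proj₁ (ends e))) (σ e) (ζ (proj₂ (ends e)))
      where
      lem : ∀ a b c → opp a · b · opp c ≡ a · b · c
      lem = from-yes (∀ˢ λ a → ∀ˢ λ b → ∀ˢ λ c → opp a · b · opp c ≟ˢ a · b · c)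

  sgn : List (Fin #E) → Sign
  sgn = foldr (λ e s → σ e · s) ⊕

  sgn-↭ : ∀ {xs ys} → xs ↭ ys → sgn xs ≡ sgn ys
  sgn-↭ _↭_.refl = refl
  sgn-↭ (_↭_.prep x p) = cong (σ x ·_) (sgn-↭ p)
  sgn-↭ (_↭_.swap {ys = ys} x y p) rewrite sgn-↭ p = lem (σ x) (σ y) (sgn ys)
    where
    lem : ∀ a b c → a · (b · c) ≡ b · (a · c)
    lem = from-yes (∀ˢ λ a → ∀ˢ λ b → ∀ˢ λ c → a · (b · c) ≟ˢ b · (a · c))
  sgn-↭ (_↭_.trans p q) = trans (sgn-↭ p) (sgn-↭ q)

  sgn-walk : ∀ {ζ x y} (P : W x y) → (∀ {e} → e ∈ˡ es P → Good ζ e) → sgn (es P) ≡ ζ x · ζ y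
  sgn-walk {ζ} (nil x) f = sym (·-same {ζ x} refl)
  sgn-walk {ζ} {x} {z} (step {y = y} e j P) f =
    trans (cong₂ _·_ (Good-σ {ζ} j (f (here refl))) (sgn-walk {ζ} P (f ∘ there))) (lem (ζ x) (ζ y) (ζ z))
    where
    lem : ∀ a b c → (a · b) · (b · c) ≡ a · c
    lem = from-yes (∀ˢ λ a → ∀ˢ λ b → ∀ˢ λ c → (a · b) · (b · c) ≟ˢ a · c)

  signOf-closed : ∀ {x y e} (P : W x y) → Unique (vs P) → e ∉ˡ es P → signOf S (closed e P) ≡ σ e · sgn (es P)
  signOf-closed {e = e} P u e∉ =
    sgn-↭ (edges-↭ {closed e P} (closed-Unique P u e∉) (∈E-mk⁺ {vs P}) (∈E-mk⁻ {vs P}))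

  signOf-closed-switch : ∀ {ζ x y e} (P : W x y) → Unique (vs P) → e ∉ˡ es P → Jn e y x →
                         (∀ {e} → e ∈ˡ es P → Good ζ e) → signOf S (closed e P) ≡ switch S ζ e
  signOf-closed-switch {ζ} {x} {y} {e} P u e∉ j f =
    trans (signOf-closed P u e∉) (trans (cong (σ e ·_) (sgn-walk {ζ} P f))
      (trans (lem (σ e) (ζ x) (ζ y)) (sym (switch-Jn ζ j))))
    where
    lem : ∀ s a b → s · (a · b) ≡ b · s · a
    lem = from-yes (∀ˢ λ s → ∀ˢ λ a → ∀ˢ λ b → s · (a · b) ≟ˢ b · s · a)

  abstract
    circleThrough : ∀ {U ζ e x y} → (∀ {g} → U g → Good ζ g) → ¬ U e → Jn e y x → Connects U x y →
      ∃[ D ] IsCircle {graph} D × signOf S D ≡ switch S ζ e × e ∈ E D × (∀ {g} → g ∈ E D → g ≡ e ⊎ U g)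
    circleThrough {U} {ζ} {e} good ¬Ue j c with simpleWalk c
    ... | P , u , f = closed e P , closed-circle P u j e∉ , signOf-closed-switch {ζ} P u e∉ j (good ∘ f) ,
          ∈E-mk⁺ {vs P} {e ∷ es P} (here refl) , λ g∈ → split (∈E-mk⁻ {vs P} {e ∷ es P} g∈)
      where
      e∉ : e ∉ˡ es P
      e∉ = ¬Ue ∘ f
      split : ∀ {g} → g ∈ˡ e ∷ es P → g ≡ e ⊎ U g
      split (here p)  = inj₁ p
      split (there p) = inj₂ (f p)

  abstract
    signOf-circle : ∀ {ζ D e} → IsCircle {graph} D → e ∈ E D → (∀ {g} → g ∈ E D → g ≢ e → Good ζ g) →
                    signOf S D ≡ switch S ζ e
    signOf-circle {ζ} {D} {e} c e∈ f with circle-closed {D} c e∈ (Jn-sym (Jn-ends e))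
    ... | P , u , e∉ , refl = signOf-closed-switch {ζ} P u e∉ (Jn-sym (Jn-ends e))
      λ g∈ → f (∈E-mk⁺ {vs P} (there g∈)) λ { refl → e∉ g∈ }

  abstract
    circle-edge : ∀ {D u} → IsCircle {graph} D → u ∈ V D → ∃[ g ] g ∈ E D × Inc g u
    circle-edge {D} {u} (_ , v2) u∈ = valency-edge {D} (≤-trans (s≤s z≤n) (≤-reflexive (sym (v2 u u∈))))

  abstract
    circle-⊑ : ∀ {D B} → IsCircle {graph} D → IsSubgraph {graph} B → (∀ {g} → g ∈ E D → g ∈ E B) → D ⊑ B
    circle-⊑ {D} {B} c s f = (λ {u} u∈ → let g , g∈ , i = circle-edge {D} c u∈ in ends∈ {B} s (f g∈) i) , f

  abstract
    circle-hasEdge : ∀ {D} → IsCircle {graph} D → Nonempty (E D)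
    circle-hasEdge {D} c@((_ , (u , u∈) , _) , _) = let g , g∈ , _ = circle-edge {D} c u∈ in g , g∈

  _[_≔_] : (Fin #V → Sign) → Fin #V → Sign → Fin #V → Sign
  (κ [ z ≔ s ]) u = if does (u ≟ z) then s else κ u

  ≔-same : ∀ κ z s → (κ [ z ≔ s ]) z ≡ s
  ≔-same κ z s rewrite dec-true (z ≟ z) refl = refl

  ≔-other : ∀ κ {z u} s → u ≢ z → (κ [ z ≔ s ]) u ≡ κ u
  ≔-other κ {z} {u} s n rewrite dec-false (u ≟ z) n = refl

  abstract
    walkPotential : ∀ {x y} (P : W x y) → Unique (vs P) → ∃[ κ ] ∀ {e} → e ∈ˡ es P → Good κ e
    walkPotential (nil x) u = (λ _ → ⊕) , λ ()
    walkPotential (step {x} {y} e j P) u with walkPotential P (Unique-tail u)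
    ... | κ , f = κ′ , λ { (here refl) → σ-Good {κ′} j (trans (lem (σ e) (κ y))
                            (sym (cong₂ _·_ (≔-same κ x s) (≔-other κ s λ { refl → x∉ (source∈ P) }))))
                         ; (there p) → trans (switch-cong {κ′} {κ} λ i → ≔-other κ s λ { refl → x∉ (es-Inc P p i) }) (f p) }
      where
      s : Sign
      s = σ e · κ y
      κ′ : Fin #V → Sign
      κ′ = κ [ x ≔ s ]
      x∉ : x ∉ˡ vs P
      x∉ = Unique-∷⁻ u
      lem : ∀ a b → a ≡ a · b · b
      lem = from-yes (∀ˢ λ a → ∀ˢ λ b → a ≟ˢ a · b · b)

  abstract
    -- On the path left by removing `e` a potential can be propagated freely; the sign of `e` after
    -- switching is then the sign of the whole circle.
    circlePotential : ∀ {C} → PositiveCircle S C → ∃[ ζ ] ∀ {g} → g ∈ E C → Good ζ g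
    circlePotential {C} (c , pos) with circle-hasEdge {C} c
    ... | e , e∈ with circle-closed {C} c e∈ (Jn-sym (Jn-ends e))
    ... | P , u , e∉ , refl with walkPotential P u
    ... | ζ , f = ζ , λ g∈ → good (∈E-mk⁻ {vs P} {e ∷ es P} g∈)
      where
      good : ∀ {g} → g ∈ˡ e ∷ es P → Good ζ g
      good (here refl) = trans (sym (signOf-closed-switch {ζ} P u e∉ (Jn-sym (Jn-ends e)) f)) pos
      good (there p)   = f p

  abstract
    -- The potential is fixed vertex by vertex as a tree grows, each value making the connecting
    -- edge positive. The conclusion mentions no tree, only that the positive edges of `U` reach
    -- from `x` whatever `U` reaches.
    spanningPotential : ∀ {U} → (∀ e → Dec (U e)) → ∀ x →
      ∃[ κ ] ∀ {y} → Connects U x y → Connects (λ g → U g × Good κ g) x y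
    spanningPotential {U} U? x with saturate
        {A = ∃₂ λ R κ → x ∈ R × (∀ y → y ∈ R → Connects (Tree R κ) x y)}
        {Done = λ (R , _) → ∀ {e y z} → y ∈ R → U e → Jn e y z → z ∈ R}
        (λ (R , _) → ∣ R ∣) #V (λ (R , _) → ∣p∣≤n R) next
        (⁅ x ⁆ , (λ _ → ⊕) , x∈⁅x⁆ x , λ y y∈ → subst (Connects _ x) (sym (x∈⁅y⁆⇒x≡y x y∈)) ε)
      where
      -- Both ends of a recorded edge lie in `R`, so choosing a value at a new vertex does not
      -- disturb its sign.
      Tree : Subset #V → (Fin #V → Sign) → Fin #E → Set
      Tree R κ g = (U g × Good κ g) × (∀ {w} → Inc g w → w ∈ R)
      next : ((R , _) : ∃₂ λ R κ → x ∈ R × (∀ y → y ∈ R → Connects (Tree R κ) x y)) → (∀ {e y z} → y ∈ R → U e → Jn e y z → z ∈ R) ⊎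
             Σ[ (R′ , _) ∈ (∃₂ λ R κ → x ∈ R × (∀ y → y ∈ R → Connects (Tree R κ) x y)) ] ∣ R ∣ < ∣ R′ ∣
      next (R , κ , x∈ , conn)
        with any? (λ e → any? λ y → any? λ z → (y ∈? R) ×-dec U? e ×-dec Jn? e y z ×-dec ¬? (z ∈? R))
      ... | no none = inj₁ λ {e} {y} {z} y∈ ue j → decidable-stable (z ∈? R) λ z∉ → none (e , y , z , y∈ , ue , j , z∉)
      ... | yes (e , y , z , y∈ , ue , j , z∉) = inj₂ ((R′ , κ′ , x∈p∪q⁺ (inj₁ x∈) ,
              λ w w∈ → [ old w , (λ { refl → old y y∈ ◅◅ edge ((ue , good) , λ {w} → new {w}) j }) ]′ (∈∪⁅⁆⁻ w∈)) , ∣∪⁅⁆∣ R z∉)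
        where
        s : Sign
        s = κ y · σ e
        κ′ : Fin #V → Sign
        κ′ = κ [ z ≔ s ]
        R′ : Subset #V
        R′ = R ∪ ⁅ z ⁆
        good : Good κ′ e
        good = trans (switch-Jn κ′ j) (trans (cong₂ (λ a b → a · σ e · b) (≔-other κ s λ { refl → z∉ y∈ }) (≔-same κ z s))
                 (·-same {s} refl))
        new : ∀ {w} → Inc e w → w ∈ R′
        new i = [ (λ { refl → x∈p∪q⁺ (inj₁ y∈) }) , (λ { refl → x∈p∪q⁺ (inj₂ (x∈⁅x⁆ z)) }) ]′ (Jn-only j i)
        old : ∀ w → w ∈ R → Connects (Tree R′ κ′) x w
        old w w∈ = Connects-mono (λ ((u , g) , i) → (u , trans (switch-cong {κ′} {κ} λ {w} iw → ≔-other κ s λ { refl → z∉ (i iw) }) g) ,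
                     λ {w} iw → x∈p∪q⁺ (inj₁ (i iw))) (conn w w∈)
    ... | (R , κ , x∈ , conn) , done = κ , λ {y} c → Connects-mono proj₁ (conn y (Connects-invariant (_∈ R) (λ u j y∈ → done y∈ u j) c x∈))


-- Circles with a root edge, as cyclic sequences

abstract
  ≤‴-from : ∀ {m n} → m ≤ n → m ≤‴ n
  ≤‴-from = ≤⇒≤‴

module Rings (G : Graph) where
  open Graph G
  open Blocks G public

  at : ∀ {x y} → W x y → ℕ → Fin #V
  at (nil x)          _       = x
  at (step {x} e j P) zero    = x
  at (step e j P)     (suc p) = at P p

  ed : ∀ {x y} → Fin #E → W x y → ℕ → Fin #E
  ed e₀ (nil x)      _       = e₀
  ed e₀ (step e j P) zero    = e
  ed e₀ (step e j P) (suc p) = ed e₀ P p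

  len : ∀ {x y} → W x y → ℕ
  len (nil x)      = 0
  len (step e j P) = suc (len P)

  idx : ∀ {x y} → W x y → Fin #V → ℕ
  idx (nil x)          u = 0
  idx (step {x} e j P) u = if does (x ≟ u) then 0 else suc (idx P u)

  at-zero : ∀ {x y} (P : W x y) → at P 0 ≡ x
  at-zero (nil x)      = refl
  at-zero (step e j P) = refl

  at-len : ∀ {x y} (P : W x y) → at P (len P) ≡ y
  at-len (nil x)      = refl
  at-len (step e j P) = at-len P

  at∈ : ∀ {x y} (P : W x y) p → at P p ∈ˡ vs P
  at∈ (nil x)      p       = here refl
  at∈ (step e j P) zero    = here refl
  at∈ (step e j P) (suc p) = there (at∈ P p)

  ed∈ : ∀ {x y} e₀ (P : W x y) {p} → p < len P → ed e₀ P p ∈ˡ es P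
  ed∈ e₀ (step e j P) {zero}  l = here refl
  ed∈ e₀ (step e j P) {suc p} l = there (ed∈ e₀ P (s≤s⁻¹ l))

  ed-Jn : ∀ {x y} e₀ (P : W x y) {p} → p < len P → Jn (ed e₀ P p) (at P p) (at P (suc p))
  ed-Jn e₀ (step e j P) {zero}  l = subst (Jn e _) (sym (at-zero P)) j
  ed-Jn e₀ (step e j P) {suc p} l = ed-Jn e₀ P (s≤s⁻¹ l)

  es-ed : ∀ {x y} e₀ (P : W x y) {g} → g ∈ˡ es P → ∃[ p ] p < len P × g ≡ ed e₀ P p
  es-ed e₀ (step e j P) (here refl) = 0 , s≤s z≤n , refl
  es-ed e₀ (step e j P) (there g∈) with es-ed e₀ P g∈
  ... | p , l , q = suc p , s≤s l , q

  at-idx : ∀ {x y} (P : W x y) {u} → u ∈ˡ vs P → at P (idx P u) ≡ u × idx P u ≤ len P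
  at-idx (nil x) (here refl) = refl , z≤n
  at-idx (step {x} e j P) {u} u∈ with x ≟ u
  ... | yes refl = refl , z≤n
  ... | no n with u∈
  ...   | here refl = ⊥-elim (n refl)
  ...   | there q = let a , b = at-idx P q in a , s≤s b

  idx-at : ∀ {x y} (P : W x y) → Unique (vs P) → ∀ {p} → p ≤ len P → idx P (at P p) ≡ p
  idx-at (nil x) q z≤n = refl
  idx-at (step {x} e j P) q {zero} l rewrite dec-true (x ≟ x) refl = refl
  idx-at (step {x} e j P) q {suc p} l
    rewrite dec-false (x ≟ at P p) (λ eq → Unique-∷⁻ q (subst (_∈ˡ vs P) (sym eq) (at∈ P p)))
    = cong suc (idx-at P (Unique-tail q) (s≤s⁻¹ l))

  -- The circle is `c 0`, ..., `c n`, where `d p` goes from `c p` to `c (suc p)` and the root `e`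
  -- closes up from `c n` to `c 0`; a loop has `n ≡ 0`. Positions are natural numbers so that they
  -- can be compared directly; the fields say nothing about `c` and `d` beyond the range.
  record Ring (C : Sub G) (e : Fin #E) : Set where
    field
      n     : ℕ
      c     : ℕ → Fin #V
      d     : ℕ → Fin #E
      pos   : Fin #V → ℕ
      close : Jn e (c n) (c 0)
      join  : ∀ {p} → p < n → Jn (d p) (c p) (c (suc p))
      pos-c : ∀ {p} → p ≤ n → pos (c p) ≡ p
      c-pos : ∀ {u} → u ∈ V C → c (pos u) ≡ u
      pos≤  : ∀ {u} → u ∈ V C → pos u ≤ n
      c∈    : ∀ {p} → p ≤ n → c p ∈ V C
      d∈    : ∀ {p} → p < n → d p ∈ E C
      e∈    : e ∈ E C
      d≢e   : ∀ {p} → p < n → d p ≢ e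
      E-cases : ∀ {g} → g ∈ E C → g ≡ e ⊎ ∃[ p ] p < n × g ≡ d p

    c-injective : ∀ {p q} → p ≤ n → q ≤ n → c p ≡ c q → p ≡ q
    c-injective p≤ q≤ eq = trans (sym (pos-c p≤)) (trans (cong pos eq) (pos-c q≤))

    d-injective : ∀ {p q} → p < n → q < n → d p ≡ d q → p ≡ q
    d-injective {p} {q} p< q< eq
      with Jn-only (join p<) (subst (λ g → Inc g (c q)) (sym eq) (Jn-Inc (join q<)))
         | Jn-only (join p<) (subst (λ g → Inc g (c (suc q))) (sym eq) (Jn-Incʳ (join q<)))
    ... | inj₁ a | _ = sym (c-injective (<⇒≤ q<) (<⇒≤ p<) a)
    ... | inj₂ a | inj₂ b = sym (suc-injective (c-injective q< p< b))
    ... | inj₂ a | inj₁ b with c-injective (<⇒≤ q<) p< a | c-injective q< (<⇒≤ p<) b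
    ...   | refl | ()

    at-pos : ∀ {u} → u ∈ V C → ∃[ p ] p ≤ n × u ≡ c p
    at-pos {u} u∈ = pos u , pos≤ u∈ , sym (c-pos u∈)

    -- The order `_≤‴_` is generated by raising the lower bound, which matches a walk built from its
    -- first vertex.
    arc : ∀ {a b} → a ≤‴ b → b ≤ n → W (c a) (c b)
    arc {a} (≤‴-reflexive refl) b≤ = nil (c a)
    arc {a} (≤‴-step q) b≤ = step (d a) (join (≤-trans (≤‴⇒≤ q) b≤)) (arc q b≤)

    arc-vs⁻ : ∀ {a b} (q : a ≤‴ b) (b≤ : b ≤ n) {u} → u ∈ˡ vs (arc q b≤) → ∃[ p ] a ≤ p × p ≤ b × u ≡ c p
    arc-vs⁻ {a} (≤‴-reflexive refl) b≤ (here refl) = a , ≤-refl , ≤-refl , refl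
    arc-vs⁻ {a} (≤‴-step q) b≤ (here refl) = a , ≤-refl , <⇒≤ (≤‴⇒≤ q) , refl
    arc-vs⁻ (≤‴-step q) b≤ (there u∈) with arc-vs⁻ q b≤ u∈
    ... | p , l , r , eq = p , <⇒≤ l , r , eq

    arc-vs⁺ : ∀ {a b} (q : a ≤‴ b) (b≤ : b ≤ n) {p} → a ≤ p → p ≤ b → c p ∈ˡ vs (arc q b≤)
    arc-vs⁺ (≤‴-reflexive refl) b≤ l r rewrite ≤-antisym r l = here refl
    arc-vs⁺ {a} (≤‴-step q) b≤ {p} l r with m≤n⇒m<n∨m≡n l
    ... | inj₂ refl = here refl
    ... | inj₁ a<p  = there (arc-vs⁺ q b≤ a<p r)

    arc-es⁻ : ∀ {a b} (q : a ≤‴ b) (b≤ : b ≤ n) {g} → g ∈ˡ es (arc q b≤) → ∃[ p ] a ≤ p × p < b × g ≡ d p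
    arc-es⁻ (≤‴-reflexive refl) b≤ ()
    arc-es⁻ {a} (≤‴-step q) b≤ (here refl) = a , ≤-refl , ≤‴⇒≤ q , refl
    arc-es⁻ (≤‴-step q) b≤ (there g∈) with arc-es⁻ q b≤ g∈
    ... | p , l , r , eq = p , <⇒≤ l , r , eq

    arc-es⁺ : ∀ {a b} (q : a ≤‴ b) (b≤ : b ≤ n) {p} → a ≤ p → p < b → d p ∈ˡ es (arc q b≤)
    arc-es⁺ (≤‴-reflexive refl) b≤ l r = ⊥-elim (<⇒≱ r l)
    arc-es⁺ {a} (≤‴-step q) b≤ {p} l r with m≤n⇒m<n∨m≡n l
    ... | inj₂ refl = here refl
    ... | inj₁ a<p  = there (arc-es⁺ q b≤ a<p r)

    arc-Unique : ∀ {a b} (q : a ≤‴ b) (b≤ : b ≤ n) → Unique (vs (arc q b≤))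
    arc-Unique (≤‴-reflexive refl) b≤ = [] ∷ []
    arc-Unique {a} (≤‴-step q) b≤ = Unique-∷⁺ a∉ (arc-Unique q b≤)
      where
      a∉ : c a ∉ˡ vs (arc q b≤)
      a∉ u∈ with arc-vs⁻ q b≤ u∈
      ... | p , l , r , eq = <⇒≢ l (c-injective (≤-trans (<⇒≤ (≤‴⇒≤ q)) b≤) (≤-trans r b≤) eq)

    abstract
      closed-arc : C ≡ closed e (arc (≤‴-from (z≤n {n})) ≤-refl)
      closed-arc = Sub-ext
        ((λ u∈ → let p , p≤ , eq = at-pos u∈ in
            ∈V-mk⁺ {vs P} {e ∷ es P} (subst (_∈ˡ vs P) (sym eq) (arc-vs⁺ _ ≤-refl z≤n p≤))) ,
         (λ g∈ → ∈E-mk⁺ {vs P} {e ∷ es P} (to (E-cases g∈))))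
        ((λ u∈ → let p , _ , p≤ , eq = arc-vs⁻ (≤‴-from z≤n) ≤-refl (∈V-mk⁻ {vs P} {e ∷ es P} u∈) in subst (_∈ V C) (sym eq) (c∈ p≤)) ,
         (λ g∈ → from (∈E-mk⁻ {vs P} {e ∷ es P} g∈)))
        where
        P : W (c 0) (c n)
        P = arc (≤‴-from (z≤n {n})) ≤-refl
        to : ∀ {g} → g ≡ e ⊎ (∃[ p ] p < n × g ≡ d p) → g ∈ˡ e ∷ es P
        to (inj₁ eq) = here eq
        to (inj₂ (p , p< , refl)) = there (arc-es⁺ _ ≤-refl z≤n p<)
        from : ∀ {g} → g ∈ˡ e ∷ es P → g ∈ E C
        from (here refl) = e∈
        from (there g∈) with arc-es⁻ (≤‴-from z≤n) ≤-refl g∈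
        ... | p , _ , p< , refl = d∈ p<

    abstract
      circle : IsCircle {G} C
      circle = subst (IsCircle {G}) (sym closed-arc)
        (closed-circle (arc (≤‴-from z≤n) ≤-refl) (arc-Unique _ ≤-refl) close λ e∈ →
          let p , _ , p< , eq = arc-es⁻ (≤‴-from z≤n) ≤-refl e∈ in d≢e p< (sym eq))

    arcConnects : ∀ {U a b} → a ≤‴ b → b ≤ n → (∀ {p} → a ≤ p → p < b → U (d p)) → Connects U (c a) (c b)
    arcConnects (≤‴-reflexive refl) b≤ f = ε
    arcConnects {a = a} (≤‴-step q) b≤ f =
      (d a , f ≤-refl (≤‴⇒≤ q) , join (≤-trans (≤‴⇒≤ q) b≤)) ◅ arcConnects q b≤ (λ l → f (<⇒≤ l))

  abstract
    rootedAt : ∀ {C e x y} → IsCircle {G} C → e ∈ E C → Jn e y x → Σ[ R ∈ Ring C e ] Ring.c R 0 ≡ x × Ring.c R (Ring.n R) ≡ y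
    rootedAt {C} {e} circ e∈ j with circle-closed {C} circ e∈ j
    ... | P , u , e∉ , refl = record
      { n = len P ; c = at P ; d = ed e P ; pos = idx P
      ; close = subst₂ (Jn e) (sym (at-len P)) (sym (at-zero P)) j
      ; join = ed-Jn e P ; pos-c = idx-at P u
      ; c-pos = λ u∈ → proj₁ (at-idx P (∈V-mk⁻ {vs P} {e ∷ es P} u∈))
      ; pos≤ = λ u∈ → proj₂ (at-idx P (∈V-mk⁻ {vs P} {e ∷ es P} u∈))
      ; c∈ = λ {p} _ → ∈V-mk⁺ {vs P} {e ∷ es P} (at∈ P p)
      ; d∈ = λ l → ∈E-mk⁺ {vs P} {e ∷ es P} (there (ed∈ e P l))
      ; e∈ = e∈
      ; d≢e = λ l eq → e∉ (subst (_∈ˡ es P) eq (ed∈ e P l))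
      ; E-cases = λ g∈ → cases (∈E-mk⁻ {vs P} {e ∷ es P} g∈) } , at-zero P , at-len P
      where
      cases : ∀ {g} → g ∈ˡ e ∷ es P → g ≡ e ⊎ ∃[ p ] p < len P × g ≡ ed e P p
      cases (here p)  = inj₁ p
      cases (there p) = inj₂ (es-ed e P p)

  link : ∀ {x y z w} → W x y → ∀ e → Jn e y z → W z w → W x w
  link (nil x)        e j Q = step e j Q
  link (step e′ k P) e j Q = step e′ k (link P e j Q)

  vs-link : ∀ {x y z w} (P : W x y) e (j : Jn e y z) (Q : W z w) → vs (link P e j Q) ≡ vs P ++ˡ vs Q
  vs-link (nil x)       e j Q = refl
  vs-link (step e′ k P) e j Q = cong (_ ∷_) (vs-link P e j Q)

  es-link : ∀ {x y z w} (P : W x y) e (j : Jn e y z) (Q : W z w) → es (link P e j Q) ≡ es P ++ˡ e ∷ es Q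
  es-link (nil x)       e j Q = refl
  es-link (step e′ k P) e j Q = cong (e′ ∷_) (es-link P e j Q)

  abstract
    circle-no3 : ∀ {C u g₁ g₂ g₃} → valency {G} C u ≡ 2 → g₁ ∈ E C → g₂ ∈ E C → g₃ ∈ E C →
                 Inc g₁ u → Inc g₂ u → Inc g₃ u → g₁ ≢ g₂ → g₁ ≢ g₃ → g₂ ≢ g₃ → Absurd
    circle-no3 {C} {u} {g₁} {g₂} {g₃} v2 m₁ m₂ m₃ i₁ i₂ i₃ n₁₂ n₁₃ n₂₃ = 1+n≰n (≤-trans
      (+-mono-≤ (ends#-Inc i₁) (+-mono-≤ (ends#-Inc i₂) (+-mono-≤ (ends#-Inc i₃) (z≤n {0}))))
      (≤-trans (val≤valency {C} {g₁ ∷ g₂ ∷ g₃ ∷ []} u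
        (((n₁₂ ∷ n₁₃ ∷ []) ∷ (n₂₃ ∷ []) ∷ [] ∷ []))
        λ { (here refl) → m₁ ; (there (here refl)) → m₂ ; (there (there (here refl))) → m₃ })
        (≤-reflexive v2)))

  -- Both subgraphs have valency 2 at u, so the edges of S at u exhaust those
  -- of C.
  abstract
    sameAt : ∀ {S C u h} → valency {G} S u ≡ 2 → valency {G} C u ≡ 2 →
             (∀ {g} → g ∈ E S → Inc g u → g ∈ E C) → h ∈ E C → Inc h u → h ∈ E S
    sameAt {S} {C} {u} {h} vS vC sub h∈ i with h ∈? E S
    ... | yes p = p
    ... | no h∉ = ⊥-elim (1+n≰n (≤-trans (+-mono-≤ (ends#-Inc i) (≤-reflexive (trans (sym vS) valS)))
         (≤-trans (val≤valency {C} {h ∷ xs} u (Unique-∷⁺ (λ q → h∉ (proj₁ (∈-edgesAt⁻ {S} q))) (edgesAt-Unique S u))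
            λ { (here refl) → h∈ ; (there q) → let q∈ , qi = ∈-edgesAt⁻ {S} q in sub q∈ qi }) (≤-reflexive vC))))
      where
      xs : List (Fin #E)
      xs = edgesAt {G} S u
      valS : valency {G} S u ≡ val xs u
      valS = trans (valency-val S u) (lem (edges S))
        where
        lem : ∀ ys → val ys u ≡ val (filter (λ e → incident? {G} e u) ys) u
        lem [] = refl
        lem (y ∷ ys) with proj₁ (ends y) ≟ u | proj₂ (ends y) ≟ u in eq₂
        ... | no _ | no _ = lem ys
        ... | no p | yes _ rewrite dec-false (proj₁ (ends y) ≟ u) p | eq₂ = cong suc (lem ys)
        ... | yes p | _ rewrite dec-true (proj₁ (ends y) ≟ u) p | eq₂ = cong suc (trans (cong (_ +_) (lem ys)) refl)


-- Nested chords

abstract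
  -- Meant for the map from the four branch vertices of a subdivided K₄ to the four chord ends.
  -- Punching out a missed value would give an injection into a smaller set.
  injection-onto : ∀ {n} {g : Fin n → Fin n} → Injective _≡_ _≡_ g → ∀ t → ∃[ s ] g s ≡ t
  injection-onto {zero} _ ()
  injection-onto {suc n} {g} inj t with any? (λ s → g s ≟ t)
  ... | yes r = r
  ... | no none = ⊥-elim (1+n≰n (injective⇒≤ {f = λ s → punchOut (miss s)}
                    λ {s} {s′} eq → inj (punchOut-injective (miss s) (miss s′) eq)))
    where
    miss : ∀ s → t ≢ g s
    miss s eq = none (s , sym eq)

module Chords (G : Graph) {C : Sub G} {e : Fin (Graph.#E G)} (R : Rings.Ring G C e) where
  open Graph G
  open Rings G
  open Ring R

  C-valency : ∀ {u} → u ∈ V C → valency {G} C u ≡ 2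
  C-valency = proj₂ circle _

  -- Deleting c b and c a′ separates c a from c b′.
  abstract
    separated : ∀ {H X : Sub G} {f f′ a b a′ b′} → (∀ {g} → g ∈ E H → g ∈ E C ⊎ g ≡ f ⊎ g ≡ f′) →
      Jn f (c a) (c b) → Jn f′ (c a′) (c b′) → a < b → b ≤ n → a′ < b′ → b′ ≤ n → a < a′ → b′ < b →
      IsConnected {G} X → (∀ {g} → g ∈ E X → g ∈ E H) → c b ∉ V X → c a′ ∉ V X →
      c a ∈ V X → c b′ ∈ V X → Absurd
    separated {H} {X} {f} {f′} {a} {b} {a′} {b′} EH jf jf′ a<b b≤n a′<b′ b′≤n a<a′ b′<b (sg , _ , conn) sub b∉ a′∉ a∈ b′∈ =
      contra (Connects-invariant Near move (conn _ _ a∈ b′∈) (a , ≤-trans (<⇒≤ a<b) b≤n , refl , inj₁ a<a′))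
      where
      -- The side of `c a` after the deletion: the positions below `a′` and those above `b`, joined
      -- through the root edge.
      Near : Fin #V → Set
      Near u = ∃[ p ] p ≤ n × u ≡ c p × (p < a′ ⊎ b < p)

      near : ∀ {p r} → r ≤ n → r ≤ suc p → p ≤ suc r → c r ∈ V X → p < a′ ⊎ b < p → Near (c r)
      near {p} {r} r≤n r≤ p≤ r∈ (inj₁ l) = r , r≤n , refl , inj₁ (≤∧≢⇒< (≤-trans r≤ l) λ { refl → a′∉ r∈ })
      near {p} {r} r≤n r≤ p≤ r∈ (inj₂ l) = r , r≤n , refl , inj₂ (≤∧≢⇒< (s≤s⁻¹ (≤-trans l p≤)) λ { refl → b∉ r∈ })

      move : ∀ {g x y} → g ∈ E X → Jn g x y → Near x → Near y
      move {g} {x} {y} g∈ jg (p , p≤n , refl , far) with EH (sub g∈)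
      ... | inj₂ (inj₁ refl) = ⊥-elim (b∉ (ends∈ {X} sg g∈ (Jn-Incʳ jf)))
      ... | inj₂ (inj₂ refl) = ⊥-elim (a′∉ (ends∈ {X} sg g∈ (Jn-Inc jf′)))
      ... | inj₁ gC with E-cases gC
      ...   | inj₁ refl with Jn-only close (Jn-Incʳ jg)
      ...     | inj₁ refl = n , ≤-refl , refl , inj₂ (≤∧≢⇒< b≤n λ { refl → b∉ (ends∈ {X} sg g∈ (Jn-Incʳ jg)) })
      ...     | inj₂ refl = 0 , z≤n , refl , inj₁ (≤-<-trans z≤n a<a′)
      move {g} {x} {y} g∈ jg (p , p≤n , refl , far) | inj₁ gC | inj₂ (r , r<n , refl)
        with Jn-only (join r<n) (Jn-Inc jg) | Jn-only (join r<n) (Jn-Incʳ jg)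
      ... | inj₁ eq | inj₁ refl with c-injective p≤n (<⇒≤ r<n) eq
      ...   | refl = r , <⇒≤ r<n , refl , far
      move {g} {x} {y} g∈ jg (p , p≤n , refl , far) | inj₁ gC | inj₂ (r , r<n , refl)
          | inj₁ eq | inj₂ refl with c-injective p≤n (<⇒≤ r<n) eq
      ...   | refl = near r<n ≤-refl (≤-trans (n≤1+n _) (n≤1+n _)) (ends∈ {X} sg g∈ (Jn-Incʳ jg)) far
      move {g} {x} {y} g∈ jg (p , p≤n , refl , far) | inj₁ gC | inj₂ (r , r<n , refl)
          | inj₂ eq | inj₁ refl with c-injective p≤n r<n eq
      ...   | refl = near (<⇒≤ r<n) (≤-trans (n≤1+n _) (n≤1+n _)) ≤-refl (ends∈ {X} sg g∈ (Jn-Incʳ jg)) far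
      move {g} {x} {y} g∈ jg (p , p≤n , refl , far) | inj₁ gC | inj₂ (r , r<n , refl)
          | inj₂ eq | inj₂ refl with c-injective p≤n r<n eq
      ...   | refl = suc r , r<n , refl , far

      contra : Near (c b′) → Absurd
      contra (p , p≤n , eq , far) with c-injective b′≤n p≤n eq
      ... | refl = [ (λ l → <⇒≱ l (<⇒≤ a′<b′)) , (λ l → <⇒≱ l (<⇒≤ b′<b)) ]′ far

  -- Three edges leave each branch vertex and `C` supplies at most two, so it is an end of a chord;
  -- hence the branch vertices are the four chord ends, all distinct. They lie on `C` in the order
  -- `a`, `a′`, `b′`, `b`, and the path of the subdivision from `c a` to `c b′` would have to avoid
  -- `c b` and `c a′`, against `separated`.
  nested-¬K₄ : ∀ {H f f′ a b a′ b′} → (∀ {g} → g ∈ E H → g ∈ E C ⊎ g ≡ f ⊎ g ≡ f′) →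
    Jn f (c a) (c b) → Jn f′ (c a′) (c b′) → a < b → b ≤ n → a′ < b′ → b′ ≤ n →
    a ≤ a′ → b′ ≤ b → ¬ IsK₄Subdivision {G} H
  nested-¬K₄ {H} {f} {f′} {a} {b} {a′} {b′} EH jf jf′ a<b b≤n a′<b′ b′≤n a≤a′ b′≤b
    (br , P , br-inj , paths , disj , VH , EH⇔) = contra
    where
    -- `P` is a path only for `i < j`. It is made symmetric because the order of the branch vertices
    -- sitting at given chord ends is unknown.
    Q : Fin 4 → Fin 4 → Sub G
    Q i j with <-cmp i j
    ... | tri> _ _ _ = P j i
    ... | _          = P i j

    record Facts (X : Sub G) (i j : Fin 4) : Set where
      field
        con : IsConnected {G} X
        br∈ : br i ∈ V X
        br∈ʳ : br j ∈ V X
        one : valency {G} X (br i) ≡ 1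
        sub : ∀ {g} → g ∈ E X → g ∈ E H

    facts : ∀ {i j} → i ≢ j → Facts (Q i j) i j
    facts {i} {j} i≢j with <-cmp i j
    ... | tri≈ _ eq _ = ⊥-elim (i≢j eq)
    ... | tri< l _ ¬g = record { con = cn ; br∈ = x ; br∈ʳ = y ; one = vx ; sub = λ g∈ → Equivalence.from (EH⇔ _) (i , j , l , g∈) }
      where
      pth = paths i j l
      cn = proj₁ pth ; x = proj₁ (proj₂ (proj₂ pth)) ; y = proj₁ (proj₂ (proj₂ (proj₂ pth)))
      vx = proj₁ (proj₂ (proj₂ (proj₂ (proj₂ pth))))
    ... | tri> _ _ l = record { con = cn ; br∈ = y ; br∈ʳ = x ; one = vy ; sub = λ g∈ → Equivalence.from (EH⇔ _) (j , i , l , g∈) }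
      where
      pth = paths j i l
      cn = proj₁ pth ; x = proj₁ (proj₂ (proj₂ pth)) ; y = proj₁ (proj₂ (proj₂ (proj₂ pth)))
      vy = proj₁ (proj₂ (proj₂ (proj₂ (proj₂ (proj₂ pth)))))

    Q-disjoint : ∀ {i j k l x} → i ≢ j → k ≢ l → ¬ (i ≡ k × j ≡ l) → ¬ (i ≡ l × j ≡ k) →
                 x ∈ V (Q i j) → x ∈ V (Q k l) → (x ≡ br i ⊎ x ≡ br j) × (x ≡ br k ⊎ x ≡ br l)
    Q-disjoint {i} {j} {k} {l} {x} i≢j k≢l n₁ n₂ p q with <-cmp i j | <-cmp k l
    ... | tri≈ _ eq _ | _ = ⊥-elim (i≢j eq)
    ... | tri< _ _ _ | tri≈ _ eq _ = ⊥-elim (k≢l eq)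
    ... | tri> _ _ _ | tri≈ _ eq _ = ⊥-elim (k≢l eq)
    ... | tri< u _ _ | tri< w _ _ = disj i j k l u w (λ eq → n₁ (,-injective eq)) x p q
    ... | tri< u _ _ | tri> _ _ w = let r , s = disj i j l k u w (λ eq → n₂ (,-injective eq)) x p q in r , swap⊎ s
    ... | tri> _ _ u | tri< w _ _ = let r , s = disj j i k l u w (λ eq → n₂ (proj₂ (,-injective eq) , proj₁ (,-injective eq))) x p q in swap⊎ r , s
    ... | tri> _ _ u | tri> _ _ w = let r , s = disj j i l k u w (λ eq → n₁ (proj₂ (,-injective eq) , proj₁ (,-injective eq))) x p q in swap⊎ r , swap⊎ s

    br-avoids : ∀ {i j k} → i ≢ j → k ≢ i → k ≢ j → br k ∉ V (Q i j)
    br-avoids i≢j k≢i k≢j k∈ = [ k≢i ∘ br-inj , k≢j ∘ br-inj ]′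
      (proj₁ (Q-disjoint i≢j k≢i (λ (p , _) → k≢i (sym p)) (λ (_ , r) → k≢j (sym r)) k∈ (Facts.br∈ (facts k≢i))))

    firstEdge : ∀ {i j} → i ≢ j → ∃[ h ] h ∈ E (Q i j) × Inc h (br i) × ¬ Loop h
    firstEdge {i} {j} ne with valency-edge {Q i j} (≤-reflexive (sym (Facts.one (facts ne))))
    ... | h , h∈ , inc = h , h∈ , inc , λ lp → 1+n≰n (≤-trans (two lp)
            (≤-trans (val≤valency {Q i j} {h ∷ []} (br i) ([] ∷ []) λ { (here refl) → h∈ })
              (≤-reflexive (Facts.one (facts ne)))))
      where
      two : Loop h → 2 ≤ val (h ∷ []) (br i)
      two lp with Inc-Jn inc
      ... | w , jw with Jn-Loop lp jw
      ... | refl rewrite ends#-Jn (br i) jw | δ-refl (br i) = ≤-refl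

    firstEdges-distinct : ∀ {i j k h h′} → i ≢ j → i ≢ k → j ≢ k → h ∈ E (Q i j) → h′ ∈ E (Q i k) →
                          Inc h (br i) → ¬ Loop h → h ≢ h′
    firstEdges-distinct {i} {j} {k} {h} ij ik jk h∈ h′∈ inc nl refl with Inc-Jn inc
    ... | w , jw with Q-disjoint ij ik (jk ∘ proj₂) (λ (p , q) → ij (sym q))
                        (ends∈ (proj₁ (Facts.con (facts ij))) h∈ (Jn-Incʳ jw))
                        (ends∈ (proj₁ (Facts.con (facts ik))) h′∈ (Jn-Incʳ jw))
    ... | inj₁ refl , _ = nl (Loop-Jn jw)
    ... | inj₂ _ , inj₁ refl = nl (Loop-Jn jw)
    ... | inj₂ p , inj₂ q = jk (br-inj (trans (sym p) q))

    atChord : ∀ i → Inc f (br i) ⊎ Inc f′ (br i)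
    atChord i with incident? {G} f (br i) | incident? {G} f′ (br i)
    ... | yes p | _ = inj₁ p
    ... | no _ | yes p = inj₂ p
    ... | no ¬p | no ¬q = ⊥-elim (circle-no3 {C} (C-valency (ends∈ (proj₁ (proj₁ circle)) (inC k₀) (ic k₀))) 
            (inC k₀) (inC k₁) (inC k₂) (ic k₀) (ic k₁) (ic k₂)
            (ds k₀ k₁ λ ()) (ds k₀ k₂ λ ()) (ds k₁ k₂ λ ()))
      where
      k₀ k₁ k₂ : Fin 3
      k₀ = zero ; k₁ = suc zero ; k₂ = suc (suc zero)
      ne : ∀ k → i ≢ punchIn i k
      ne k = punchInᵢ≢i i k ∘ sym
      h : Fin 3 → Fin #E
      h k = proj₁ (firstEdge (ne k))
      h∈ = λ k → proj₁ (proj₂ (firstEdge (ne k)))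
      ic = λ k → proj₁ (proj₂ (proj₂ (firstEdge (ne k))))
      inC : ∀ k → h k ∈ E C
      inC k with EH (Facts.sub (facts (ne k)) (h∈ k))
      ... | inj₁ p = p
      ... | inj₂ (inj₁ eq) = ⊥-elim (¬p (subst (λ g → Inc g (br i)) eq (ic k)))
      ... | inj₂ (inj₂ eq) = ⊥-elim (¬q (subst (λ g → Inc g (br i)) eq (ic k)))
      ds : ∀ k l → k ≢ l → h k ≢ h l
      ds k l k≢l = firstEdges-distinct (ne k) (ne l) (k≢l ∘ punchIn-injective i k l) (h∈ k) (h∈ l) (ic k)
                     (proj₂ (proj₂ (proj₂ (firstEdge (ne k)))))

    q : Fin 4 → ℕ
    q = λ { zero → a ; (suc zero) → b ; (suc (suc zero)) → a′ ; (suc (suc (suc zero))) → b′ }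

    code : ∀ i → ∃[ s ] br i ≡ c (q s)
    code i with atChord i
    ... | inj₁ p = [ zero ,_ , suc zero ,_ ]′ (Jn-only jf p)
    ... | inj₂ p = [ suc (suc zero) ,_ , suc (suc (suc zero)) ,_ ]′ (Jn-only jf′ p)

    onto : ∀ t → ∃[ i ] br i ≡ c (q t)
    onto t with injection-onto {g = proj₁ ∘ code} (λ {i} {j} eq →
                   br-inj (trans (proj₂ (code i)) (trans (cong (c ∘ q) eq) (sym (proj₂ (code j)))))) t
    ... | i , refl = i , proj₂ (code i)

    q-inj : ∀ {s t} → q s ≡ q t → s ≡ t
    q-inj {s} {t} eq = trans (sym (pre s)) (trans (cong (proj₁ ∘ code) same) (pre t))
      where
      ont : ∀ t → ∃[ i ] proj₁ (code i) ≡ t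
      ont = injection-onto {g = proj₁ ∘ code} (λ {i} {j} eq →
                   br-inj (trans (proj₂ (code i)) (trans (cong (c ∘ q) eq) (sym (proj₂ (code j))))))
      pre = λ t → proj₂ (ont t)
      same : proj₁ (ont s) ≡ proj₁ (ont t)
      same = br-inj (trans (proj₂ (code _)) (trans (cong c (trans (cong q (pre s)) (trans eq (cong q (sym (pre t)))))) (sym (proj₂ (code _)))))

    -- Four branch vertices on four chord ends keep these ends apart, so the weak inequalities
    -- become strict.
    a<a′ : a < a′
    a<a′ = ≤∧≢⇒< a≤a′ λ eq → case q-inj {zero} {suc (suc zero)} eq of λ ()
    b′<b : b′ < b
    b′<b = ≤∧≢⇒< b′≤b λ eq → case q-inj {suc (suc (suc zero))} {suc zero} eq of λ ()

    i j : Fin 4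
    i = proj₁ (onto zero)
    j = proj₁ (onto (suc (suc (suc zero))))

    q≤ : ∀ t → q t ≤ n
    q≤ zero = ≤-trans (<⇒≤ a<b) b≤n
    q≤ (suc zero) = b≤n
    q≤ (suc (suc zero)) = ≤-trans (<⇒≤ a′<b′) b′≤n
    q≤ (suc (suc (suc zero))) = b′≤n

    onto-≢ : ∀ {s t} → s ≢ t → proj₁ (onto s) ≢ proj₁ (onto t)
    onto-≢ {s} {t} ne eq = ne (q-inj (c-injective (q≤ s) (q≤ t)
      (trans (sym (proj₂ (onto s))) (trans (cong br eq) (proj₂ (onto t))))))

    i≢j : i ≢ j
    i≢j = onto-≢ λ ()

    avoids : ∀ t → t ≢ zero → t ≢ suc (suc (suc zero)) → c (q t) ∉ V (Q i j)
    avoids t n₁ n₂ t∈ = br-avoids i≢j (onto-≢ n₁) (onto-≢ n₂) (subst (_∈ V (Q i j)) (sym (proj₂ (onto t))) t∈)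

    contra : Absurd
    contra = separated {H} EH jf jf′ a<b b≤n a′<b′ b′≤n a<a′ b′<b (Facts.con (facts i≢j)) (Facts.sub (facts i≢j))
      (avoids (suc zero) (λ ()) (λ ())) (avoids (suc (suc zero)) (λ ()) (λ ()))
      (subst (_∈ V (Q i j)) (proj₂ (onto zero)) (Facts.br∈ (facts i≢j)))
      (subst (_∈ V (Q i j)) (proj₂ (onto (suc (suc (suc zero))))) (Facts.br∈ʳ (facts i≢j)))


-- Handles of nested chords

module Handles (G : Graph) {C : Sub G} {e : Fin (Graph.#E G)} (R : Rings.Ring G C e) where
  open Graph G
  open Rings G
  open Ring R
  open Chords G R

  abstract
    -- Membership in `S` passes between consecutive edges of the walk through their common inner
    -- vertex, hence it is constant along the walk.
    allOrNone : (S : Sub G) → ∀ {x y} (P : W x y) → Unique (vs P) →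
      (∀ {z g h} → z ∈ˡ vs P → z ≢ x → z ≢ y → g ∈ˡ es P → h ∈ˡ es P → Inc g z → Inc h z → g ∈ E S → h ∈ E S) →
      (∀ {g} → g ∈ˡ es P → g ∈ E S) ⊎ (∀ {g} → g ∈ˡ es P → g ∉ E S)
    allOrNone S (nil x) u f = inj₁ λ ()
    allOrNone S (step e j (nil y)) u f with e ∈? E S
    ... | yes p = inj₁ λ { (here refl) → p }
    ... | no p  = inj₂ λ { (here refl) → p }
    allOrNone S (step {x} e j P@(step {x′} {z = y} h k P′)) u f
      with allOrNone S P (Unique-tail u) (λ z∈ _ z≢y g∈ h∈ → f (there z∈) (λ { refl → Unique-∷⁻ u z∈ }) z≢y (there g∈) (there h∈))
    ... | inj₁ all = inj₁ λ { (here refl) → f (there (here refl)) x′≢x x′≢y (there (here refl)) (here refl) (Jn-Inc k) (Jn-Incʳ j) (all (here refl))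
                            ; (there p) → all p }
      where
      x′≢x : x′ ≢ x
      x′≢x refl = Unique-∷⁻ u (here refl)
      x′≢y : x′ ≢ y
      x′≢y refl = Unique-∷⁻ (Unique-tail u) (target∈ P′)
    ... | inj₂ none = inj₂ λ { (here refl) e∈ → none (here refl) (f (there (here refl)) x′≢x x′≢y (here refl) (there (here refl)) (Jn-Incʳ j) (Jn-Inc k) e∈)
                             ; (there p) → none p }
      where
      x′≢x : x′ ≢ x
      x′≢x refl = Unique-∷⁻ u (here refl)
      x′≢y : x′ ≢ y
      x′≢y refl = Unique-∷⁻ (Unique-tail u) (target∈ P′)

  abstract
    walk-covered : ∀ {x y z w e} {j : Jn e x w} {P : W w y} → z ∈ˡ vs (step e j P) → ∃[ g ] g ∈ˡ e ∷ es P × Inc g z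
    walk-covered {e = e} {j} (here refl) = e , here refl , Jn-Inc j
    walk-covered {e = e} {j} {nil y} (there (here refl)) = e , here refl , Jn-Incʳ j
    walk-covered {P = step h k P} (there z∈) with walk-covered {j = k} {P = P} z∈
    ... | g , g∈ , i = g , there g∈ , i

  abstract
    trail-unique : ∀ {S : Sub G} {x y} (P : W x y) → x ≢ y → IsSubgraph {G} S → (∀ {z} → z ∈ V S → 1 ≤ valency {G} S z) →
      (∀ {g} → g ∈ E S → g ∈ˡ es P) → (∀ {g} → g ∈ˡ es P → g ∈ E S) → S ≡ trail P
    trail-unique (nil x) x≢y _ _ _ _ = ⊥-elim (x≢y refl)
    trail-unique {S} P@(step e j P′) x≢y sub pos to from = Sub-ext
      ((λ z∈ → let g , g∈ , i = valency-edge {S} (pos z∈) in ∈V-mk⁺ {vs P} {es P} (es-Inc P (to g∈) i)) ,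
       (λ g∈ → ∈E-mk⁺ {vs P} {es P} (to g∈)))
      ((λ z∈ → let g , g∈ , i = walk-covered {j = j} {P = P′} (∈V-mk⁻ {vs P} {es P} z∈) in ends∈ {S} sub (from g∈) i) ,
       (λ g∈ → from (∈E-mk⁻ {vs P} {es P} g∈)))

  module _ {a b : ℕ} (a<b : a < b) (b≤n : b ≤ n) where

    innerWalk : W (c a) (c b)
    innerWalk = arc (≤‴-from (<⇒≤ a<b)) b≤n

    a≤n : a ≤ n
    a≤n = ≤-trans (<⇒≤ a<b) b≤n

    upper : W (c b) (c n)
    upper = arc (≤‴-from b≤n) ≤-refl
    lower : W (c 0) (c a)
    lower = arc (≤‴-from z≤n) a≤n

    outerWalk : W (c b) (c a)
    outerWalk = link upper e close lower

    inner outer : Sub G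
    inner = trail innerWalk
    outer = trail outerWalk

    outer-vs⁻ : ∀ {u} → u ∈ˡ vs outerWalk → ∃[ p ] p ≤ n × (b ≤ p ⊎ p ≤ a) × u ≡ c p
    outer-vs⁻ u∈ with ∈-++ˡ⁻ (vs upper) (subst (_ ∈ˡ_) (vs-link upper e close lower) u∈)
    ... | inj₁ q = let p , l , r , eq = arc-vs⁻ (≤‴-from b≤n) ≤-refl q in p , r , inj₁ l , eq
    ... | inj₂ q = let p , l , r , eq = arc-vs⁻ (≤‴-from z≤n) a≤n q in p , ≤-trans r a≤n , inj₂ r , eq

    outer-vs⁺ : ∀ {p} → p ≤ n → b ≤ p ⊎ p ≤ a → c p ∈ˡ vs outerWalk
    outer-vs⁺ {p} p≤n l = subst (c p ∈ˡ_) (sym (vs-link upper e close lower))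
      ([ (λ r → ∈-++ˡ⁺ˡ (arc-vs⁺ (≤‴-from b≤n) ≤-refl r p≤n)) , (λ r → ∈-++ˡ⁺ʳ (vs upper) (arc-vs⁺ _ a≤n z≤n r)) ]′ l)

    outer-es⁻ : ∀ {g} → g ∈ˡ es outerWalk → g ≡ e ⊎ ∃[ p ] p < n × (b ≤ p ⊎ p < a) × g ≡ d p
    outer-es⁻ g∈ with ∈-++ˡ⁻ (es upper) (subst (_ ∈ˡ_) (es-link upper e close lower) g∈)
    ... | inj₁ q = let p , l , r , eq = arc-es⁻ (≤‴-from b≤n) ≤-refl q in inj₂ (p , r , inj₁ l , eq)
    ... | inj₂ (here eq) = inj₁ eq
    ... | inj₂ (there q) = let p , l , r , eq = arc-es⁻ (≤‴-from z≤n) a≤n q in inj₂ (p , ≤-trans r a≤n , inj₂ r , eq)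

    outer-e : e ∈ˡ es outerWalk
    outer-e = subst (e ∈ˡ_) (sym (es-link upper e close lower)) (∈-++ˡ⁺ʳ (es upper) (here refl))

    outer-es⁺ : ∀ {p} → p < n → b ≤ p ⊎ p < a → d p ∈ˡ es outerWalk
    outer-es⁺ {p} p<n l = subst (d p ∈ˡ_) (sym (es-link upper e close lower))
      ([ (λ r → ∈-++ˡ⁺ˡ (arc-es⁺ (≤‴-from b≤n) ≤-refl r p<n)) , (λ r → ∈-++ˡ⁺ʳ (es upper) (there (arc-es⁺ _ a≤n z≤n r))) ]′ l)

    inner-Unique : Unique (vs innerWalk)
    inner-Unique = arc-Unique _ b≤n

    outer-Unique : Unique (vs outerWalk)
    outer-Unique = subst Unique (sym (vs-link upper e close lower))
      (Uniq.++⁺ (arc-Unique _ ≤-refl) (arc-Unique _ a≤n) disjoint)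
      where
      disjoint : ∀ {u} → ¬ (u ∈ˡ vs upper × u ∈ˡ vs lower)
      disjoint (p∈ , q∈) with arc-vs⁻ (≤‴-from b≤n) ≤-refl p∈ | arc-vs⁻ (≤‴-from z≤n) a≤n q∈
      ... | p , l , r , refl | q , _ , s , eq with c-injective r (≤-trans s a≤n) eq
      ... | refl = <⇒≱ a<b (≤-trans l s)

    ca≢cb : c a ≢ c b
    ca≢cb eq = <⇒≢ a<b (c-injective a≤n b≤n eq)

    inner-⊑ : inner ⊑ C
    inner-⊑ = mkSub-⊑ {vs innerWalk} {es innerWalk} {C}
      (λ u∈ → let p , _ , r , eq = arc-vs⁻ (≤‴-from (<⇒≤ a<b)) b≤n u∈ in subst (_∈ V C) (sym eq) (c∈ (≤-trans r b≤n)))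
      (λ g∈ → let p , _ , r , eq = arc-es⁻ (≤‴-from (<⇒≤ a<b)) b≤n g∈ in subst (_∈ E C) (sym eq) (d∈ (≤-trans r b≤n)))

    outer-es-C : ∀ {g} → g ∈ˡ es outerWalk → g ∈ E C
    outer-es-C g∈ with outer-es⁻ g∈
    ... | inj₁ refl = e∈
    ... | inj₂ (p , p<n , _ , refl) = d∈ p<n

    outer-⊑ : outer ⊑ C
    outer-⊑ = mkSub-⊑ {vs outerWalk} {es outerWalk} {C}
      (λ u∈ → let p , r , _ , eq = outer-vs⁻ u∈ in subst (_∈ V C) (sym eq) (c∈ r)) outer-es-C

    inner-path : IsPath {G} inner (c a) (c b)
    inner-path = trail-path innerWalk inner-Unique ca≢cb

    outer-path : IsPath {G} outer (c b) (c a)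
    outer-path = trail-path outerWalk outer-Unique (ca≢cb ∘ sym)

    inner-es-C : ∀ {g} → g ∈ˡ es innerWalk → g ∈ E C
    inner-es-C g∈ = proj₂ inner-⊑ (∈E-mk⁺ {vs innerWalk} {es innerWalk} g∈)

    e∉inner : e ∉ E inner
    e∉inner e∈′ with arc-es⁻ (≤‴-from (<⇒≤ a<b)) b≤n (∈E-mk⁻ {vs innerWalk} {es innerWalk} e∈′)
    ... | p , _ , r , eq = d≢e (≤-trans r b≤n) (sym eq)

    inner-or-outer : ∀ {g} → g ∈ E C → g ∈ˡ es innerWalk ⊎ g ∈ˡ es outerWalk
    inner-or-outer g∈ with E-cases g∈
    ... | inj₁ refl = inj₂ outer-e
    ... | inj₂ (p , p<n , refl) with <-≤-connex p a | <-≤-connex p b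
    ...   | inj₁ l | _      = inj₂ (outer-es⁺ p<n (inj₂ l))
    ...   | inj₂ l | inj₁ r = inj₁ (arc-es⁺ _ b≤n l r)
    ...   | inj₂ _ | inj₂ r = inj₂ (outer-es⁺ p<n (inj₁ r))

    -- Since inner vertices have valency 2, each of the two arcs between `c a` and `c b` lies in `S`
    -- entirely or not at all. Both arcs would give `c a` valency 2, and neither would leave it
    -- without an edge.
    pathInCircle : {S : Sub G} → IsSubgraph {G} S → S ⊑ C → valency {G} S (c a) ≡ 1 → valency {G} S (c b) ≡ 1 →
      (∀ z → z ∈ V S → z ≢ c a → z ≢ c b → valency {G} S z ≡ 2) → S ≡ inner ⊎ S ≡ outer
    pathInCircle {S} sub (_ , S⊑C) v1a v1b v2 with allOrNone S innerWalk inner-Unique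
           (λ {z} {g} {h} _ z≢a z≢b _ h∈ ig ih g∈ → spread {z} {g} {h} z≢a z≢b (inner-es-C h∈) ig ih g∈)
         | allOrNone S outerWalk outer-Unique
           (λ {z} {g} {h} _ z≢b z≢a _ h∈ ig ih g∈ → spread {z} {g} {h} z≢a z≢b (outer-es-C h∈) ig ih g∈)
      where
      spread : ∀ {z g h} → z ≢ c a → z ≢ c b → h ∈ E C → Inc g z → Inc h z → g ∈ E S → h ∈ E S
      spread z≢a z≢b h∈ ig ih g∈ = sameAt {S} {C} (v2 _ (ends∈ {S} sub g∈ ig) z≢a z≢b)
        (C-valency (ends∈ {C} (proj₁ (proj₁ circle)) h∈ ih)) (λ g∈ _ → S⊑C g∈) h∈ ih
    ... | inj₁ f | inj₁ g = ⊥-elim (1+n≰n (≤-trans (≤-reflexive (sym (C-valency (c∈ a≤n))))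
            (≤-trans (≤-reflexive (valency-val C (c a))) (≤-trans
              (val≤valency {S} {edges C} (c a) (edges-Unique C) λ h∈ → [ f , g ]′ (inner-or-outer (∈-edges⁻ {C} h∈)))
              (≤-reflexive v1a)))))
    ... | inj₂ f | inj₂ g = let h , h∈ , _ = valency-edge {S} (≤-reflexive (sym v1a)) in
            ⊥-elim ([ (λ p → f p h∈) , (λ p → g p h∈) ]′ (inner-or-outer (S⊑C h∈)))
    ... | inj₁ f | inj₂ g = inj₁ (trail-unique {S} innerWalk ca≢cb sub v1
            (λ h∈ → [ id , (λ p → ⊥-elim (g p h∈)) ]′ (inner-or-outer (S⊑C h∈))) f)
      where
      v1 : ∀ {z} → z ∈ V S → 1 ≤ valency {G} S z
      v1 {z} z∈ with z ≟ c a | z ≟ c b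
      ... | yes refl | _ = ≤-reflexive (sym v1a)
      ... | no _ | yes refl = ≤-reflexive (sym v1b)
      ... | no p | no q = ≤-trans (s≤s z≤n) (≤-reflexive (sym (v2 z z∈ p q)))
    ... | inj₂ f | inj₁ g = inj₂ (trail-unique {S} outerWalk (ca≢cb ∘ sym) sub v1
            (λ h∈ → [ (λ p → ⊥-elim (f p h∈)) , id ]′ (inner-or-outer (S⊑C h∈))) g)
      where
      v1 : ∀ {z} → z ∈ V S → 1 ≤ valency {G} S z
      v1 {z} z∈ with z ≟ c a | z ≟ c b
      ... | yes refl | _ = ≤-reflexive (sym v1a)
      ... | no _ | yes refl = ≤-reflexive (sym v1b)
      ... | no p | no q = ≤-trans (s≤s z≤n) (≤-reflexive (sym (v2 z z∈ p q)))

  module _ {H : Sub G} {k : ℕ} (chord : Fin (suc k) → Fin #E) (a b : Fin (suc k) → ℕ)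
    (a<b : ∀ i → a i < b i) (b≤n : ∀ i → b i ≤ n) (jn : ∀ i → Jn (chord i) (c (a i)) (c (b i)))
    (isChord : ∀ i → IsChord {G} H C (chord i)) (allChords : ∀ f → IsChord {G} H C f → ∃[ i ] f ≡ chord i)
    (nested : ∀ i j → ¬ (a i < a j × b i < b j)) where

    private
      Inside : Fin (suc k) → Fin (suc k) → Set
      Inside i j = a j ≤ a i × b i ≤ b j

      -- `nested` forbids intervals side by side as well as crossing ones, so of two intervals one
      -- contains the other.
      inside-total : ∀ i j → Inside i j ⊎ Inside j i
      inside-total i j with <-cmpⁿ (a i) (a j)
      ... | tri< l _ _ = inj₂ (<⇒≤ l , ≮⇒≥ λ r → nested i j (l , r))
      ... | tri> _ _ l = inj₁ (<⇒≤ l , ≮⇒≥ λ r → nested j i (l , r))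
      ... | tri≈ _ eq _ with ≤-total (b i) (b j)
      ...   | inj₁ r = inj₁ (≤-reflexive (sym eq) , r)
      ...   | inj₂ r = inj₂ (≤-reflexive eq , r)

    nested-noCross : ∀ f f′ → IsChord {G} H C f → IsChord {G} H C f′ → f ≢ f′ → ¬ Cross {G} C f f′
    nested-noCross f f′ cf cf′ _ K with allChords f cf | allChords f′ cf′
    ... | i , refl | j , refl with inside-total i j
    ... | inj₁ (l , r) = nested-¬K₄ {f = chord j} {chord i} (λ g∈ → map⊎ id (swap⊎ ∘ ends⁻) (x∈p∪q⁻ (E C) _ g∈))
                           (jn j) (jn i) (a<b j) (b≤n j) (a<b i) (b≤n i) l r K
    ... | inj₂ (l , r) = nested-¬K₄ {f = chord i} {chord j} (λ g∈ → map⊎ id ends⁻ (x∈p∪q⁻ (E C) _ g∈))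
                           (jn i) (jn j) (a<b i) (b≤n i) (a<b j) (b≤n j) l r K

    private
      endpoint : ∀ {z} → ChordEndpoint {G} H C z → ∃[ j ] (z ≡ c (a j) ⊎ z ≡ c (b j))
      endpoint (f , cf , i) with allChords f cf
      ... | j , refl = j , Jn-only (jn j) i

      aEnd : ∀ i → ChordEndpoint {G} H C (c (a i))
      aEnd i = chord i , isChord i , Jn-Inc (jn i)
      bEnd : ∀ i → ChordEndpoint {G} H C (c (b i))
      bEnd i = chord i , isChord i , Jn-Incʳ (jn i)

      a≤ : ∀ i → a i ≤ n
      a≤ i = ≤-trans (<⇒≤ (a<b i)) (b≤n i)

      innermost : ∃[ i ] ∀ j → Inside i j
      innermost = leastOf {R = Inside} (λ _ → ≤-refl , ≤-refl) (λ (p , q) (r , s) → ≤-trans r p , ≤-trans q s) inside-total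
      outermost : ∃[ i ] ∀ j → Inside j i
      outermost = leastOf {R = flip Inside} (λ _ → ≤-refl , ≤-refl) (λ (p , q) (r , s) → ≤-trans p r , ≤-trans s q)
                    (λ i j → inside-total j i)

      inn out : ∀ i → Sub G
      inn i = inner (a<b i) (b≤n i)
      out i = outer (a<b i) (b≤n i)

      inner-cong : ∀ {p q p′ q′} (l : p < q) (m : q ≤ n) (l′ : p′ < q′) (m′ : q′ ≤ n) → p ≡ p′ → q ≡ q′ →
                   inner l m ≡ inner l′ m′
      inner-cong l m l′ m′ refl refl = cong₂ (λ l m → inner l m) (≤-irrelevant l l′) (≤-irrelevant m m′)

      outer-cong : ∀ {p q p′ q′} (l : p < q) (m : q ≤ n) (l′ : p′ < q′) (m′ : q′ ≤ n) → p ≡ p′ → q ≡ q′ →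
                   outer l m ≡ outer l′ m′
      outer-cong l m l′ m′ refl refl = cong₂ (λ l m → outer l m) (≤-irrelevant l l′) (≤-irrelevant m m′)

      inn-handle : ∀ i → (∀ j → Inside i j) → IsHandle {G} H C (inn i)
      inn-handle i min = c (a i) , c (b i) ,
        (inner-path (a<b i) (b≤n i) , inner-⊑ (a<b i) (b≤n i) , aEnd i , bEnd i , only) ,
        chord i , isChord i , jn i
        where
        P = innerWalk (a<b i) (b≤n i)
        only : ∀ z → z ∈ V (inn i) → ChordEndpoint {G} H C z → z ≡ c (a i) ⊎ z ≡ c (b i)
        only z z∈ end with arc-vs⁻ (≤‴-from (<⇒≤ (a<b i))) (b≤n i) (∈V-mk⁻ {vs P} {es P} z∈) | endpoint end
        ... | p , l , r , refl | j , inj₁ eq with c-injective (≤-trans r (b≤n i)) (a≤ j) eq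
        ...   | refl = inj₁ (cong c (≤-antisym (proj₁ (min j)) l))
        only z z∈ end | p , l , r , refl | j , inj₂ eq with c-injective (≤-trans r (b≤n i)) (b≤n j) eq
        ...   | refl = inj₂ (cong c (≤-antisym r (proj₂ (min j))))

      out-handle : ∀ i → (∀ j → Inside j i) → IsHandle {G} H C (out i)
      out-handle i max = c (b i) , c (a i) ,
        (outer-path (a<b i) (b≤n i) , outer-⊑ (a<b i) (b≤n i) , bEnd i , aEnd i , only) ,
        chord i , isChord i , Jn-sym (jn i)
        where
        P = outerWalk (a<b i) (b≤n i)
        only : ∀ z → z ∈ V (out i) → ChordEndpoint {G} H C z → z ≡ c (b i) ⊎ z ≡ c (a i)
        only z z∈ end with outer-vs⁻ (a<b i) (b≤n i) (∈V-mk⁻ {vs P} {es P} z∈) | endpoint end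
        ... | p , p≤n , l , refl | j , inj₁ eq with c-injective p≤n (a≤ j) eq
        ...   | refl = inj₂ (cong c (≤-antisym ([ (λ r → ⊥-elim (<⇒≱ (a<b j) (≤-trans (proj₂ (max j)) r))) , id ]′ l) (proj₁ (max j))))
        only z z∈ end | p , p≤n , l , refl | j , inj₂ eq with c-injective p≤n (b≤n j) eq
        ...   | refl = inj₁ (cong c (≤-antisym (proj₂ (max j)) ([ id , (λ r → ⊥-elim (<⇒≱ (a<b j) (≤-trans r (proj₁ (max j))))) ]′ l)))

      -- The chord `j` of a handle makes it one of the two arcs `inn j` and `out j`. The first
      -- contains the ends of the innermost chord, the second those of the outermost chord; a
      -- segment has chord ends only at its own ends, so the intervals agree.
      complete : ∀ S → IsHandle {G} H C S → S ≡ inn (proj₁ innermost) ⊎ S ≡ out (proj₁ outermost)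
      complete S (x , y , (path@((sub , _) , _ , _ , _ , vx , vy , v2) , S⊑C , _ , _ , only) , f , cf , jf)
        with allChords f cf
      ... | j , refl = finish (pathInCircle (a<b j) (b≤n j) {S} sub S⊑C (proj₁ vals) (proj₁ (proj₂ vals)) (proj₂ (proj₂ vals)))
        where
        orient : (x ≡ c (a j) × y ≡ c (b j)) ⊎ (x ≡ c (b j) × y ≡ c (a j))
        orient with Jn-only (jn j) (Jn-Inc jf)
        ... | inj₁ refl = inj₁ (refl , Jn-end jf (jn j))
        ... | inj₂ refl = inj₂ (refl , Jn-end jf (Jn-sym (jn j)))
        vals : valency {G} S (c (a j)) ≡ 1 × valency {G} S (c (b j)) ≡ 1 ×
               (∀ z → z ∈ V S → z ≢ c (a j) → z ≢ c (b j) → valency {G} S z ≡ 2)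
        vals with orient
        ... | inj₁ (refl , refl) = vx , vy , v2
        ... | inj₂ (refl , refl) = vy , vx , λ z z∈ p q → v2 z z∈ q p
        only′ : ∀ {p} → p ≤ n → c p ∈ V S → ChordEndpoint {G} H C (c p) → p ≡ a j ⊎ p ≡ b j
        only′ p≤n z∈ end with orient | only _ z∈ end
        ... | inj₁ (refl , refl) | inj₁ q = inj₁ (c-injective p≤n (a≤ j) q)
        ... | inj₁ (refl , refl) | inj₂ q = inj₂ (c-injective p≤n (b≤n j) q)
        ... | inj₂ (refl , refl) | inj₁ q = inj₂ (c-injective p≤n (b≤n j) q)
        ... | inj₂ (refl , refl) | inj₂ q = inj₁ (c-injective p≤n (a≤ j) q)
        finish : S ≡ inn j ⊎ S ≡ out j → S ≡ inn (proj₁ innermost) ⊎ S ≡ out (proj₁ outermost)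
        finish (inj₁ eqS) with innermost
        ... | i , min = inj₁ (trans eqS (inner-cong (a<b j) (b≤n j) (a<b i) (b≤n i) (sym aa) (sym bb)))
          where
          P = innerWalk (a<b j) (b≤n j)
          in∈ : ∀ {p} → a j ≤ p → p ≤ b j → c p ∈ V S
          in∈ l r = subst (λ T → _ ∈ V T) (sym eqS) (∈V-mk⁺ {vs P} {es P} (arc-vs⁺ _ (b≤n j) l r))
          aa : a i ≡ a j
          aa with only′ (a≤ i) (in∈ (proj₁ (min j)) (≤-trans (<⇒≤ (a<b i)) (proj₂ (min j)))) (aEnd i)
          ... | inj₁ q = q
          ... | inj₂ q = ⊥-elim (<⇒≱ (a<b i) (≤-trans (proj₂ (min j)) (≤-reflexive (sym q))))
          bb : b i ≡ b j
          bb with only′ (b≤n i) (in∈ (≤-trans (proj₁ (min j)) (<⇒≤ (a<b i))) (proj₂ (min j))) (bEnd i)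
          ... | inj₂ q = q
          ... | inj₁ q = ⊥-elim (<⇒≱ (a<b i) (≤-trans (≤-reflexive q) (proj₁ (min j))))
        finish (inj₂ eqS) with outermost
        ... | i , max = inj₂ (trans eqS (outer-cong (a<b j) (b≤n j) (a<b i) (b≤n i) (sym aa) (sym bb)))
          where
          P = outerWalk (a<b j) (b≤n j)
          in∈ : ∀ {p} → p ≤ n → b j ≤ p ⊎ p ≤ a j → c p ∈ V S
          in∈ l r = subst (λ T → _ ∈ V T) (sym eqS) (∈V-mk⁺ {vs P} {es P} (outer-vs⁺ (a<b j) (b≤n j) l r))
          aa : a i ≡ a j
          aa with only′ (a≤ i) (in∈ (a≤ i) (inj₂ (proj₁ (max j)))) (aEnd i)
          ... | inj₁ q = q
          ... | inj₂ q = ⊥-elim (<⇒≱ (a<b j) (≤-trans (≤-reflexive (sym q)) (proj₁ (max j))))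
          bb : b i ≡ b j
          bb with only′ (b≤n i) (in∈ (b≤n i) (inj₁ (proj₂ (max j)))) (bEnd i)
          ... | inj₂ q = q
          ... | inj₁ q = ⊥-elim (<⇒≱ (a<b j) (≤-trans (proj₂ (max j)) (≤-reflexive q)))

    -- The inner handle misses the root edge and the outer one contains it, so they differ even if a
    -- single chord is both innermost and outermost.
    nested-twoHandles : Exactly 2 (IsHandle {G} H C)
    nested-twoHandles = h , inj , (λ { zero → inn-handle i₀ (proj₂ innermost) ; (suc zero) → out-handle i₁ (proj₂ outermost) }) ,
      λ S hS → [ (λ eq → zero , sym eq) , (λ eq → suc zero , sym eq) ]′ (complete S hS)
      where
      i₀ = proj₁ innermost
      i₁ = proj₁ outermost
      h : Fin 2 → Sub G
      h zero = inn i₀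
      h (suc zero) = out i₁
      differ : inn i₀ ≢ out i₁
      differ eq = e∉inner (a<b i₀) (b≤n i₀) (subst (λ T → e ∈ E T) (sym eq)
        (∈E-mk⁺ {vs (outerWalk (a<b i₁) (b≤n i₁))} {es (outerWalk (a<b i₁) (b≤n i₁))} (outer-e (a<b i₁) (b≤n i₁))))
      inj : Injective _≡_ _≡_ h
      inj {zero} {zero} _ = refl
      inj {suc zero} {suc zero} _ = refl
      inj {zero} {suc zero} eq = ⊥-elim (differ eq)
      inj {suc zero} {zero} eq = ⊥-elim (differ (sym eq))


-- Old and new edges of an enlarged graph

module _ {m : ℕ} where

  ∈-++ᵛ⁺ : ∀ {k} (q : Subset k) {p : Subset m} {x} → x ∈ p → k ↑ʳ x ∈ q ++ᵛ p
  ∈-++ᵛ⁺ []      x∈ = x∈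
  ∈-++ᵛ⁺ (_ ∷ q) x∈ = there (∈-++ᵛ⁺ q x∈)

  ∈-++ᵛ⁻ : ∀ {k} (q : Subset k) {p : Subset m} {x} → k ↑ʳ x ∈ q ++ᵛ p → x ∈ p
  ∈-++ᵛ⁻ []      x∈ = x∈
  ∈-++ᵛ⁻ (_ ∷ q) (there x∈) = ∈-++ᵛ⁻ q x∈

  ↑-cases : ∀ k (z : Fin (k + m)) → (∃[ i ] z ≡ i ↑ˡ m) ⊎ (∃[ x ] z ≡ k ↑ʳ x)
  ↑-cases k z with splitAt k z in eq
  ... | inj₁ i = inj₁ (i , sym (splitAt⁻¹-↑ˡ eq))
  ... | inj₂ x = inj₂ (x , sym (splitAt⁻¹-↑ʳ eq))

  ↑ˡ∈⊤ : ∀ {k} {p : Subset m} (i : Fin k) → i ↑ˡ m ∈ ⊤ ++ᵛ p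
  ↑ˡ∈⊤ zero    = here
  ↑ˡ∈⊤ (suc i) = there (↑ˡ∈⊤ i)

  ↑ˡ∉⊥ : ∀ {k} {p : Subset m} (i : Fin k) → i ↑ˡ m ∉ ⊥ ++ᵛ p
  ↑ˡ∉⊥ (suc i) (there i∈) = ↑ˡ∉⊥ i i∈

module NewEdges (G : Graph) {k : ℕ} (new : Fin k → Fin (Graph.#V G) × Fin (Graph.#V G)) where
  open Graph G
  G⁺ : Graph
  G⁺ = addEdges G k new

  ends-old : ∀ g → Graph.ends G⁺ (k ↑ʳ g) ≡ ends g
  ends-old g = cong [ new , ends ]′ (splitAt-↑ʳ k #E g)

  ends-new : ∀ i → Graph.ends G⁺ (i ↑ˡ #E) ≡ new i
  ends-new i = cong [ new , ends ]′ (splitAt-↑ˡ k i #E)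

  Jn-old : ∀ {g x y} → Joins {G} g x y → Joins {G⁺} (k ↑ʳ g) x y
  Jn-old = map⊎ (trans (ends-old _)) (trans (ends-old _))

-- Layered chords from nested intervals on a ring

module LayeredRing (G : Graph) {C : Sub G} {e : Fin (Graph.#E G)} (R : Rings.Ring G C e)
  {k : ℕ} (a b : Fin (suc k) → ℕ) (a<b : ∀ i → a i < b i) (b≤n : ∀ i → b i ≤ Rings.Ring.n R)
  (nested : ∀ i j → ¬ (a i < a j × b i < b j)) where
  open Graph G
  open Rings.Ring R

  chords : Fin (suc k) → Fin #V × Fin #V
  chords i = c (a i) , c (b i)

  open NewEdges G chords

  private
    C⁰ C⁺ : Sub G⁺
    C⁰ = C° G C chords
    C⁺ = C* G C chords

    R⁺ : Rings.Ring G⁺ C⁰ (suc k ↑ʳ e)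
    R⁺ = record
      { n = n ; c = c ; d = λ p → suc k ↑ʳ d p ; pos = pos ; close = Jn-old close ; join = λ l → Jn-old (join l)
      ; pos-c = pos-c ; c-pos = c-pos ; pos≤ = pos≤ ; c∈ = c∈ ; d∈ = λ l → ∈-++ᵛ⁺ (⊥ {suc k}) (d∈ l) ; e∈ = ∈-++ᵛ⁺ (⊥ {suc k}) e∈
      ; d≢e = λ l eq → d≢e l (↑ʳ-injective (suc k) _ _ eq)
      ; E-cases = cases }
      where
      cases : ∀ {g} → g ∈ E C⁰ → g ≡ suc k ↑ʳ e ⊎ ∃[ p ] p < n × g ≡ suc k ↑ʳ d p
      cases {g} g∈ with ↑-cases (suc k) g
      ... | inj₁ (i , refl) = ⊥-elim (↑ˡ∉⊥ i g∈)
      ... | inj₂ (x , refl) with E-cases (∈-++ᵛ⁻ (⊥ {suc k}) g∈)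
      ...   | inj₁ refl = inj₁ refl
      ...   | inj₂ (p , l , refl) = inj₂ (p , l , refl)

    module M = Handles G⁺ R⁺
    module W⁺ = Walks G⁺

    chord : Fin (suc k) → Fin (suc k + #E)
    chord i = i ↑ˡ #E

    jn : ∀ i → W⁺.Jn (chord i) (c (a i)) (c (b i))
    jn i = inj₁ (ends-new i)

    a≤ : ∀ i → a i ≤ n
    a≤ i = ≤-trans (<⇒≤ (a<b i)) (b≤n i)

    isChord : ∀ i → IsChord {G⁺} C⁺ C⁰ (chord i)
    isChord i = ↑ˡ∈⊤ i , ↑ˡ∉⊥ i , (λ l → <⇒≢ (a<b i) (c-injective (a≤ i) (b≤n i) (W⁺.Jn-Loop {chord i} l (jn i)))) ,
      subst (_∈ V C) (sym (cong proj₁ (ends-new i))) (c∈ (a≤ i)) ,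
      subst (_∈ V C) (sym (cong proj₂ (ends-new i))) (c∈ (b≤n i))

    allChords : ∀ f → IsChord {G⁺} C⁺ C⁰ f → ∃[ i ] f ≡ chord i
    allChords f (f∈ , f∉ , _) with ↑-cases (suc k) f
    ... | inj₁ (i , eq) = i , eq
    ... | inj₂ (x , refl) = ⊥-elim (f∉ (∈-++ᵛ⁺ (⊥ {suc k}) (∈-++ᵛ⁻ (⊤ {suc k}) f∈)))

  abstract
    layeredChords : LayeredChords G C chords
    layeredChords = M.nested-noCross {C⁺} chord a b a<b b≤n jn isChord allChords nested ,
                    M.nested-twoHandles {C⁺} chord a b a<b b≤n jn isChord allChords nested


-- Bridges

module Bridges (G : Graph) {B C : Sub G} (tight : Blocks.Tight G B) (circ : IsCircle {G} C) (C⊑B : C ⊑ B) where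
  open Graph G
  open Rings G
  open Tight tight

  private
    C-sub : IsSubgraph {G} C
    C-sub = proj₁ (proj₁ circ)

    C-edge : ∃[ e ] e ∈ E C
    C-edge with proj₁ (proj₂ (proj₁ circ))
    ... | u , u∈ = let e , e∈ , _ = valency-edge {C} (≤-trans (s≤s z≤n) (≤-reflexive (sym (proj₂ circ u u∈)))) in e , e∈

  abstract
    IsChord? : ∀ f → Dec (IsChord {G} B C f)
    IsChord? f = (f ∈? E B) ×-dec ¬? (f ∈? E C) ×-dec ¬? (isLoop? {G} f) ×-dec
                 (proj₁ (ends f) ∈? V C) ×-dec (proj₂ (ends f) ∈? V C)

  abstract
    Avoids? : ∀ K → Dec (AvoidsCircle {G} B C K)
    Avoids? K = (K ⊑? B) ×-dec (all? λ x → (x ∈? V K) →-dec ¬? (x ∈? V C))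

  abstract
    IsComponentOff? : ∀ K → Dec (IsComponentOff {G} B C K)
    IsComponentOff? K = IsConnected? K ×-dec Avoids? K ×-dec
      allSub? (λ K′ → IsConnected? K′ →-dec (Avoids? K′ →-dec ((K ⊑? K′) →-dec (K′ ≟ₛ K))))

  abstract
    Joining? : ∀ K g → Dec (Joining {G} B C K g)
    Joining? K g = (g ∈? E B) ×-dec (any? λ x → any? λ y → (x ∈? V K) ×-dec (y ∈? V C) ×-dec Jn? g x y)

  abstract
    BridgeVertex? : ∀ K x → Dec (x ∈ V K ⊎ (x ∈ V C × (∃[ g ] Joining {G} B C K g × Inc g x)))
    BridgeVertex? K x = (x ∈? V K) ⊎-dec ((x ∈? V C) ×-dec (any? λ g → Joining? K g ×-dec incident? {G} g x))

  abstract
    BridgeEdge? : ∀ K g → Dec (g ∈ E K ⊎ Joining {G} B C K g)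
    BridgeEdge? K g = (g ∈? E K) ⊎-dec Joining? K g

  abstract
    IsBridge? : ∀ D → Dec (IsBridge {G} B C D)
    IsBridge? D =
      (any? λ f → IsChord? f ×-dec (D ≟ₛ ⟨ ⁅ proj₁ (ends f) ⁆ ∪ ⁅ proj₂ (ends f) ⁆ , ⁅ f ⁆ ⟩)) ⊎-dec
      (anySub? λ K → IsComponentOff? K ×-dec
        (all? λ x → (x ∈? V D) ⇔-dec BridgeVertex? K x) ×-dec
        (all? λ g → (g ∈? E D) ⇔-dec BridgeEdge? K g))

  abstract
    component-unique : ∀ {K K′ u} → IsComponentOff {G} B C K → IsComponentOff {G} B C K′ → u ∈ V K → u ∈ V K′ → K ≡ K′
    component-unique {K} {K′} {u} ((s , _ , conn) , ((a , b) , av) , max) ((s′ , _ , conn′) , ((a′ , b′) , av′) , max′) u∈ u∈′ =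
      trans (sym (max (K ⊔ K′) con avo (x∈p∪q⁺ ∘ inj₁ , x∈p∪q⁺ ∘ inj₁)))
            (max′ (K ⊔ K′) con avo (x∈p∪q⁺ ∘ inj₂ , x∈p∪q⁺ ∘ inj₂))
      where
      sub : IsSubgraph {G} (K ⊔ K′)
      sub g g∈ with x∈p∪q⁻ (E K) (E K′) g∈
      ... | inj₁ p = x∈p∪q⁺ (inj₁ (proj₁ (s g p))) , x∈p∪q⁺ (inj₁ (proj₂ (s g p)))
      ... | inj₂ p = x∈p∪q⁺ (inj₂ (proj₁ (s′ g p))) , x∈p∪q⁺ (inj₂ (proj₂ (s′ g p)))
      to : ∀ {x} → x ∈ V (K ⊔ K′) → Connects (_∈ E (K ⊔ K′)) u x
      to {x} x∈ with x∈p∪q⁻ (V K) (V K′) x∈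
      ... | inj₁ p = Connects-mono (x∈p∪q⁺ ∘ inj₁) (conn u x u∈ p)
      ... | inj₂ p = Connects-mono (x∈p∪q⁺ ∘ inj₂) (conn′ u x u∈′ p)
      con : IsConnected {G} (K ⊔ K′)
      con = sub , (u , x∈p∪q⁺ (inj₁ u∈)) , λ x y x∈ y∈ → Connects-sym (to x∈) ◅◅ to y∈
      avo : AvoidsCircle {G} B C (K ⊔ K′)
      avo = ((λ x∈ → [ a , a′ ]′ (x∈p∪q⁻ (V K) (V K′) x∈)) , (λ x∈ → [ b , b′ ]′ (x∈p∪q⁻ (E K) (E K′) x∈))) ,
            λ x x∈ → [ av x , av′ x ]′ (x∈p∪q⁻ (V K) (V K′) x∈)

  abstract
    componentAt : ∀ {y} → y ∈ V B → y ∉ V C → ∃[ K ] IsComponentOff {G} B C K × y ∈ V K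
    componentAt {y} y∈ y∉ with reachableSet (Linked? {Off} Off?) y
      where
      Off : Fin #E → Set
      Off g = g ∈ E B × proj₁ (ends g) ∉ V C × proj₂ (ends g) ∉ V C
      Off? : ∀ g → Dec (Off g)
      Off? g = (g ∈? E B) ×-dec ¬? (proj₁ (ends g) ∈? V C) ×-dec ¬? (proj₂ (ends g) ∈? V C)
    ... | S , (y∈S , sound) , cl = K , (con , avo , max) , y∈S
      where
      Off : Fin #E → Set
      Off g = g ∈ E B × proj₁ (ends g) ∉ V C × proj₂ (ends g) ∉ V C
      EK? : ∀ g → Dec (g ∈ E B × proj₁ (ends g) ∈ S × proj₂ (ends g) ∈ S)
      EK? g = (g ∈? E B) ×-dec (proj₁ (ends g) ∈? S) ×-dec (proj₂ (ends g) ∈? S)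
      K : Sub G
      K = ⟨ S , ⟦ EK? ⟧ ⟩
      Off-end : ∀ {g x z} → Off g → Jn g x z → z ∉ V C
      Off-end (_ , p , q) (inj₁ refl) = q
      Off-end (_ , p , q) (inj₂ refl) = p
      mkOff : ∀ {g x z} → g ∈ E B → Jn g x z → x ∉ V C → z ∉ V C → Off g
      mkOff g∈ (inj₁ refl) p q = g∈ , p , q
      mkOff g∈ (inj₂ refl) p q = g∈ , q , p
      inK : ∀ {g x z} → g ∈ E B → Jn g x z → x ∈ S → z ∈ S → g ∈ E K
      inK g∈ (inj₁ refl) p q = ∈⟦⟧⁺ EK? (g∈ , p , q)
      inK g∈ (inj₂ refl) p q = ∈⟦⟧⁺ EK? (g∈ , q , p)
      S∉C : ∀ {x} → x ∈ S → x ∉ V C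
      S∉C x∈ = Connects-invariant (_∉ V C) (λ o j _ → Off-end o j) (sound _ x∈) y∉
      S∈B : ∀ {x} → x ∈ S → x ∈ V B
      S∈B x∈ = Connects-invariant (_∈ V B) (λ (g∈ , _) j _ → ends∈ {B} subgraph g∈ (Jn-Incʳ j)) (sound _ x∈) y∈
      within : ∀ {x z} → Connects Off x z → x ∈ S → Connects (_∈ E K) x z
      within ε x∈ = ε
      within ((g , o , j) ◅ s) x∈ = (g , inK (proj₁ o) j x∈ (cl x∈ (g , o , j)) , j) ◅ within s (cl x∈ (g , o , j))
      con : IsConnected {G} K
      con = (λ g g∈ → proj₂ (∈⟦⟧⁻ EK? g∈)) , (y , y∈S) ,
            λ x z x∈ z∈ → Connects-sym (within (sound x x∈) y∈S) ◅◅ within (sound z z∈) y∈S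
      avo : AvoidsCircle {G} B C K
      avo = (S∈B , proj₁ ∘ ∈⟦⟧⁻ EK?) , λ x → S∉C
      max : ∀ K′ → IsConnected {G} K′ → AvoidsCircle {G} B C K′ → K ⊑ K′ → K′ ≡ K
      max K′ (s′ , _ , conn′) ((a , b) , av) (p , q) = Sub-ext
        (inS , (λ {g} g∈ → inK (b g∈) (Jn-ends g) (inS (proj₁ (s′ g g∈))) (inS (proj₂ (s′ g g∈))))) (p , q)
        where
        inS : ∀ {x} → x ∈ V K′ → x ∈ S
        inS {x} x∈ = Connects-invariant (_∈ S)
          (λ g∈ j u∈ → cl u∈ (_ , mkOff (b g∈) j (av _ (ends∈ {K′} s′ g∈ (Jn-Inc j))) (av _ (ends∈ {K′} s′ g∈ (Jn-Incʳ j))) , j))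
          (conn′ y x (p y∈S) x∈) y∈S

  module Component {K} (comp : IsComponentOff {G} B C K) where
    private
      K-sub : IsSubgraph {G} K
      K-sub = proj₁ (proj₁ comp)
      K⊑B : K ⊑ B
      K⊑B = proj₁ (proj₁ (proj₂ comp))
      K-off : ∀ {x} → x ∈ V K → x ∉ V C
      K-off = proj₂ (proj₁ (proj₂ comp)) _

    -- If `y` were off `C`, it could be added to `K` together with `g`, against the maximality of
    -- the component.
    leaves : ∀ {g x y} → g ∈ E B → Jn g x y → x ∈ V K → y ∉ V K → y ∈ V C
    leaves {g} {x} {y} g∈ j x∈ y∉ = decidable-stable (y ∈? V C) λ y∉C →
      y∉ (subst (λ L → y ∈ V L) (max K′ con (avo y∉C) (x∈p∪q⁺ ∘ inj₁ , x∈p∪q⁺ ∘ inj₁)) (x∈p∪q⁺ (inj₂ (x∈⁅x⁆ y))))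
      where
      max = proj₂ (proj₂ comp)
      K′ : Sub G
      K′ = ⟨ V K ∪ ⁅ y ⁆ , E K ∪ ⁅ g ⁆ ⟩
      to : ∀ {z} → z ∈ V K′ → Connects (_∈ E K′) x z
      to {z} z∈ with ∈∪⁅⁆⁻ {p = V K} z∈
      ... | inj₁ p = Connects-mono (x∈p∪q⁺ ∘ inj₁) (proj₂ (proj₂ (proj₁ comp)) x z x∈ p)
      ... | inj₂ refl = edge {e = g} (x∈p∪q⁺ (inj₂ (x∈⁅x⁆ g))) j
      sub : IsSubgraph {G} K′
      sub h h∈ with ∈∪⁅⁆⁻ {p = E K} h∈
      ... | inj₁ p = x∈p∪q⁺ (inj₁ (proj₁ (K-sub h p))) , x∈p∪q⁺ (inj₁ (proj₂ (K-sub h p)))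
      ... | inj₂ refl = incident∈ (inj₁ refl) , incident∈ (inj₂ refl)
        where
        incident∈ : ∀ {z} → Inc h z → z ∈ V K′
        incident∈ i = [ (λ { refl → x∈p∪q⁺ (inj₁ x∈) }) , (λ { refl → x∈p∪q⁺ (inj₂ (x∈⁅x⁆ y)) }) ]′ (Jn-only j i)
      con : IsConnected {G} K′
      con = sub , (x , x∈p∪q⁺ (inj₁ x∈)) , λ a b a∈ b∈ → Connects-sym (to a∈) ◅◅ to b∈
      avo : y ∉ V C → AvoidsCircle {G} B C K′
      avo y∉C = ((λ z∈ → [ proj₁ K⊑B , (λ { refl → ends∈ {B} subgraph g∈ (Jn-Incʳ j) }) ]′ (∈∪⁅⁆⁻ {p = V K} z∈)) ,
                 (λ h∈ → [ proj₂ K⊑B , (λ { refl → g∈ }) ]′ (∈∪⁅⁆⁻ {p = E K} h∈))) ,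
                λ z z∈ → [ K-off , (λ { refl → y∉C }) ]′ (∈∪⁅⁆⁻ {p = V K} z∈)

    private
      X? : ∀ g → Dec (∃[ u ] u ∈ V K × Inc g u)
      X? g = any? λ u → (u ∈? V K) ×-dec incident? {G} g u

      toJoining : ∀ {x y g w} → y ≢ x → y ∉ V K → g ∈ E B → Inc g y → w ∈ V K → Inc g w →
                  ∃[ y ] y ≢ x × y ∈ V C × (∃[ g ] Joining {G} B C K g × Inc g y)
      toJoining {x} {y} {g} y≢x y∉ g∈ iy w∈ iw with Inc-Jn iy
      ... | _ , j with Jn-only j iw
      ...   | inj₁ refl = ⊥-elim (y∉ w∈)
      ...   | inj₂ refl = y , y≢x , yC , g , (g∈ , _ , y , w∈ , yC , Jn-sym j) , iy
        where
        yC : y ∈ V C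
        yC = leaves g∈ (Jn-sym j) w∈ y∉

      fromMixed : ∀ {x y} → y ≢ x → Mixed B ⟦ X? ⟧ y → ∃[ y ] y ≢ x × y ∈ V C × (∃[ g ] Joining {G} B C K g × Inc g y)
      fromMixed y≢x ((g , (g∈ , g∈X) , ig) , h , (_ , h∉) , ih) with ∈⟦⟧⁻ X? g∈X
      ... | w , w∈ , iw = toJoining y≢x (λ y∈ → h∉ (∈⟦⟧⁺ X? (_ , y∈ , ih))) g∈ ig w∈ iw

    abstract
      -- Colour the edges that touch `K`. Those of `C` do not, so the colours meet at some `y ≢ x`;
      -- a vertex of `K` sees only one colour, hence `y` lies on `C`. Used twice, this gives two
      -- attachments.
      attachmentOff : ∀ x → ∃[ y ] y ≢ x × y ∈ V C × (∃[ g ] Joining {G} B C K g × Inc g y)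
      attachmentOff x with proj₁ (proj₂ (proj₁ comp)) | C-edge
      ... | u , u∈ | e , e∈ with covered (proj₁ K⊑B u∈)
      ... | g , g∈ , i with mixing x ⟦ X? ⟧ g∈ (∈⟦⟧⁺ X? (u , u∈ , i)) (proj₂ C⊑B e∈) untouched
        where
        untouched : e ∉ ⟦ X? ⟧
        untouched q with ∈⟦⟧⁻ X? q
        ... | w , w∈ , iw = K-off w∈ (ends∈ {C} C-sub e∈ iw)
      ... | y , y≢x , m = fromMixed y≢x m

  abstract
    bridge-Inc : ∀ {D g u} → IsBridge {G} B C D → g ∈ E D → Inc g u → u ∈ V D
    bridge-Inc (inj₁ (f , _ , refl)) g∈ i with x∈⁅y⁆⇒x≡y f g∈
    ... | refl = ends⁺ ([ inj₁ ∘ sym , inj₂ ∘ sym ]′ i)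
    bridge-Inc {D} {g} {u} (inj₂ (K , comp , VD , ED)) g∈ i with Equivalence.to (ED g) g∈
    ... | inj₁ gK = Equivalence.from (VD u) (inj₁ (ends∈ {K} (proj₁ (proj₁ comp)) gK i))
    ... | inj₂ jg@(_ , x , y , x∈ , y∈ , j) with Jn-only j i
    ...   | inj₁ refl = Equivalence.from (VD u) (inj₁ x∈)
    ...   | inj₂ refl = Equivalence.from (VD u) (inj₂ (y∈ , g , jg , i))

  abstract
    bridge-E : ∀ {D g} → IsBridge {G} B C D → g ∈ E D → g ∈ E B × g ∉ E C
    bridge-E (inj₁ (f , (f∈ , f∉ , _) , refl)) g∈ with x∈⁅y⁆⇒x≡y f g∈
    ... | refl = f∈ , f∉
    bridge-E {D} {g} (inj₂ (K , ((s , _) , ((_ , K⊑B) , off) , _) , _ , ED)) g∈ with Equivalence.to (ED g) g∈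
    ... | inj₁ gK = K⊑B gK , λ gC → off _ (proj₁ (s g gK)) (proj₁ (C-sub g gC))
    ... | inj₂ (g∈B , x , y , x∈ , _ , j) = g∈B , λ gC → off x x∈ (ends∈ {C} C-sub gC (Jn-Inc j))

  abstract
    bridge-unique-V : ∀ {D D′ u} → IsBridge {G} B C D → IsBridge {G} B C D′ → u ∈ V D → u ∈ V D′ → u ∉ V C → D ≡ D′
    bridge-unique-V (inj₁ (f , (_ , _ , _ , p , q) , refl)) _ u∈ _ u∉ =
      ⊥-elim (u∉ ([ (λ { refl → p }) , (λ { refl → q }) ]′ (ends⁻ u∈)))
    bridge-unique-V (inj₂ _) (inj₁ (f , (_ , _ , _ , p , q) , refl)) _ u∈ u∉ =
      ⊥-elim (u∉ ([ (λ { refl → p }) , (λ { refl → q }) ]′ (ends⁻ u∈)))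
    bridge-unique-V {D} {D′} {u} (inj₂ (K , comp , VD , ED)) (inj₂ (K′ , comp′ , VD′ , ED′)) u∈ u∈′ u∉
      with component-unique comp comp′ ([ id , ⊥-elim ∘ u∉ ∘ proj₁ ]′ (Equivalence.to (VD u) u∈))
                                       ([ id , ⊥-elim ∘ u∉ ∘ proj₁ ]′ (Equivalence.to (VD′ u) u∈′))
    ... | refl = Sub-ext
      ((λ x∈ → Equivalence.from (VD′ _) (Equivalence.to (VD _) x∈)) , (λ x∈ → Equivalence.from (ED′ _) (Equivalence.to (ED _) x∈)))
      ((λ x∈ → Equivalence.from (VD _) (Equivalence.to (VD′ _) x∈)) , (λ x∈ → Equivalence.from (ED _) (Equivalence.to (ED′ _) x∈)))

  private
    offEnd : ∀ {D g} → IsBridge {G} B C D → g ∈ E D → (D ≡ ⟨ ⁅ proj₁ (ends g) ⁆ ∪ ⁅ proj₂ (ends g) ⁆ , ⁅ g ⁆ ⟩) ⊎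
             (∃[ u ] Inc g u × u ∉ V C)
    offEnd (inj₁ (f , cf , refl)) g∈ with x∈⁅y⁆⇒x≡y f g∈
    ... | refl = inj₁ refl
    offEnd {D} {g} (inj₂ (K , ((s , _) , (_ , off) , _) , _ , ED)) g∈ with Equivalence.to (ED g) g∈
    ... | inj₁ gK = inj₂ (_ , inj₁ refl , off _ (proj₁ (s g gK)))
    ... | inj₂ (_ , x , y , x∈ , _ , j) = inj₂ (x , Jn-Inc j , off x x∈)

  abstract
    bridge-unique-E : ∀ {D D′ g} → IsBridge {G} B C D → IsBridge {G} B C D′ → g ∈ E D → g ∈ E D′ → D ≡ D′
    bridge-unique-E br br′ g∈ g∈′ with offEnd br g∈ | offEnd br′ g∈′
    ... | inj₁ p | inj₁ q = trans p (sym q)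
    ... | inj₂ (u , i , u∉) | _ = bridge-unique-V br br′ (bridge-Inc br g∈ i) (bridge-Inc br′ g∈′ i) u∉
    ... | _ | inj₂ (u , i , u∉) = bridge-unique-V br br′ (bridge-Inc br g∈ i) (bridge-Inc br′ g∈′ i) u∉

  abstract
    bridge-edgeAt : ∀ {D u} → IsBridge {G} B C D → u ∈ V D → u ∈ V C → ∃[ g ] g ∈ E D × Inc g u
    bridge-edgeAt (inj₁ (f , _ , refl)) u∈ _ = f , x∈⁅x⁆ f , map⊎ sym sym (ends⁻ u∈)
    bridge-edgeAt {D} {u} (inj₂ (K , (_ , (_ , off) , _) , VD , ED)) u∈ uC with Equivalence.to (VD u) u∈
    ... | inj₁ uK = ⊥-elim (off u uK uC)
    ... | inj₂ (_ , g , jg , i) = g , Equivalence.from (ED g) (inj₂ jg) , i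

  abstract
    noLoop : ∀ {g} → g ∈ E B → g ∉ E C → ¬ Loop g
    noLoop g∈ g∉ l with C-edge
    ... | e , e∈ with loop-only {B} tight g∈ l (proj₂ C⊑B e∈)
    ... | refl = g∉ e∈

  abstract
    bridgeThrough : ∀ {g u} → g ∈ E B → g ∉ E C → Inc g u → u ∈ V C → ∃[ D ] IsBridge {G} B C D × g ∈ E D
    bridgeThrough {g} {u} g∈ g∉ i u∈ with Inc-Jn i
    ... | w , j with w ∈? V C
    ... | yes w∈ = _ , inj₁ (g , (g∈ , g∉ , noLoop g∈ g∉ , incident∈ (inj₁ refl) , incident∈ (inj₂ refl)) , refl) , x∈⁅x⁆ g
      where
      incident∈ : ∀ {z} → Inc g z → z ∈ V C
      incident∈ iz = [ (λ { refl → u∈ }) , (λ { refl → w∈ }) ]′ (Jn-only j iz)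
    ... | no w∉ with componentAt (ends∈ {B} subgraph g∈ (Jn-Incʳ j)) w∉
    ... | K , comp , w∈ = ⟨ ⟦ BridgeVertex? K ⟧ , ⟦ BridgeEdge? K ⟧ ⟩ , inj₂ (K , comp ,
          (λ x → mk⇔ (∈⟦⟧⁻ (BridgeVertex? K)) (∈⟦⟧⁺ (BridgeVertex? K))) , (λ x → mk⇔ (∈⟦⟧⁻ (BridgeEdge? K)) (∈⟦⟧⁺ (BridgeEdge? K)))) ,
          ∈⟦⟧⁺ (BridgeEdge? K) (inj₂ (g∈ , w , u , w∈ , u∈ , Jn-sym j))

  abstract
    bridge-attachments : ∀ {D} → IsBridge {G} B C D → ∃₂ λ u w → u ≢ w × (u ∈ V D × u ∈ V C) × (w ∈ V D × w ∈ V C)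
    bridge-attachments (inj₁ (f , (_ , _ , nl , p , q) , refl)) = _ , _ , nl , (ends⁺ (inj₁ refl) , p) , (ends⁺ (inj₂ refl) , q)
    bridge-attachments (inj₂ (K , comp , VD , ED)) with Component.attachmentOff comp (proj₁ (proj₁ (proj₂ (proj₁ comp))))
    ... | u , _ , uC , ju with Component.attachmentOff comp u
    ... | w , w≢u , wC , jw = u , w , w≢u ∘ sym , (Equivalence.from (VD u) (inj₂ (uC , ju)) , uC) , (Equivalence.from (VD w) (inj₂ (wC , jw)) , wC)

  abstract
    -- An edge outside `C` may be far from `C`. With the edges of `C` as one colour, the colours
    -- meet at a vertex of `C`, and a bridge starts there.
    bridge-exists : B ≢ C → ∃[ D ] IsBridge {G} B C D
    bridge-exists B≢C with any? (λ g → (g ∈? E B) ×-dec ¬? (g ∈? E C))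
    ... | yes (g , g∈ , g∉) with C-edge
    ...   | e , e∈ with mixing (proj₁ (ends e)) (E C) (proj₂ C⊑B e∈) e∈ g∈ g∉
    ...   | y , _ , (h , (_ , hC) , ih) , (h′ , (h′∈ , h′∉) , ih′) =
            let D , br , _ = bridgeThrough h′∈ h′∉ ih′ (ends∈ {C} C-sub hC ih) in D , br
    bridge-exists B≢C | no none = ⊥-elim (B≢C (Sub-ext
      ((λ {u} u∈ → let g , g∈ , i = covered u∈ in ends∈ {C} C-sub (inC g∈) i) , inC) C⊑B))
      where
      inC : ∀ {g} → g ∈ E B → g ∈ E C
      inC {g} g∈ = decidable-stable (g ∈? E C) λ g∉ → none (g , g∈ , g∉)


-- The unique positive circle through an edge

pick : {P : Set} → Dec P → Sign → Sign → Sign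
pick (yes _) s t = s
pick (no _)  s t = t

pick-yes : ∀ {P} {s t} (p? : Dec P) → P → pick p? s t ≡ s
pick-yes (yes _) p = refl
pick-yes (no ¬p) p = ⊥-elim (¬p p)

pick-no : ∀ {P} {s t} (p? : Dec P) → ¬ P → pick p? s t ≡ t
pick-no (yes p) ¬p = ⊥-elim (¬p p)
pick-no (no _)  ¬p = refl

UniqueThrough : (S : SignedGraph) (B C : Sub (SignedGraph.graph S)) → Fin (SignedGraph.#E S) → Set
UniqueThrough S B C e = ∀ D → PositiveCircle S D → D ⊑ B → e ∈ E D → D ≡ C

module Core (S : SignedGraph) {B C : Sub (SignedGraph.graph S)} (tight : Blocks.Tight (SignedGraph.graph S) B)
  (pos : PositiveCircle S C) (C⊑B : C ⊑ B) {e : Fin (SignedGraph.#E S)} (R : Rings.Ring (SignedGraph.graph S) C e) where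
  open SignedGraph S
  open Signed S
  open Rings.Ring R renaming (pos to posn)
  module Br = Bridges graph tight (proj₁ pos) C⊑B

  abstract
    ζ : Fin #V → Sign
    ζ = proj₁ (circlePotential {C} pos)

    ζ-Good : ∀ {g} → g ∈ E C → Good ζ g
    ζ-Good = proj₂ (circlePotential {C} pos)

  C-sub : IsSubgraph {graph} C
  C-sub = proj₁ (proj₁ circle)

  bridge-∉C : ∀ {D g} → IsBridge {graph} B C D → g ∈ E D → g ∉ E C
  bridge-∉C {D} br g∈ = proj₂ (Br.bridge-E {D} br g∈)

  abstract
    exclude : ∀ {g h U ξ x y} → UniqueThrough S B C g → (∀ {f} → U f → Good ξ f) → Good ξ g → ¬ U g →
              (∀ {f} → U f → f ∈ E B) → g ∈ E B → Jn g y x → Connects U x y → h ∈ E C → h ≢ g → ¬ U h → Absurd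
    exclude {g} {h} {U} {ξ} uniq good goodg ¬Ug U⊆B g∈B j con h∈ h≢g ¬Uh with circleThrough {U} {ξ} good ¬Ug j con
    ... | D , circD , sgnD , g∈D , edgesD with uniq D (circD , trans sgnD goodg)
          (circle-⊑ {D} {B} circD (Tight.subgraph tight) (λ f∈ → [ (λ { refl → g∈B }) , U⊆B ]′ (edgesD f∈))) g∈D
    ... | refl = [ h≢g , ¬Uh ]′ (edgesD h∈)

  -- A detour through `D`, given by edges `L` that are positive for a potential `μ` of their own. As
  -- `μ` agrees with `ζ` at `c a` and up to the factor `s` at `c b`, the detour has sign `s` after
  -- switching by `ζ`. `L` meets `C` only in these two vertices, which allows `μ` to be glued to `ζ`
  -- or to a partial reversal of it.
  record PreLink (D : Sub graph) (a b : ℕ) (s : Sign) : Set₁ where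
    field
      L    : Fin #E → Set
      L⊆D  : ∀ {g} → L g → g ∈ E D
      μ    : Fin #V → Sign
      good : ∀ {g} → L g → Good μ g
      μa   : μ (c a) ≡ ζ (c a)
      μb   : μ (c b) ≡ s · ζ (c b)
      ends-C : ∀ {g u} → L g → Inc g u → u ∈ V C → u ≡ c a ⊎ u ≡ c b
      conn : Connects L (c a) (c b)

  -- The circle C with the arc from c a to c b replaced by a path through D is
  -- negative.
  Link : Sub graph → ℕ → ℕ → Set₁
  Link D a b = PreLink D a b ⊖

  module _ {D : Sub graph} (br : IsBridge {graph} B C D) {a b : ℕ} (a<b : a < b) (b≤n : b ≤ n) where

    private
      Detour : ∀ {s} → PreLink D a b s → Fin #E → Set
      Detour l g = PreLink.L l g ⊎ ∃[ p ] p < n × (p < a ⊎ b ≤ p) × g ≡ d p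

      Detour⊆B : ∀ {s} (l : PreLink D a b s) {g} → Detour l g → g ∈ E B
      Detour⊆B l (inj₁ q) = proj₁ (Br.bridge-E {D} br (PreLink.L⊆D l q))
      Detour⊆B l (inj₂ (p , p<n , _ , refl)) = proj₂ C⊑B (d∈ p<n)

      ¬Detour-e : ∀ {s} (l : PreLink D a b s) → ¬ Detour l e
      ¬Detour-e l (inj₁ q) = bridge-∉C {D} br (PreLink.L⊆D l q) e∈
      ¬Detour-e l (inj₂ (p , p<n , _ , eq)) = d≢e p<n (sym eq)

      a≤n : a ≤ n
      a≤n = ≤-trans (<⇒≤ a<b) b≤n

      Detour-conn : ∀ {s} (l : PreLink D a b s) → Connects (Detour l) (c 0) (c n)
      Detour-conn l = arcConnects (≤‴-from z≤n) a≤n (λ {p} _ p<a → inj₂ (p , ≤-trans p<a a≤n , inj₁ p<a , refl))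
        ◅◅ Connects-mono inj₁ (PreLink.conn l)
        ◅◅ arcConnects (≤‴-from b≤n) ≤-refl (λ {p} b≤p p<n → inj₂ (p , p<n , inj₂ b≤p , refl))

      flipped : ∀ {s} → PreLink D a b s → Fin #V → Sign
      flipped l u = pick (u ∈? V C) (pick (b ≤?ⁿ posn u) (opp (ζ u)) (ζ u)) (PreLink.μ l u)

    abstract
      -- For a positive detour `μ` and `ζ` agree wherever `L` meets `C`, so they glue to one
      -- potential. Replacing the arc from `c a` to `c b` by the detour then gives a positive circle
      -- through `e` that misses `d a`.
      noPositive : UniqueThrough S B C e → ¬ PreLink D a b ⊕
      noPositive uniq l = exclude {g = e} {d a} {Detour l} {ξ} uniq good′ (C-good e∈) (¬Detour-e l) (Detour⊆B l)
        (proj₂ C⊑B e∈) close (Detour-conn l) (d∈ a<n) (d≢e a<n) missing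
        where
        open PreLink l
        ξ : Fin #V → Sign
        ξ u = pick (u ∈? V C) (ζ u) (μ u)
        a<n : a < n
        a<n = ≤-trans a<b b≤n
        C-good : ∀ {g} → g ∈ E C → Good ξ g
        C-good g∈ = trans (switch-cong {ξ} {ζ} λ i → pick-yes (_ ∈? V C) (ends∈ {C} C-sub g∈ i)) (ζ-Good g∈)
        good′ : ∀ {g} → Detour l g → Good ξ g
        good′ (inj₂ (p , p<n , _ , refl)) = C-good (d∈ p<n)
        good′ {g} (inj₁ q) = trans (switch-cong {ξ} {μ} agree) (good q)
          where
          agree : ∀ {u} → Inc g u → ξ u ≡ μ u
          agree {u} i with u ∈? V C
          ... | no _ = refl
          ... | yes u∈ with ends-C q i u∈
          ...   | inj₁ refl = sym μa
          ...   | inj₂ refl = sym μb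
        missing : ¬ Detour l (d a)
        missing (inj₁ q) = bridge-∉C {D} br (L⊆D q) (d∈ a<n)
        missing (inj₂ (p , p<n , l , eq)) with d-injective a<n p<n eq
        ... | refl = [ <-irrefl refl , (λ r → <⇒≱ a<b r) ]′ l

    abstract
      -- Reversing `ζ` from position `b` on fits the negative detour and keeps the two remaining
      -- arcs of `C` positive. Only `e`, which runs from the reversed `c n` to the unreversed `c 0`,
      -- becomes negative.
      negativeCircle : Link D a b → ∃[ N ] IsCircle {graph} N × N ⊑ B × signOf S N ≡ ⊖
      negativeCircle l with circleThrough {Detour l} {ξ} {e} good′ (¬Detour-e l) close (Detour-conn l)
        where
        open PreLink l
        ξ : Fin #V → Sign
        ξ = flipped l
        good′ : ∀ {g} → Detour l g → Good ξ g
        good′ {g} (inj₁ q) = trans (switch-cong {ξ} {μ} agree) (good q)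
          where
          agree : ∀ {u} → Inc g u → ξ u ≡ μ u
          agree {u} i with u ∈? V C
          ... | no _ = refl
          ... | yes u∈ with ends-C q i u∈
          ...   | inj₁ refl = trans (pick-no (b ≤?ⁿ _) λ r → <⇒≱ a<b (≤-trans r (≤-reflexive (pos-c a≤n)))) (sym μa)
          ...   | inj₂ refl = trans (pick-yes (b ≤?ⁿ _) (≤-reflexive (sym (pos-c b≤n)))) (sym μb)
        good′ (inj₂ (p , p<n , inj₁ p<a , refl)) = trans (switch-cong {ξ} {ζ} agree) (ζ-Good (d∈ p<n))
          where
          agree : ∀ {u} → Inc (d p) u → ξ u ≡ ζ u
          agree {u} i = trans (pick-yes (u ∈? V C) (ends∈ {C} C-sub (d∈ p<n) i)) (pick-no (b ≤?ⁿ posn u) λ r →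
            <⇒≱ a<b (≤-trans r ([ (λ { refl → ≤-trans (≤-reflexive (pos-c (<⇒≤ p<n))) (<⇒≤ p<a) }) ,
                                  (λ { refl → ≤-trans (≤-reflexive (pos-c p<n)) p<a }) ]′ (Jn-only (join p<n) i))))
        good′ (inj₂ (p , p<n , inj₂ b≤p , refl)) = trans (switch-cong {ξ} {λ u → ⊖ · ζ u} agree)
          (trans (switch-scale ⊖ ζ (d p)) (ζ-Good (d∈ p<n)))
          where
          agree : ∀ {u} → Inc (d p) u → ξ u ≡ opp (ζ u)
          agree {u} i = trans (pick-yes (u ∈? V C) (ends∈ {C} C-sub (d∈ p<n) i)) (pick-yes (b ≤?ⁿ posn u)
            (≤-trans b≤p ([ (λ { refl → ≤-reflexive (sym (pos-c (<⇒≤ p<n))) }) ,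
                            (λ { refl → ≤-trans (n≤1+n p) (≤-reflexive (sym (pos-c p<n))) }) ]′ (Jn-only (join p<n) i))))
      ... | N , circN , sgnN , _ , edgesN = N , circN , circle-⊑ {N} {B} circN (Tight.subgraph tight)
              (λ g∈ → [ (λ { refl → proj₂ C⊑B e∈ }) , Detour⊆B l ]′ (edgesN g∈)) , trans sgnN (trans (switch-Jn (flipped l) close)
              (trans (cong₂ (λ s t → s · σ e · t)
                 (trans (pick-yes (c n ∈? V C) (c∈ ≤-refl)) (pick-yes (b ≤?ⁿ posn (c n)) (≤-trans b≤n (≤-reflexive (sym (pos-c ≤-refl))))))
                 (trans (pick-yes (c 0 ∈? V C) (c∈ z≤n)) (pick-no (b ≤?ⁿ posn (c 0)) λ r → <⇒≱ (≤-<-trans z≤n a<b) (≤-trans r (≤-reflexive (pos-c z≤n))))))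
                (lem (ζ (c n)) (σ e) (ζ (c 0)) (trans (sym (switch-Jn ζ close)) (ζ-Good e∈)))))
        where
        lem : ∀ x s y → x · s · y ≡ ⊕ → opp x · s · y ≡ ⊖
        lem = from-yes (∀ˢ λ x → ∀ˢ λ s → ∀ˢ λ y → (x · s · y ≟ˢ ⊕) →-dec (opp x · s · y ≟ˢ ⊖))

  module Hooks {D K : Sub graph} (comp : IsComponentOff {graph} B C K)
    (VD : ∀ x → x ∈ V D ⇔ (x ∈ V K ⊎ (x ∈ V C × (∃[ f ] Joining {graph} B C K f × Inc f x))))
    (ED : ∀ f → f ∈ E D ⇔ (f ∈ E K ⊎ Joining {graph} B C K f)) where

    Off : ∀ {x} → x ∈ V K → x ∉ V C
    Off = proj₂ (proj₁ (proj₂ comp)) _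

    abstract
      κ : Fin #V → Sign
      κ = proj₁ (spanningPotential {λ f → f ∈ E K} (λ f → f ∈? E K) (proj₁ (proj₁ (proj₂ (proj₁ comp)))))

      tree : ∀ {x y} → x ∈ V K → y ∈ V K → Connects (λ f → f ∈ E K × Good κ f) x y
      tree {x} {y} x∈ y∈ = Connects-sym (reach (conn k₀ x k₀∈ x∈)) ◅◅ reach (conn k₀ y k₀∈ y∈)
        where
        k₀ : Fin #V
        k₀ = proj₁ (proj₁ (proj₂ (proj₁ comp)))
        k₀∈ : k₀ ∈ V K
        k₀∈ = proj₂ (proj₁ (proj₂ (proj₁ comp)))
        conn : ∀ x y → x ∈ V K → y ∈ V K → Connects (λ f → f ∈ E K) x y
        conn = proj₂ (proj₂ (proj₁ comp))
        reach : ∀ {y} → Connects (λ f → f ∈ E K) k₀ y → Connects (λ f → f ∈ E K × Good κ f) k₀ y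
        reach = proj₂ (spanningPotential {λ f → f ∈ E K} (λ f → f ∈? E K) k₀)

    record Hook (p : ℕ) : Set where
      field
        f  : Fin #E
        x  : Fin #V
        f∈ : f ∈ E B
        x∈ : x ∈ V K
        jn : Jn f x (c p)
        c∈C : c p ∈ V C

    abstract
      hookAt : ∀ {p} → p ≤ n → c p ∈ V D → Hook p
      hookAt {p} p≤n c∈D with Equivalence.to (VD (c p)) c∈D
      ... | inj₁ q = ⊥-elim (Off q (c∈ p≤n))
      ... | inj₂ (cC , f , (f∈ , x , y , x∈ , y∈ , j) , i) with Jn-only j i
      ...   | inj₁ refl = ⊥-elim (Off x∈ cC)
      ...   | inj₂ refl = record { f = f ; x = x ; f∈ = f∈ ; x∈ = x∈ ; jn = j ; c∈C = cC }

    -- The sign of the hook relative to `κ` on `K` and `ζ` on `C`. Edges positive for `κ` connect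
    -- `K`, so a detour through two hooks has the product of their signs.
    τ : ∀ {p} → Hook p → Sign
    τ {p} h = κ x · σ f · ζ (c p)
      where open Hook h

    abstract
      preLink : ∀ {a b} → c a ≢ c b → (h : Hook a) (h′ : Hook b) → PreLink D a b (τ h · τ h′)
      preLink {a} {b} a≢b h h′ = record
        { L = L ; L⊆D = L⊆D ; μ = μ ; good = good
        ; μa = trans (pick-no (c a ∈? V K) (λ q → Off q H.c∈C)) (pick-no (c a ≟ c b) a≢b)
        ; μb = trans (pick-no (c b ∈? V K) (λ q → Off q H′.c∈C)) (pick-yes (c b ≟ c b) refl)
        ; ends-C = ends-C
        ; conn = edge {e = H.f} (inj₂ (inj₁ refl)) (Jn-sym H.jn) ◅◅ Connects-mono inj₁ (tree H.x∈ H′.x∈)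
                 ◅◅ edge {e = H′.f} (inj₂ (inj₂ refl)) H′.jn }
        where
        module H = Hook h
        module H′ = Hook h′
        L : Fin #E → Set
        L g = (g ∈ E K × Good κ g) ⊎ g ≡ H.f ⊎ g ≡ H′.f
        -- The factor `τ h` makes the first hook positive while `c a` keeps its value `ζ (c a)`; the
        -- value at `c b` is then forced by the second hook.
        μ : Fin #V → Sign
        μ u = pick (u ∈? V K) (τ h · κ u) (pick (u ≟ c b) (τ h · τ h′ · ζ (c b)) (ζ u))
        L⊆D : ∀ {g} → L g → g ∈ E D
        L⊆D (inj₁ (g∈ , _)) = Equivalence.from (ED _) (inj₁ g∈)
        L⊆D (inj₂ (inj₁ refl)) = Equivalence.from (ED _) (inj₂ (H.f∈ , H.x , c a , H.x∈ , H.c∈C , H.jn))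
        L⊆D (inj₂ (inj₂ refl)) = Equivalence.from (ED _) (inj₂ (H′.f∈ , H′.x , c b , H′.x∈ , H′.c∈C , H′.jn))
        good : ∀ {g} → L g → Good μ g
        good {g} (inj₁ (g∈ , gd)) = trans (switch-cong {μ} {λ u → τ h · κ u}
          λ i → pick-yes (_ ∈? V K) (ends∈ {K} (proj₁ (proj₁ comp)) g∈ i)) (trans (switch-scale (τ h) κ g) gd)
        good (inj₂ (inj₁ refl)) = trans (switch-Jn μ H.jn) (trans
          (cong₂ (λ s t → s · σ H.f · t) (pick-yes (H.x ∈? V K) H.x∈)
             (trans (pick-no (c a ∈? V K) (λ q → Off q H.c∈C)) (pick-no (c a ≟ c b) a≢b)))
          (lem (κ H.x) (σ H.f) (ζ (c a))))
          where
          lem : ∀ k s z → (k · s · z) · k · s · z ≡ ⊕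
          lem = from-yes (∀ˢ λ k → ∀ˢ λ s → ∀ˢ λ z → (k · s · z) · k · s · z ≟ˢ ⊕)
        good (inj₂ (inj₂ refl)) = trans (switch-Jn μ H′.jn) (trans
          (cong₂ (λ s t → s · σ H′.f · t) (pick-yes (H′.x ∈? V K) H′.x∈)
             (trans (pick-no (c b ∈? V K) (λ q → Off q H′.c∈C)) (pick-yes (c b ≟ c b) refl)))
          (lem (τ h) (κ H′.x) (σ H′.f) (ζ (c b))))
          where
          lem : ∀ t k s z → t · k · s · (t · (k · s · z) · z) ≡ ⊕
          lem = from-yes (∀ˢ λ t → ∀ˢ λ k → ∀ˢ λ s → ∀ˢ λ z → t · k · s · (t · (k · s · z) · z) ≟ˢ ⊕)
        ends-C : ∀ {g u} → L g → Inc g u → u ∈ V C → u ≡ c a ⊎ u ≡ c b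
        ends-C (inj₁ (g∈ , _)) i u∈ = ⊥-elim (Off (ends∈ {K} (proj₁ (proj₁ comp)) g∈ i) u∈)
        ends-C (inj₂ (inj₁ refl)) i u∈ = [ (λ { refl → ⊥-elim (Off H.x∈ u∈) }) , inj₁ ]′ (Jn-only H.jn i)
        ends-C (inj₂ (inj₂ refl)) i u∈ = [ (λ { refl → ⊥-elim (Off H′.x∈ u∈) }) , inj₂ ]′ (Jn-only H′.jn i)

  abstract
    chordLink : ∀ {f a b} → Jn f (c a) (c b) → c a ≢ c b →
      PreLink ⟨ ⁅ proj₁ (ends f) ⁆ ∪ ⁅ proj₂ (ends f) ⁆ , ⁅ f ⁆ ⟩ a b (switch S ζ f)
    chordLink {f} {a} {b} j a≢b = record
      { L = _≡ f ; L⊆D = λ { refl → x∈⁅x⁆ f } ; μ = μ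
      ; good = λ { refl → trans (switch-Jn μ j) (trans (cong₂ (λ x y → x · σ f · y) (≔-other ζ s a≢b) (≔-same ζ (c b) s))
          (trans (cong (λ t → ζ (c a) · σ f · (t · ζ (c b))) (switch-Jn ζ j)) (lem (ζ (c a)) (σ f) (ζ (c b))))) }
      ; μa = ≔-other ζ s a≢b ; μb = ≔-same ζ (c b) s
      ; ends-C = λ { refl i _ → Jn-only j i } ; conn = edge {e = f} refl j }
      where
      s : Sign
      s = switch S ζ f · ζ (c b)
      μ : Fin #V → Sign
      μ = ζ [ c b ≔ s ]
      lem : ∀ x s y → x · s · (x · s · y · y) ≡ ⊕
      lem = from-yes (∀ˢ λ x → ∀ˢ λ s → ∀ˢ λ y → x · s · (x · s · y · y) ≟ˢ ⊕)

  module _ (uniq : UniqueThrough S B C e) where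

    negative : ∀ {D a b s} → IsBridge {graph} B C D → a < b → b ≤ n → PreLink D a b s → Link D a b
    negative {s = ⊖} br a<b b≤n l = l
    negative {s = ⊕} br a<b b≤n l = ⊥-elim (noPositive br a<b b≤n uniq l)

    c≢ : ∀ {a b} → a < b → b ≤ n → c a ≢ c b
    c≢ a<b b≤n eq = <⇒≢ a<b (c-injective (≤-trans (<⇒≤ a<b) b≤n) b≤n eq)

    abstract
      linkOf : ∀ {D a b} → IsBridge {graph} B C D → a < b → b ≤ n → c a ∈ V D → c b ∈ V D → Link D a b
      linkOf {D} {a} {b} br@(inj₁ (f , _ , refl)) a<b b≤n a∈ b∈ = negative br a<b b≤n (chordLink j (c≢ a<b b≤n))
        where
        j : Jn f (c a) (c b)
        j with ends⁻ a∈ | ends⁻ b∈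
        ... | inj₁ p | inj₂ q = inj₁ (sym (cong₂ _,_ p q))
        ... | inj₂ p | inj₁ q = inj₂ (sym (cong₂ _,_ q p))
        ... | inj₁ p | inj₁ q = ⊥-elim (c≢ a<b b≤n (trans p (sym q)))
        ... | inj₂ p | inj₂ q = ⊥-elim (c≢ a<b b≤n (trans p (sym q)))
      linkOf {D} {a} {b} br@(inj₂ (K , comp , VD , ED)) a<b b≤n a∈ b∈ =
        negative br a<b b≤n (H.preLink (c≢ a<b b≤n) (H.hookAt (≤-trans (<⇒≤ a<b) b≤n) a∈) (H.hookAt b≤n b∈))
        where module H = Hooks {D} {K} comp VD ED

    abstract
      noThree : ∀ {D p q r} → IsBridge {graph} B C D → p < q → q < r → r ≤ n →
                c p ∈ V D → c q ∈ V D → c r ∈ V D → Absurd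
      noThree (inj₁ (f , _ , refl)) p<q q<r r≤n p∈ q∈ r∈ with ends⁻ p∈ | ends⁻ q∈ | ends⁻ r∈
      ... | inj₁ x | inj₁ y | _      = c≢ p<q (≤-trans (<⇒≤ q<r) r≤n) (trans x (sym y))
      ... | inj₂ x | inj₂ y | _      = c≢ p<q (≤-trans (<⇒≤ q<r) r≤n) (trans x (sym y))
      ... | inj₁ x | inj₂ _ | inj₁ z = c≢ (<-trans p<q q<r) r≤n (trans x (sym z))
      ... | inj₂ x | inj₁ _ | inj₂ z = c≢ (<-trans p<q q<r) r≤n (trans x (sym z))
      ... | inj₁ _ | inj₂ y | inj₂ z = c≢ q<r r≤n (trans y (sym z))
      ... | inj₂ _ | inj₁ y | inj₁ z = c≢ q<r r≤n (trans y (sym z))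
      noThree {D} {p} {q} {r} br@(inj₂ (K , comp , VD , ED)) p<q q<r r≤n p∈ q∈ r∈ =
        [ (λ eq → same p<q q≤n hp hq eq) , [ (λ eq → same (<-trans p<q q<r) r≤n hp hr eq) , (λ eq → same q<r r≤n hq hr eq) ]′ ]′
          (sign-pigeonhole (H.τ hp) (H.τ hq) (H.τ hr))
        where
        module H = Hooks {D} {K} comp VD ED
        q≤n : q ≤ n
        q≤n = ≤-trans (<⇒≤ q<r) r≤n
        hp : H.Hook p
        hp = H.hookAt (≤-trans (<⇒≤ p<q) q≤n) p∈
        hq : H.Hook q
        hq = H.hookAt q≤n q∈
        hr : H.Hook r
        hr = H.hookAt r≤n r∈
        same : ∀ {x y} → x < y → y ≤ n → (h : H.Hook x) (h′ : H.Hook y) → H.τ h ≡ H.τ h′ → Absurd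
        same x<y y≤n h h′ eq = noPositive br x<y y≤n uniq (subst (PreLink D _ _) (·-same eq) (H.preLink (c≢ x<y y≤n) h h′))

    record Span (D : Sub graph) : Set₁ where
      field
        a b : ℕ
        a<b : a < b
        b≤n : b ≤ n
        attach : attachments {graph} C D ≡ ⁅ c a ⁆ ∪ ⁅ c b ⁆
        a∈ : c a ∈ V D
        b∈ : c b ∈ V D
        lnk : Link D a b

    abstract
      orderedSpan : ∀ {D a b} → IsBridge {graph} B C D → a < b → b ≤ n → c a ∈ V D → c b ∈ V D → Span D
      orderedSpan {D} {a} {b} br a<b b≤n a∈ b∈ = record
        { a = a ; b = b ; a<b = a<b ; b≤n = b≤n ; a∈ = a∈ ; b∈ = b∈ ; lnk = linkOf br a<b b≤n a∈ b∈
        ; attach = ⊆-antisym (λ {z} z∈ → to (proj₁ (x∈p∩q⁻ (V D) (V C) z∈)) (proj₂ (x∈p∩q⁻ (V D) (V C) z∈)))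
            (λ z∈ → [ (λ { refl → x∈p∩q⁺ (a∈ , c∈ (≤-trans (<⇒≤ a<b) b≤n)) }) , (λ { refl → x∈p∩q⁺ (b∈ , c∈ b≤n) }) ]′ (ends⁻ z∈)) }
        where
        to : ∀ {z} → z ∈ V D → z ∈ V C → z ∈ ⁅ c a ⁆ ∪ ⁅ c b ⁆
        to z∈ zC with at-pos zC
        ... | r , r≤n , refl with <-cmpⁿ r a | <-cmpⁿ r b
        ... | tri≈ _ refl _ | _ = ends⁺ (inj₁ refl)
        ... | tri< l _ _ | _ = ⊥-elim (noThree {D} br l a<b b≤n z∈ a∈ b∈)
        ... | tri> _ _ _ | tri≈ _ refl _ = ends⁺ (inj₂ refl)
        ... | tri> _ _ l | tri< l′ _ _ = ⊥-elim (noThree {D} br l l′ b≤n a∈ z∈ b∈)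
        ... | tri> _ _ _ | tri> _ _ l = ⊥-elim (noThree {D} br a<b l r≤n a∈ b∈ z∈)

    abstract
      span : ∀ {D} → IsBridge {graph} B C D → Span D
      span {D} br with Br.bridge-attachments {D} br
      ... | u , w , u≢w , (u∈ , uC) , (w∈ , wC) with at-pos uC | at-pos wC
      ... | p , p≤n , refl | q , q≤n , refl with <-cmpⁿ p q
      ... | tri≈ _ refl _ = ⊥-elim (u≢w refl)
      ... | tri< p<q _ _ = orderedSpan {D} br p<q q≤n u∈ w∈
      ... | tri> _ _ q<p = orderedSpan {D} br q<p p≤n w∈ u∈


-- Two bridges of a unique positive circle

module Nesting (S : SignedGraph) {B C : Sub (SignedGraph.graph S)} (tight : Blocks.Tight (SignedGraph.graph S) B)
  (pos : PositiveCircle S C) (C⊑B : C ⊑ B) {e : Fin (SignedGraph.#E S)} (R : Rings.Ring (SignedGraph.graph S) C e) where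
  open SignedGraph S
  open Signed S
  open Rings.Ring R renaming (pos to posn)
  open Core S tight pos C⊑B R

  private
    turned : (Q : ℕ → Set) → (∀ p → Dec (Q p)) → Fin #V → Sign
    turned Q Q? u = pick (Q? (posn u)) (opp (ζ u)) (ζ u)

    turned-yes : ∀ {Q Q? p} → p ≤ n → Q p → turned Q Q? (c p) ≡ opp (ζ (c p))
    turned-yes {Q} {Q?} {p} p≤n q = pick-yes (Q? _) (subst Q (sym (pos-c p≤n)) q)

    turned-no : ∀ {Q Q? p} → p ≤ n → ¬ Q p → turned Q Q? (c p) ≡ ζ (c p)
    turned-no {Q} {Q?} {p} p≤n ¬q = pick-no (Q? _) (λ q → ¬q (subst Q (pos-c p≤n) q))

    -- A common potential for two detours: on `C` it is `ζ`, reversed at the positions in `Q`; on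
    -- the rest of `D` it is that of the first link; elsewhere it is that of the second, scaled by
    -- `t`. Distinct bridges share no vertex off `C`, so the pieces do not conflict.
    module Patch {D D′ : Sub graph} (br : IsBridge {graph} B C D) (br′ : IsBridge {graph} B C D′) (D≢D′ : D ≢ D′)
      {s s′ a b a′ b′} (l : PreLink D a b s) (l′ : PreLink D′ a′ b′ s′) (t : Sign) (Q : ℕ → Set) (Q? : ∀ p → Dec (Q p)) where
      module L = PreLink l
      module L′ = PreLink l′

      ξ : Fin #V → Sign
      ξ u = pick (u ∈? V C) (turned Q Q? u) (pick (u ∈? V D) (L.μ u) (t · L′.μ u))

      ξ-C : ∀ {u} → u ∈ V C → ξ u ≡ turned Q Q? u
      ξ-C {u} = pick-yes (u ∈? V C)

      abstract
        good-L : turned Q Q? (c a) ≡ L.μ (c a) → turned Q Q? (c b) ≡ L.μ (c b) → ∀ {g} → L.L g → Good ξ g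
        good-L pa pb {g} q = trans (switch-cong {ξ} {L.μ} agree) (L.good q)
          where
          agree : ∀ {u} → Inc g u → ξ u ≡ L.μ u
          agree {u} i with u ∈? V C
          ... | no u∉ = pick-yes (u ∈? V D) (Br.bridge-Inc {D} br (L.L⊆D q) i)
          ... | yes u∈ with L.ends-C q i u∈
          ...   | inj₁ refl = pa
          ...   | inj₂ refl = pb

        good-L′ : turned Q Q? (c a′) ≡ t · L′.μ (c a′) → turned Q Q? (c b′) ≡ t · L′.μ (c b′) → ∀ {g} → L′.L g → Good ξ g
        good-L′ pa pb {g} q = trans (switch-cong {ξ} {λ u → t · L′.μ u} agree) (trans (switch-scale t L′.μ g) (L′.good q))
          where
          agree : ∀ {u} → Inc g u → ξ u ≡ t · L′.μ u
          agree {u} i with u ∈? V C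
          ... | no u∉ = pick-no (u ∈? V D) λ u∈ → D≢D′ (Br.bridge-unique-V {D} {D′} br br′ u∈ (Br.bridge-Inc {D′} br′ (L′.L⊆D q) i) u∉)
          ... | yes u∈ with L′.ends-C q i u∈
          ...   | inj₁ refl = pa
          ...   | inj₂ refl = pb

        good-in : ∀ {g x y} → g ∈ E C → Jn g (c x) (c y) → x ≤ n → y ≤ n → Q x → Q y → Good ξ g
        good-in {g} g∈ j x≤ y≤ qx qy = trans (switch-cong {ξ} {λ u → ⊖ · ζ u} agree) (trans (switch-scale ⊖ ζ g) (ζ-Good g∈))
          where
          agree : ∀ {u} → Inc g u → ξ u ≡ opp (ζ u)
          agree i = trans (ξ-C (ends∈ {C} C-sub g∈ i)) ([ (λ { refl → turned-yes {Q} {Q?} x≤ qx }) , (λ { refl → turned-yes {Q} {Q?} y≤ qy }) ]′ (Jn-only j i))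

        good-out : ∀ {g x y} → g ∈ E C → Jn g (c x) (c y) → x ≤ n → y ≤ n → ¬ Q x → ¬ Q y → Good ξ g
        good-out {g} g∈ j x≤ y≤ qx qy = trans (switch-cong {ξ} {ζ} agree) (ζ-Good g∈)
          where
          agree : ∀ {u} → Inc g u → ξ u ≡ ζ u
          agree i = trans (ξ-C (ends∈ {C} C-sub g∈ i)) ([ (λ { refl → turned-no {Q} {Q?} x≤ qx }) , (λ { refl → turned-no {Q} {Q?} y≤ qy }) ]′ (Jn-only j i))

    opp-opp : ∀ s → opp (opp s) ≡ s
    opp-opp ⊕ = refl
    opp-opp ⊖ = refl

  abstract
    -- Otherwise two detours, with the part of C between them traversed
    -- backwards if the bridges cross, make up a positive circle through e.
    nested : UniqueThrough S B C e → ∀ {D D′ a b a′ b′} → IsBridge {graph} B C D → IsBridge {graph} B C D′ → D ≢ D′ →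
      Link D a b → Link D′ a′ b′ → a < b → b ≤ n → a′ < b′ → b′ ≤ n → ¬ (a < a′ × b < b′)
    nested uniq {D} {D′} {a} {b} {a′} {b′} br br′ D≢D′ l l′ a<b b≤n a′<b′ b′≤n (a<a′ , b<b′) =
      exclude {g = e} {d a} {U} {ξ} uniq good (good-out e∈ close ≤-refl z≤n ¬Q-n ¬Q-0) ¬Ue U⊆B (proj₂ C⊑B e∈) close
        conn (d∈ a<n) (d≢e a<n) missing
      where
      -- Both detours are negative: the first demands a reversal of `ζ` at `b`, the second undoes it
      -- between `a′` and `b′`. So `ζ` is reversed exactly on the part between `b` and `a′`, in
      -- whichever order these come, and the second link is scaled by `⊖`.
      Q : ℕ → Set
      Q p = (b ≤ p × p ≤ a′) ⊎ (a′ ≤ p × p ≤ b)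
      Q? : ∀ p → Dec (Q p)
      Q? p = ((b ≤?ⁿ p) ×-dec (p ≤?ⁿ a′)) ⊎-dec ((a′ ≤?ⁿ p) ×-dec (p ≤?ⁿ b))
      open Patch br br′ D≢D′ l l′ ⊖ Q Q?
      -- The parts of `C` on the route. None of them contains `d a`, which serves as the missing
      -- edge.
      Range : ℕ → Set
      Range p = p < a ⊎ (b ≤ p × p < a′) ⊎ (a′ ≤ p × p < b) ⊎ b′ ≤ p
      U : Fin #E → Set
      U g = L.L g ⊎ L′.L g ⊎ ∃[ p ] p < n × Range p × g ≡ d p
      a′≤n : a′ ≤ n
      a′≤n = ≤-trans (<⇒≤ a′<b′) b′≤n
      a≤n : a ≤ n
      a≤n = ≤-trans (<⇒≤ a<b) b≤n
      a<n : a < n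
      a<n = ≤-trans a<b b≤n
      Q-b : Q b
      Q-b = map⊎ (≤-refl ,_) (_, ≤-refl) (≤-total b a′)
      Q-a′ : Q a′
      Q-a′ = map⊎ (_, ≤-refl) (≤-refl ,_) (≤-total b a′)
      ¬Q-low : ∀ {p} → p ≤ a → ¬ Q p
      ¬Q-low p≤a (inj₁ (r , _)) = <⇒≱ a<b (≤-trans r p≤a)
      ¬Q-low p≤a (inj₂ (r , _)) = <⇒≱ a<a′ (≤-trans r p≤a)
      ¬Q-high : ∀ {p} → b′ ≤ p → ¬ Q p
      ¬Q-high b′≤p (inj₁ (_ , r)) = <⇒≱ a′<b′ (≤-trans b′≤p r)
      ¬Q-high b′≤p (inj₂ (_ , r)) = <⇒≱ b<b′ (≤-trans b′≤p r)
      ¬Q-n : ¬ Q n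
      ¬Q-n = ¬Q-high b′≤n
      ¬Q-0 : ¬ Q 0
      ¬Q-0 = ¬Q-low z≤n
      good : ∀ {g} → U g → Good ξ g
      good (inj₁ q) = good-L (trans (turned-no {Q} {Q?} a≤n (¬Q-low ≤-refl)) (sym L.μa)) (trans (turned-yes {Q} {Q?} b≤n Q-b) (sym L.μb)) q
      good (inj₂ (inj₁ q)) = good-L′ (trans (turned-yes {Q} {Q?} a′≤n Q-a′) (cong opp (sym L′.μa)))
        (trans (turned-no {Q} {Q?} b′≤n (¬Q-high ≤-refl)) (trans (sym (opp-opp _)) (cong opp (sym L′.μb)))) q
      good (inj₂ (inj₂ (p , p<n , inj₁ r , refl))) =
        good-out (d∈ p<n) (join p<n) (<⇒≤ p<n) p<n (¬Q-low (<⇒≤ r)) (¬Q-low r)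
      good (inj₂ (inj₂ (p , p<n , inj₂ (inj₁ (r , s)) , refl))) =
        good-in (d∈ p<n) (join p<n) (<⇒≤ p<n) p<n (inj₁ (r , <⇒≤ s)) (inj₁ (≤-trans r (n≤1+n p) , s))
      good (inj₂ (inj₂ (p , p<n , inj₂ (inj₂ (inj₁ (r , s))) , refl))) =
        good-in (d∈ p<n) (join p<n) (<⇒≤ p<n) p<n (inj₂ (r , <⇒≤ s)) (inj₂ (≤-trans r (n≤1+n p) , s))
      good (inj₂ (inj₂ (p , p<n , inj₂ (inj₂ (inj₂ r)) , refl))) =
        good-out (d∈ p<n) (join p<n) (<⇒≤ p<n) p<n (¬Q-high r) (¬Q-high (≤-trans r (n≤1+n p)))
      ¬Ue : ¬ U e
      ¬Ue (inj₁ q) = bridge-∉C {D} br (L.L⊆D q) e∈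
      ¬Ue (inj₂ (inj₁ q)) = bridge-∉C {D′} br′ (L′.L⊆D q) e∈
      ¬Ue (inj₂ (inj₂ (p , p<n , _ , eq))) = d≢e p<n (sym eq)
      U⊆B : ∀ {g} → U g → g ∈ E B
      U⊆B (inj₁ q) = proj₁ (Br.bridge-E {D} br (L.L⊆D q))
      U⊆B (inj₂ (inj₁ q)) = proj₁ (Br.bridge-E {D′} br′ (L′.L⊆D q))
      U⊆B (inj₂ (inj₂ (p , p<n , _ , refl))) = proj₂ C⊑B (d∈ p<n)
      along : ∀ {x y} → x ≤ y → y ≤ n → (∀ {p} → x ≤ p → p < y → Range p) → Connects U (c x) (c y)
      along x≤y y≤n f = arcConnects (≤‴-from x≤y) y≤n λ {p} r s → inj₂ (inj₂ (p , ≤-trans s y≤n , f r s , refl))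
      middle : Connects U (c b) (c a′)
      middle = [ (λ r → along r a′≤n λ p q → inj₂ (inj₁ (p , q))) ,
                 (λ r → Connects-sym (along r b≤n λ p q → inj₂ (inj₂ (inj₁ (p , q))))) ]′ (≤-total b a′)
      conn : Connects U (c 0) (c n)
      conn = along z≤n a≤n (λ _ → inj₁) ◅◅ Connects-mono inj₁ L.conn ◅◅ middle ◅◅
             Connects-mono (inj₂ ∘ inj₁) L′.conn ◅◅ along b′≤n ≤-refl (λ r _ → inj₂ (inj₂ (inj₂ r)))
      missing : ¬ U (d a)
      missing (inj₁ q) = bridge-∉C {D} br (L.L⊆D q) (d∈ a<n)
      missing (inj₂ (inj₁ q)) = bridge-∉C {D′} br′ (L′.L⊆D q) (d∈ a<n)
      missing (inj₂ (inj₂ (p , p<n , r , eq))) with d-injective a<n p<n eq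
      ... | refl with r
      ...   | inj₁ q = <-irrefl refl q
      ...   | inj₂ (inj₁ (q , _)) = <⇒≱ a<b q
      ...   | inj₂ (inj₂ (inj₁ (q , _))) = <⇒≱ a<a′ q
      ...   | inj₂ (inj₂ (inj₂ q)) = <⇒≱ (<-trans a<b b<b′) q

    -- A bridge attached at c 0, where both edges of C lie in no other positive
    -- circle, leaves no room for a second one.
    noSecond : (∀ {g} → 0 < n → g ≡ d 0 → UniqueThrough S B C g) → ∀ {D D′ w a′ b′} →
      IsBridge {graph} B C D → IsBridge {graph} B C D′ → D ≢ D′ →
      Link D 0 w → Link D′ a′ b′ → w ≤ n → 0 < a′ → a′ < b′ → b′ ≤ w → Absurd
    noSecond uniq {D} {D′} {w} {a′} {b′} br br′ D≢D′ l l′ w≤n 0<a′ a′<b′ b′≤w =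
      exclude {g = d 0} {e} {U} {ξ} (uniq 0<n refl) good
        (good-out (d∈ 0<n) (join 0<n) z≤n 0<n (¬Q-low (<-trans 0<a′ a′<b′)) (¬Q-low (≤-<-trans 0<a′ a′<b′))) ¬Ud U⊆B (proj₂ C⊑B (d∈ 0<n))
        (join 0<n) conn e∈ (d≢e 0<n ∘ sym) missing
      where
      0<w : 0 < w
      0<w = <-≤-trans (<-trans 0<a′ a′<b′) b′≤w
      0<n : 0 < n
      0<n = <-≤-trans 0<w w≤n
      -- The circle is closed by `d 0`: from `c 1` along `C` to `c a′`, across `D′`, along `C` to
      -- `c w`, and across `D` back to `c 0`. Both detours are negative, so `ζ` is reversed from
      -- `b′` on; the missing edge of `C` is `e`.
      Q : ℕ → Set
      Q p = b′ ≤ p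
      Q? : ∀ p → Dec (Q p)
      Q? p = b′ ≤?ⁿ p
      open Patch br br′ D≢D′ l l′ ⊕ Q Q?
      Range : ℕ → Set
      Range p = (1 ≤ p × p < a′) ⊎ (b′ ≤ p × p < w)
      U : Fin #E → Set
      U g = L.L g ⊎ L′.L g ⊎ ∃[ p ] p < n × Range p × g ≡ d p
      b′≤n : b′ ≤ n
      b′≤n = ≤-trans b′≤w w≤n
      a′≤n : a′ ≤ n
      a′≤n = ≤-trans (<⇒≤ a′<b′) b′≤n
      ¬Q-low : ∀ {p} → p < b′ → ¬ Q p
      ¬Q-low p<b′ r = <⇒≱ p<b′ r
      good : ∀ {g} → U g → Good ξ g
      good (inj₁ q) = good-L (trans (turned-no {Q} {Q?} z≤n (¬Q-low (<-trans 0<a′ a′<b′))) (sym L.μa))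
        (trans (turned-yes {Q} {Q?} w≤n b′≤w) (sym L.μb)) q
      good (inj₂ (inj₁ q)) = good-L′ (trans (turned-no {Q} {Q?} a′≤n (¬Q-low a′<b′)) (sym L′.μa))
        (trans (turned-yes {Q} {Q?} b′≤n ≤-refl) (sym L′.μb)) q
      good (inj₂ (inj₂ (p , p<n , inj₁ (_ , r) , refl))) =
        good-out (d∈ p<n) (join p<n) (<⇒≤ p<n) p<n (¬Q-low (<-trans r a′<b′)) (¬Q-low (≤-<-trans r a′<b′))
      good (inj₂ (inj₂ (p , p<n , inj₂ (r , _) , refl))) =
        good-in (d∈ p<n) (join p<n) (<⇒≤ p<n) p<n r (≤-trans r (n≤1+n p))
      U⊆B : ∀ {g} → U g → g ∈ E B
      U⊆B (inj₁ q) = proj₁ (Br.bridge-E {D} br (L.L⊆D q))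
      U⊆B (inj₂ (inj₁ q)) = proj₁ (Br.bridge-E {D′} br′ (L′.L⊆D q))
      U⊆B (inj₂ (inj₂ (p , p<n , _ , refl))) = proj₂ C⊑B (d∈ p<n)
      ¬Ud : ¬ U (d 0)
      ¬Ud (inj₁ q) = bridge-∉C {D} br (L.L⊆D q) (d∈ 0<n)
      ¬Ud (inj₂ (inj₁ q)) = bridge-∉C {D′} br′ (L′.L⊆D q) (d∈ 0<n)
      ¬Ud (inj₂ (inj₂ (p , p<n , r , eq))) with d-injective 0<n p<n eq
      ... | refl = [ (λ { (() , _) }) , (λ (q , _) → <⇒≱ (<-trans 0<a′ a′<b′) q) ]′ r
      missing : ¬ U e
      missing (inj₁ q) = bridge-∉C {D} br (L.L⊆D q) e∈
      missing (inj₂ (inj₁ q)) = bridge-∉C {D′} br′ (L′.L⊆D q) e∈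
      missing (inj₂ (inj₂ (p , p<n , _ , eq))) = d≢e p<n (sym eq)
      along : ∀ {x y} → x ≤ y → y ≤ n → (∀ {p} → x ≤ p → p < y → Range p) → Connects U (c x) (c y)
      along x≤y y≤n f = arcConnects (≤‴-from x≤y) y≤n λ {p} r s → inj₂ (inj₂ (p , ≤-trans s y≤n , f r s , refl))
      conn : Connects U (c 1) (c 0)
      conn = along 0<a′ a′≤n (λ r s → inj₁ (r , s)) ◅◅ Connects-mono (inj₂ ∘ inj₁) L′.conn ◅◅
             along b′≤w w≤n (λ r s → inj₂ (r , s)) ◅◅ Connects-sym (Connects-mono inj₁ L.conn)

  module _ (uniq : UniqueThrough S B C e) where

    abstract
      layered : B ≢ C → Layered {graph} B C
      layered B≢C = fromEnumeration (enumerateSubs Br.IsBridge?)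
        where
        fromEnumeration : (∃[ k ] Exactly k (IsBridge {graph} B C)) → Layered {graph} B C
        fromEnumeration (zero , _ , _ , _ , complete) = case proj₁ (complete _ (proj₂ (Br.bridge-exists B≢C))) of λ ()
        fromEnumeration (suc k , D , inj , sound , complete) = suc k , D , LR.chords , (inj , sound , complete) ,
          (λ i → (λ eq → <⇒≢ (Span.a<b (sp i)) (c-injective (≤-trans (<⇒≤ (Span.a<b (sp i))) (Span.b≤n (sp i))) (Span.b≤n (sp i)) eq)) ,
                 Span.attach (sp i)) ,
          LR.layeredChords
          where
          sp : ∀ i → Span uniq (D i)
          sp i = span uniq (sound i)
          nest : ∀ i j → ¬ (Span.a (sp i) < Span.a (sp j) × Span.b (sp i) < Span.b (sp j))
          nest i j with i ≟ j
          ... | yes refl = λ (r , _) → <-irrefl refl r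
          ... | no i≢j = nested uniq (sound i) (sound j) (i≢j ∘ inj) (Span.lnk (sp i)) (Span.lnk (sp j))
                (Span.a<b (sp i)) (Span.b≤n (sp i)) (Span.a<b (sp j)) (Span.b≤n (sp j))
          module LR = LayeredRing graph R (λ i → Span.a (sp i)) (λ i → Span.b (sp i)) (λ i → Span.a<b (sp i)) (λ i → Span.b≤n (sp i)) nest


-- Suppressing a vertex of degree 2

theTwo-list : ∀ {A : Set} (xs : List A) (eq : length xs ≡ 2) → xs ≡ proj₁ (theTwo xs eq) ∷ proj₂ (theTwo xs eq) ∷ []
theTwo-list (x ∷ y ∷ []) _ = refl

module Suppression (S : SignedGraph) {B : Sub (SignedGraph.graph S)} {v : Fin (SignedGraph.#V S)}
  (tight : Blocks.Tight (SignedGraph.graph S) B) (two : deg {(SignedGraph.graph S)} B v ≡ 2) where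
  open SignedGraph S
  open Signed S
  open Suppress S B v two
  open Tight tight

  module ↓ where
    open Signed S↓ public
    open SignedGraph S↓ public

  private
    list : edgesAt {graph} B v ≡ e₁ ∷ e₂ ∷ []
    list = theTwo-list (edgesAt {graph} B v) two

  abstract
    e₁-at : e₁ ∈ E B × Inc e₁ v
    e₁-at = ∈-edgesAt⁻ {B} (subst (e₁ ∈ˡ_) (sym list) (here refl))

    e₂-at : e₂ ∈ E B × Inc e₂ v
    e₂-at = ∈-edgesAt⁻ {B} (subst (e₂ ∈ˡ_) (sym list) (there (here refl)))

    e₁≢e₂ : e₁ ≢ e₂
    e₁≢e₂ eq = Unique-∷⁻ (subst Unique list (edgesAt-Unique B v)) (here eq)

    onlyTwo : ∀ {g} → g ∈ E B → Inc g v → g ≡ e₁ ⊎ g ≡ e₂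
    onlyTwo {g} g∈ i with subst (g ∈ˡ_) list (∈-edgesAt⁺ {B} g∈ i)
    ... | here eq = inj₁ eq
    ... | there (here eq) = inj₂ eq

  s t : Fin #V
  s = otherEnd {graph} e₁ v
  t = otherEnd {graph} e₂ v

  abstract
    j₁ : Jn e₁ v s
    j₁ = otherEnd-Jn (proj₂ e₁-at)

    j₂ : Jn e₂ v t
    j₂ = otherEnd-Jn (proj₂ e₂-at)

    v≢s : v ≢ s
    v≢s eq = e₁≢e₂ (sym (loop-only {B} tight (proj₁ e₁-at) (Loop-Jn (subst (Jn e₁ v) (sym eq) j₁)) (proj₁ e₂-at)))

    v≢t : v ≢ t
    v≢t eq = e₁≢e₂ (loop-only {B} tight (proj₁ e₂-at) (Loop-Jn (subst (Jn e₂ v) (sym eq) j₂)) (proj₁ e₁-at))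

    s∈ : s ∈ V B
    s∈ = ends∈ {B} subgraph (proj₁ e₁-at) (Jn-Incʳ j₁)

    t∈ : t ∈ V B
    t∈ = ends∈ {B} subgraph (proj₁ e₂-at) (Jn-Incʳ j₂)

    ↓E⁺ : ∀ {H : Sub graph} {g} → g ∈ E H → g ≢ e₁ → g ≢ e₂ → suc g ∈ E (↓ H)
    ↓E⁺ g∈ n₁ n₂ = there (x∈p∧x≢y⇒x∈p-y (x∈p∧x≢y⇒x∈p-y g∈ n₁) n₂)

    ↓E⁻ : ∀ {H : Sub graph} {g} → suc g ∈ E (↓ H) → g ∈ E H × g ≢ e₁ × g ≢ e₂
    ↓E⁻ {H} (there g∈) with ∈-⁻ {p = E H - e₁} g∈
    ... | q , n₂ with ∈-⁻ {p = E H} q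
    ...   | r , n₁ = r , n₁ , n₂

  avoid : ∀ {g} → g ∈ E B → g ≢ e₁ → g ≢ e₂ → ¬ Inc g v
  avoid g∈ n₁ n₂ i = [ n₁ , n₂ ]′ (onlyTwo g∈ i)

  lift : ∀ {x y} → W x y → ↓.W x y
  lift (nil x)      = ↓.nil x
  lift (step e j P) = ↓.step (suc e) j (lift P)

  vs-lift : ∀ {x y} (P : W x y) → ↓.vs (lift P) ≡ vs P
  vs-lift (nil x)      = refl
  vs-lift (step e j P) = cong (_ ∷_) (vs-lift P)

  es-lift : ∀ {x y} (P : W x y) → ↓.es (lift P) ≡ map suc (es P)
  es-lift (nil x)      = refl
  es-lift (step e j P) = cong (suc e ∷_) (es-lift P)

  sgn-lift : ∀ xs → ↓.sgn (map suc xs) ≡ sgn xs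
  sgn-lift []       = refl
  sgn-lift (x ∷ xs) = cong (σ x ·_) (sgn-lift xs)

  lower : ∀ {x y} (P : ↓.W x y) → eᵥ ∉ˡ ↓.es P → Σ[ Q ∈ W x y ] lift Q ≡ P
  lower (↓.nil x) _ = nil x , refl
  lower (↓.step zero j P) n = ⊥-elim (n (here refl))
  lower (↓.step (suc e) j P) n with lower P (n ∘ there)
  ... | Q , refl = step e j Q , refl

  ∈-lift⁺ : ∀ {x y} (P : W x y) {g} → g ∈ˡ es P → suc g ∈ˡ ↓.es (lift P)
  ∈-lift⁺ (step e j P) (here refl) = here refl
  ∈-lift⁺ (step e j P) (there g∈) = there (∈-lift⁺ P g∈)

  ∈-lift⁻ : ∀ {x y} (P : W x y) {g} → g ∈ˡ ↓.es (lift P) → ∃[ h ] g ≡ suc h × h ∈ˡ es P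
  ∈-lift⁻ (step e j P) (here refl) = e , refl , here refl
  ∈-lift⁻ (step e j P) (there g∈) with ∈-lift⁻ P g∈
  ... | h , eq , h∈ = h , eq , there h∈

  module _ (P : W t s) (uP : Unique (vs P)) (v∉ : v ∉ˡ vs P) where

    long : W v s
    long = step e₂ j₂ P

    through : Sub graph
    through = closed e₁ long

    through↓ : Sub ↓.graph
    through↓ = ↓.closed eᵥ (lift P)

    private
      e₁∉ : e₁ ∉ˡ es long
      e₁∉ (here eq) = e₁≢e₂ eq
      e₁∉ (there q) = v∉ (es-Inc P q (Jn-Inc j₁))

      eᵥ∉ : eᵥ ∉ˡ ↓.es (lift P)
      eᵥ∉ q with ∈-lift⁻ P q
      ... | _ , () , _

      uP↓ : Unique (↓.vs (lift P))
      uP↓ = subst Unique (sym (vs-lift P)) uP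

    abstract
      through-circle : IsCircle {graph} through
      through-circle = closed-circle long (Unique-∷⁺ v∉ uP) (Jn-sym j₁) e₁∉

      through↓-circle : IsCircle {↓.graph} through↓
      through↓-circle = ↓.closed-circle (lift P) uP↓ (inj₁ refl) eᵥ∉

      through-sign : signOf S through ≡ signOf S↓ through↓
      through-sign = trans (signOf-closed long (Unique-∷⁺ v∉ uP) e₁∉)
        (trans (lem (σ e₁) (σ e₂) (sgn (es P))) (sym (trans (↓.signOf-closed (lift P) uP↓ eᵥ∉)
          (cong ((σ e₁ · σ e₂) ·_) (trans (cong ↓.sgn (es-lift P)) (sgn-lift (es P)))))))
        where
        lem : ∀ a b c → a · (b · c) ≡ (a · b) · c
        lem = from-yes (∀ˢ λ a → ∀ˢ λ b → ∀ˢ λ c → a · (b · c) ≟ˢ (a · b) · c)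

      ↓-through : ↓ through ≡ through↓
      ↓-through = Sub-ext
        ((λ u∈ → ↓.∈V-mk⁺ {↓.vs (lift P)} {eᵥ ∷ ↓.es (lift P)} (subst (_ ∈ˡ_) (sym (vs-lift P)) (inV u∈))) ,
         (λ {g} g∈ → ↓.∈E-mk⁺ {↓.vs (lift P)} {eᵥ ∷ ↓.es (lift P)} (inE g g∈)))
        ((λ u∈ → outV (subst (_ ∈ˡ_) (vs-lift P) (↓.∈V-mk⁻ {↓.vs (lift P)} {eᵥ ∷ ↓.es (lift P)} u∈))) ,
         (λ g∈ → outE (↓.∈E-mk⁻ {↓.vs (lift P)} {eᵥ ∷ ↓.es (lift P)} g∈)))
        where
        inV : ∀ {u} → u ∈ V through - v → u ∈ˡ vs P
        inV u∈ with ∈-⁻ {p = V through} u∈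
        ... | q , u≢v with ∈V-mk⁻ {vs long} {e₁ ∷ es long} q
        ...   | here eq = ⊥-elim (u≢v eq)
        ...   | there r = r
        outV : ∀ {u} → u ∈ˡ vs P → u ∈ V through - v
        outV u∈ = x∈p∧x≢y⇒x∈p-y (∈V-mk⁺ {vs long} {e₁ ∷ es long} (there u∈)) λ { refl → v∉ u∈ }
        inE : ∀ g → g ∈ E (↓ through) → g ∈ˡ eᵥ ∷ ↓.es (lift P)
        inE zero _ = here refl
        inE (suc g) g∈ with ↓E⁻ {through} g∈
        ... | q , n₁ , n₂ with ∈E-mk⁻ {vs long} {e₁ ∷ es long} q
        ...   | here eq = ⊥-elim (n₁ eq)
        ...   | there (here eq) = ⊥-elim (n₂ eq)
        ...   | there (there r) = there (∈-lift⁺ P r)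
        outE : ∀ {g} → g ∈ˡ eᵥ ∷ ↓.es (lift P) → g ∈ E (↓ through)
        outE (here refl) = here
        outE (there q) with ∈-lift⁻ P q
        ... | h , refl , h∈ = ↓E⁺ {through} (∈E-mk⁺ {vs long} {e₁ ∷ es long} (there (there h∈)))
              (λ { refl → v∉ (es-Inc P h∈ (Jn-Inc j₁)) }) (λ { refl → v∉ (es-Inc P h∈ (Jn-Inc j₂)) })

      v∈through : v ∈ V through
      v∈through = ∈V-mk⁺ {vs long} {e₁ ∷ es long} (here refl)

  abstract
    circle-e₁e₂ : ∀ {D} → IsCircle {graph} D → D ⊑ B → v ∈ V D → e₁ ∈ E D × e₂ ∈ E D
    circle-e₁e₂ {D} circD D⊑B v∈ = has e₁ e₂ s j₁ j₂ v≢t (λ g∈ i → onlyTwo g∈ i) , has e₂ e₁ t j₂ j₁ v≢s (λ g∈ i → swap⊎ (onlyTwo g∈ i))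
      where
      has : ∀ g h x {y} → Jn g v x → Jn h v y → v ≢ y → (∀ {f} → f ∈ E B → Inc f v → f ≡ g ⊎ f ≡ h) → g ∈ E D
      has g h x {y} jg jh v≢y only with circle-edge {D} circD v∈
      ... | f , f∈ , i with only (proj₂ D⊑B f∈) i
      ...   | inj₁ refl = f∈
      ...   | inj₂ refl with val<valency {D} {h ∷ []} v ([] ∷ []) (λ { (here refl) → f∈ })
                               (≤-trans (s≤s (≤-reflexive one)) (≤-reflexive (sym (proj₂ circD v v∈))))
        where
        one : val (h ∷ []) v ≡ 1
        one = trans (+-identityʳ _) (trans (ends#-Jn v jh) (cong₂ _+_ (δ-refl v) (δ-≢ (v≢y ∘ sym))))
      ...     | f′ , f′∈ , n , i′ with only (proj₂ D⊑B f′∈) i′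
      ...       | inj₁ refl = f′∈
      ...       | inj₂ refl = ⊥-elim (n (here refl))

    -- Rooting the circle at `e₁` puts `v` at one end of the remaining path, and the only edge by
    -- which this path can leave `v` is `e₂`.
    decompose : ∀ {D} → IsCircle {graph} D → D ⊑ B → v ∈ V D →
                Σ[ P ∈ W t s ] Σ[ uP ∈ Unique (vs P) ] Σ[ v∉ ∈ v ∉ˡ vs P ] D ≡ through P uP v∉
    decompose {D} circD D⊑B v∈ with circle-e₁e₂ {D} circD D⊑B v∈
    ... | e₁∈ , _ with circle-closed {D} circD e₁∈ (Jn-sym j₁)
    ... | P , uP , e₁∉ , eq = go P uP e₁∉ refl eq
      where
      go : ∀ {x} (P : W x s) → Unique (vs P) → e₁ ∉ˡ es P → x ≡ v → D ≡ closed e₁ P →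
           Σ[ P ∈ W t s ] Σ[ uP ∈ Unique (vs P) ] Σ[ v∉ ∈ v ∉ˡ vs P ] D ≡ through P uP v∉
      go (nil _) _ _ s≡v _ = ⊥-elim (v≢s (sym s≡v))
      go (step h j P) uP e₁∉ refl eq with onlyTwo (proj₂ D⊑B (subst (λ T → h ∈ E T) (sym eq)
             (∈E-mk⁺ {vs (step h j P)} {e₁ ∷ h ∷ es P} (there (here refl))))) (Jn-Inc j)
      ... | inj₁ refl = ⊥-elim (e₁∉ (here refl))
      ... | inj₂ refl with Jn-end j j₂
      ...   | refl = P , Unique-tail uP , Unique-∷⁻ uP , eq

    decompose↓ : ∀ {D} → IsCircle {↓.graph} D → D ⊑ ↓ B → eᵥ ∈ E D →
                 Σ[ P ∈ W t s ] Σ[ uP ∈ Unique (vs P) ] Σ[ v∉ ∈ v ∉ˡ vs P ] (D ≡ through↓ P uP v∉ × (∀ {g} → g ∈ˡ es P → g ∈ E B))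
    decompose↓ {D} circD D⊑ eᵥ∈ with ↓.circle-closed {D} {eᵥ} {t} {s} circD eᵥ∈ (inj₁ refl)
    ... | P , uP , eᵥ∉ , refl with lower P eᵥ∉
    ...   | Q , refl = Q , subst Unique (vs-lift Q) uP ,
            (λ v∈ → proj₂ (∈-⁻ {p = V B} (proj₁ D⊑ (↓.∈V-mk⁺ {↓.vs (lift Q)} {eᵥ ∷ ↓.es (lift Q)} (subst (v ∈ˡ_) (sym (vs-lift Q)) v∈)))) refl) ,
            refl , λ g∈ → proj₁ (↓E⁻ {B} (proj₂ D⊑ (↓.∈E-mk⁺ {↓.vs (lift Q)} {eᵥ ∷ ↓.es (lift Q)} (there (∈-lift⁺ Q g∈)))))

    ↓-circle : ∀ {D} → IsCircle {graph} D → D ⊑ B → v ∈ V D →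
               IsCircle {↓.graph} (↓ D) × signOf S D ≡ signOf S↓ (↓ D)
    ↓-circle {D} circD D⊑B v∈ with decompose {D} circD D⊑B v∈
    ... | P , uP , v∉ , refl = subst (IsCircle {↓.graph}) (sym (↓-through P uP v∉)) (through↓-circle P uP v∉) ,
            trans (through-sign P uP v∉) (cong (signOf S↓) (sym (↓-through P uP v∉)))

    ↓-unique : ∀ {C} → (∀ D → PositiveCircle S D → v ∈ V D → D ≡ C) → UniqueThrough S↓ (↓ B) (↓ C) eᵥ
    ↓-unique {C} uniq D (circD , sgnD) D⊑ eᵥ∈ with decompose↓ {D} circD D⊑ eᵥ∈
    ... | P , uP , v∉ , refl , _ = trans (sym (↓-through P uP v∉))
          (cong ↓ (uniq (through P uP v∉) (through-circle P uP v∉ , trans (through-sign P uP v∉) sgnD) (v∈through P uP v∉)))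

    ↓-⊑ : ∀ {H} → H ⊑ B → ↓ H ⊑ ↓ B
    ↓-⊑ {H} (f , g) = (λ u∈ → let q , n = ∈-⁻ {p = V H} u∈ in x∈p∧x≢y⇒x∈p-y (f q) n) , λ {x} → edge⊆ x
      where
      edge⊆ : ∀ x → x ∈ E (↓ H) → x ∈ E (↓ B)
      edge⊆ zero _ = here
      edge⊆ (suc x) x∈ = let q , n₁ , n₂ = ↓E⁻ {H} x∈ in ↓E⁺ {B} (g q) n₁ n₂

    ↓-reflect : ∀ {C} → IsCircle {graph} C → C ⊑ B → v ∈ V C → ↓ B ≡ ↓ C → B ≡ C
    ↓-reflect {C} circC C⊑B v∈ eq = Sub-ext ((λ {u} → inV u) , (λ {g} → inE g)) C⊑B
      where
      inV : ∀ u → u ∈ V B → u ∈ V C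
      inV u u∈ with u ≟ v
      ... | yes refl = v∈
      ... | no n = proj₁ (∈-⁻ {p = V C} (subst (λ T → u ∈ V T) eq (x∈p∧x≢y⇒x∈p-y {p = V B} u∈ n)))
      inE : ∀ g → g ∈ E B → g ∈ E C
      inE g g∈ with g ≟ e₁ | g ≟ e₂
      ... | yes refl | _ = proj₁ (circle-e₁e₂ {C} circC C⊑B v∈)
      ... | no _ | yes refl = proj₂ (circle-e₁e₂ {C} circC C⊑B v∈)
      ... | no n₁ | no n₂ = proj₁ (↓E⁻ {C} (subst (λ T → suc g ∈ E T) eq (↓E⁺ {B} g∈ n₁ n₂)))

    -- A colouring of `B↓v` is pulled back along `image`, which sends `e₁` and `e₂` to `eᵥ`. In the
    -- pullback `v` sees only one colour, so the vertex where the colours meet survives the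
    -- suppression.
    ↓-tight : Blocks.Tight ↓.graph (↓ B)
    ↓-tight = record { subgraph = sub ; covered = cov ; mixing = mix }
      where
      inV : ∀ {u} → u ∈ V B → u ≢ v → u ∈ V (↓ B)
      inV = x∈p∧x≢y⇒x∈p-y
      end : ∀ {g u} → g ∈ E B → g ≢ e₁ → g ≢ e₂ → Inc g u → u ∈ V (↓ B)
      end g∈ n₁ n₂ i = inV (ends∈ {B} subgraph g∈ i) λ { refl → avoid g∈ n₁ n₂ i }
      sub : IsSubgraph {↓.graph} (↓ B)
      sub zero _ = inV s∈ (v≢s ∘ sym) , inV t∈ (v≢t ∘ sym)
      sub (suc g) g∈ = let q , n₁ , n₂ = ↓E⁻ {B} g∈ in end q n₁ n₂ (inj₁ refl) , end q n₁ n₂ (inj₂ refl)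
      image : Fin #E → Fin (suc #E)
      image g = case (g ≟ e₁) ⊎-dec (g ≟ e₂) of λ { (yes _) → eᵥ ; (no _) → suc g }
      image∈ : ∀ {g} → g ∈ E B → image g ∈ E (↓ B)
      image∈ {g} g∈ with (g ≟ e₁) ⊎-dec (g ≟ e₂)
      ... | yes _ = here
      ... | no n = ↓E⁺ {B} g∈ (n ∘ inj₁) (n ∘ inj₂)
      image-Inc : ∀ {g y} → Inc g y → y ≢ v → ↓.Inc (image g) y
      image-Inc {g} i y≢v with (g ≟ e₁) ⊎-dec (g ≟ e₂)
      ... | no _ = i
      ... | yes (inj₁ refl) = inj₁ ([ (λ { refl → ⊥-elim (y≢v refl) }) , sym ]′ (Jn-only j₁ i))
      ... | yes (inj₂ refl) = inj₂ ([ (λ { refl → ⊥-elim (y≢v refl) }) , sym ]′ (Jn-only j₂ i))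
      cov : ∀ {u} → u ∈ V (↓ B) → ∃[ g ] g ∈ E (↓ B) × ↓.Inc g u
      cov {u} u∈ with ∈-⁻ {p = V B} u∈
      ... | q , u≢v with covered q
      ...   | g , g∈ , i = image g , image∈ g∈ , image-Inc i u≢v
      image-e₁ : image e₁ ≡ eᵥ
      image-e₁ with (e₁ ≟ e₁) ⊎-dec (e₁ ≟ e₂)
      ... | yes _ = refl
      ... | no n = ⊥-elim (n (inj₁ refl))
      image-e₂ : image e₂ ≡ eᵥ
      image-e₂ with (e₂ ≟ e₁) ⊎-dec (e₂ ≟ e₂)
      ... | yes _ = refl
      ... | no n = ⊥-elim (n (inj₂ refl))
      image-suc : ∀ {g} → g ≢ e₁ → g ≢ e₂ → image g ≡ suc g
      image-suc {g} n₁ n₂ with (g ≟ e₁) ⊎-dec (g ≟ e₂)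
      ... | yes p = ⊥-elim ([ n₁ , n₂ ]′ p)
      ... | no _ = refl
      preimage : ∀ {g} → g ∈ E (↓ B) → ∃[ h ] h ∈ E B × image h ≡ g
      preimage {zero} _ = e₁ , proj₁ e₁-at , image-e₁
      preimage {suc g} g∈ = let q , n₁ , n₂ = ↓E⁻ {B} g∈ in g , q , image-suc n₁ n₂
      mix : ↓.Mixing (↓ B)
      mix x X {g} {h} g∈ gX h∈ hX with preimage {g} g∈ | preimage {h} h∈
      ... | g′ , g′∈ , eg | h′ , h′∈ , eh = finish
            (mixing x ⟦ X? ⟧ g′∈ (∈⟦⟧⁺ X? (subst (_∈ X) (sym eg) gX)) h′∈ (λ q → hX (subst (_∈ X) eh (∈⟦⟧⁻ X? q))))
        where
        X? : ∀ f → Dec (image f ∈ X)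
        X? f = image f ∈? X
        atV : ∀ {f} → f ∈ E B → Inc f v → image f ≡ eᵥ
        atV f∈ i with onlyTwo f∈ i
        ... | inj₁ refl = image-e₁
        ... | inj₂ refl = image-e₂
        finish : (∃[ y ] y ≢ x × Mixed B ⟦ X? ⟧ y) → ∃[ y ] y ≢ x × ↓.Mixed (↓ B) X y
        finish (y , y≢x , (f , (f∈ , fX) , i) , (k , (k∈ , kX) , i′)) with y ≟ v
        ... | yes refl = ⊥-elim (kX (∈⟦⟧⁺ X? (subst (_∈ X) (trans (atV f∈ i) (sym (atV k∈ i′))) (∈⟦⟧⁻ X? fX))))
        ... | no y≢v = y , y≢x , (image f , (image∈ f∈ , ∈⟦⟧⁻ X? fX) , image-Inc i y≢v) ,
              (image k , (image∈ k∈ , kX ∘ ∈⟦⟧⁺ X?) , image-Inc i′ y≢v)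

    balancing : ∀ ζ → (∀ {g} → g ∈ E B → g ≢ e₁ → g ≢ e₂ → Good ζ g) → ζ s · (σ e₁ · σ e₂) · ζ t ≡ ⊖ →
                IsBalancingEdge S↓ (↓ B) eᵥ
    balancing ζ good neg = here , ζ , λ { zero _ → mk⇔ (λ _ → refl) (λ _ → neg)
        ; (suc g) g∈ → let q , n₁ , n₂ = ↓E⁻ {B} g∈ in
            mk⇔ (λ p → case trans (sym (good q n₁ n₂)) p of λ ()) (λ ()) }

    balancing⇒negative : IsBalancingEdge S↓ (↓ B) eᵥ → ∀ {D} → IsCircle {graph} D → D ⊑ B → v ∈ V D → signOf S D ≡ ⊖
    balancing⇒negative (_ , ζ , f) {D} circD D⊑B v∈ with ↓-circle {D} circD D⊑B v∈
    ... | circ↓ , eq = trans eq (trans (↓.signOf-circle {ζ} {↓ D} {eᵥ} circ↓ here good) (Equivalence.from (f eᵥ here) refl))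
      where
      plus : ∀ {s} → s ≢ ⊖ → s ≡ ⊕
      plus {⊕} _ = refl
      plus {⊖} n = ⊥-elim (n refl)
      good : ∀ {g} → g ∈ E (↓ D) → g ≢ eᵥ → ↓.Good ζ g
      good {g} g∈ n = plus λ p → n (Equivalence.to (f g (proj₂ (↓-⊑ {D} D⊑B) g∈)) p)


-- Blocks without a positive circle through a vertex of degree 2

module Balance (S : SignedGraph) {B : Sub (SignedGraph.graph S)} {v : Fin (SignedGraph.#V S)}
  (tight : Blocks.Tight (SignedGraph.graph S) B) (two : deg {(SignedGraph.graph S)} B v ≡ 2)
  (noPos : ∀ D → PositiveCircle S D → D ⊑ B → v ∈ V D → Absurd) where
  open SignedGraph S
  open Signed S
  open Suppress S B v two using (e₁; e₂; eᵥ; S↓; ↓)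
  private
    module Sup = Suppression S {B} {v} tight two
    module Rg = Rings graph
  open Sup using (s; t; j₁; j₂; e₁-at; e₂-at; e₁≢e₂; onlyTwo; v≢s; v≢t; s∈; t∈; avoid)
  open Tight tight

  private
    Inner : Fin #E → Set
    Inner g = g ∈ E B × ¬ Inc g v

    sign-eᵥ : (Fin #V → Sign) → Sign
    sign-eᵥ ζ = ζ s · (σ e₁ · σ e₂) · ζ t

  abstract
    -- The value `σ e₂ · ζ t` at `v` makes `e₂` positive and gives `e₁` the sign of `eᵥ`. If that
    -- were positive, `e₁` would close up with `e₂` and `U` to a positive circle through `v`.
    viaV : ∀ {U ζ} → (∀ {g} → U g → Inner g × Good ζ g) → Connects U t s → sign-eᵥ ζ ≢ ⊕
    viaV {U} {ζ} f con eq with circleThrough {U⁺} {ξ} {e₁} good ¬U (Jn-sym j₁) (edge {e = e₂} (inj₂ refl) j₂ ◅◅ Connects-mono inj₁ con)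
      where
      U⁺ : Fin #E → Set
      U⁺ g = U g ⊎ g ≡ e₂
      ξ : Fin #V → Sign
      ξ = ζ [ v ≔ σ e₂ · ζ t ]
      good : ∀ {g} → U⁺ g → Good ξ g
      good (inj₁ u) = trans (switch-cong {ξ} {ζ} λ i → ≔-other ζ _ λ { refl → proj₂ (proj₁ (f u)) i }) (proj₂ (f u))
      good (inj₂ refl) = trans (switch-Jn ξ j₂) (trans (cong₂ (λ a b → a · σ e₂ · b) (≔-same ζ v _) (≔-other ζ _ (v≢t ∘ sym)))
        (lem (σ e₂) (ζ t)))
        where
        lem : ∀ a b → a · b · a · b ≡ ⊕
        lem = from-yes (∀ˢ λ a → ∀ˢ λ b → a · b · a · b ≟ˢ ⊕)
      ¬U : ¬ U⁺ e₁
      ¬U (inj₁ u) = proj₂ (proj₁ (f u)) (proj₂ e₁-at)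
      ¬U (inj₂ eq) = e₁≢e₂ eq
    ... | D , circD , sgnD , e₁∈ , edgesD = noPos D (circD , trans sgnD (trans (switch-Jn (ζ [ v ≔ σ e₂ · ζ t ]) j₁)
          (trans (cong₂ (λ a b → a · σ e₁ · b) (≔-same ζ v _) (≔-other ζ _ (v≢s ∘ sym)))
            (trans (lem (σ e₂) (ζ t) (σ e₁) (ζ s)) eq))))
          (circle-⊑ {D} {B} circD subgraph λ g∈ → [ (λ { refl → proj₁ e₁-at }) , [ (λ u → proj₁ (proj₁ (f u))) , (λ { refl → proj₁ e₂-at }) ]′ ]′ (edgesD g∈))
          (ends∈ {D} (proj₁ (proj₁ circD)) e₁∈ (proj₂ e₁-at))
      where
      lem : ∀ a b c d → a · b · c · d ≡ d · (c · a) · b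
      lem = from-yes (∀ˢ λ a → ∀ˢ λ b → ∀ˢ λ c → ∀ˢ λ d → a · b · c · d ≟ˢ d · (c · a) · b)

  -- A partial st-numbering r of B - v: every numbered vertex other than s and
  -- t has a lower and a higher neighbour.  The edges to the chosen lower
  -- neighbours are positive for ζ, and eᵥ is negative.
  record Numbering : Set where
    field
      F : Subset #V
      r : Fin #V → ℕ
      ζ : Fin #V → Sign
      s∈F : s ∈ F
      t∈F : t ∈ F
      F⊆  : ∀ {u} → u ∈ F → u ∈ V B
      v∉F : v ∉ F
      r-injective : ∀ {u w} → u ∈ F → w ∈ F → r u ≡ r w → u ≡ w
      lower  : ∀ {u} → u ∈ F → u ≢ s → u ≢ t → ∃₂ λ g w → g ∈ E B × Jn g u w × w ∈ F × r w < r u × Good ζ g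
      higher : ∀ {u} → u ∈ F → u ≢ s → u ≢ t → ∃₂ λ g w → g ∈ E B × Jn g u w × w ∈ F × r u < r w
      least    : ∀ {u} → u ∈ F → r s ≤ r u
      greatest : ∀ {u} → u ∈ F → r u ≤ r t
      neg-eᵥ : sign-eᵥ ζ ≡ ⊖

  initial : s ≢ t → Numbering
  initial s≢t = record
    { F = ⁅ s ⁆ ∪ ⁅ t ⁆ ; r = r ; ζ = ζ ; s∈F = ends⁺ (inj₁ refl) ; t∈F = ends⁺ (inj₂ refl)
    ; F⊆ = λ u∈ → [ (λ { refl → s∈ }) , (λ { refl → t∈ }) ]′ (ends⁻ u∈)
    ; v∉F = λ v∈ → [ v≢s , v≢t ]′ (ends⁻ v∈)
    ; r-injective = λ u∈ w∈ → inj (ends⁻ u∈) (ends⁻ w∈)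
    ; lower = λ u∈ n₁ n₂ → ⊥-elim ([ n₁ , n₂ ]′ (ends⁻ u∈))
    ; higher = λ u∈ n₁ n₂ → ⊥-elim ([ n₁ , n₂ ]′ (ends⁻ u∈))
    ; least = λ _ → ≤-trans (≤-reflexive r-s) z≤n
    ; greatest = λ {u} _ → ≤-trans (r≤1 u) (≤-reflexive (sym r-t))
    ; neg-eᵥ = trans (cong₂ (λ a b → a · (σ e₁ · σ e₂) · b) (≔-other (λ _ → ⊕) _ s≢t) (≔-same (λ _ → ⊕) t _)) (lem (σ e₁ · σ e₂)) }
    where
    ζ : Fin #V → Sign
    -- The value at `t` is the one that makes `eᵥ` negative.
    ζ = (λ _ → ⊕) [ t ≔ opp (σ e₁ · σ e₂) ]
    r : Fin #V → ℕ
    r u = if does (u ≟ s) then 0 else 1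
    r-s : r s ≡ 0
    r-s rewrite dec-true (s ≟ s) refl = refl
    r-t : r t ≡ 1
    r-t rewrite dec-false (t ≟ s) (s≢t ∘ sym) = refl
    r≤1 : ∀ u → r u ≤ 1
    r≤1 u with does (u ≟ s)
    ... | true = z≤n
    ... | false = ≤-refl
    inj : ∀ {u w} → u ≡ s ⊎ u ≡ t → w ≡ s ⊎ w ≡ t → r u ≡ r w → u ≡ w
    inj (inj₁ refl) (inj₁ refl) _ = refl
    inj (inj₂ refl) (inj₂ refl) _ = refl
    inj (inj₁ refl) (inj₂ refl) eq with trans (sym r-s) (trans eq r-t)
    ... | ()
    inj (inj₂ refl) (inj₁ refl) eq with trans (sym r-t) (trans eq r-s)
    ... | ()
    lem : ∀ a → a · opp a ≡ ⊖
    lem = from-yes (∀ˢ λ a → a · opp a ≟ˢ ⊖)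

  module Insert (N : Numbering) where
    open Numbering N

    Outside : Fin #E → Set
    Outside g = g ∈ E B × (∀ {u} → Inc g u → u ∉ F)

    module _ {x₁ x₂ p q g₁ g₂} (x₁∈ : x₁ ∈ F) (x₂∈ : x₂ ∈ F) (x₁<x₂ : r x₁ < r x₂)
      (g₁∈ : g₁ ∈ E B) (g₂∈ : g₂ ∈ E B) (k₁ : Jn g₁ x₁ p) (k₂ : Jn g₂ q x₂) (p∉ : p ∉ F) (p≢v : p ≢ v)
      (P : W p q) (uP : Unique (vs P)) (outP : ∀ {g} → g ∈ˡ es P → Outside g) where

      private
        m : ℕ
        m = Rg.len P

        -- The path never passes through `v`, because the neighbours `s` and `t` of `v` belong to
        -- `F`.
        onP : ∀ {u} → u ∈ˡ vs P → u ∈ V B × u ∉ F × u ≢ v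
        onP u∈ = Connects-invariant (λ u → u ∈ V B × u ∉ F × u ≢ v) move (walk-Connects P outP u∈)
          (ends∈ {B} subgraph g₁∈ (Jn-Incʳ k₁) , p∉ , p≢v)
          where
          move : ∀ {e x y} → Outside e → Jn e x y → x ∈ V B × x ∉ F × x ≢ v → y ∈ V B × y ∉ F × y ≢ v
          move (e∈ , out) j (_ , x∉ , _) = ends∈ {B} subgraph e∈ (Jn-Incʳ j) , out (Jn-Incʳ j) ,
            λ { refl → [ (λ { refl → nbr j₁ s∈F }) , (λ { refl → nbr j₂ t∈F }) ]′ (onlyTwo e∈ (Jn-Incʳ j)) }
            where
            nbr : ∀ {z} → Jn _ v z → z ∉ F
            nbr k z∈ = out (Jn-Incʳ k) z∈

        κ : Fin #V → Sign
        κ = proj₁ (walkPotential P uP)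

        κ-good : ∀ {g} → g ∈ˡ es P → Good κ g
        κ-good = proj₂ (walkPotential P uP)

        -- This factor makes `g₁` positive. The sign of `g₂` stays arbitrary, as `g₂` only provides
        -- a higher neighbour.
        c₀ : Sign
        c₀ = ζ x₁ · σ g₁ · κ p

        ζ′ : Fin #V → Sign
        ζ′ u = pick (u ∈? F) (ζ u) (c₀ · κ u)

        -- `P` has `suc m` vertices: the numbers above `r x₁` move up by `suc m`, and the path fills
        -- the gap in the order of traversal. As `r x₁ < r x₂`, the numbers increase along the whole
        -- ear.
        shift′ : ∀ {u} → Dec (u ∈ F) → Dec (r u ≤ r x₁) → ℕ
        shift′ {u} (yes _) (yes _) = r u
        shift′ {u} (yes _) (no _)  = r u + suc m
        shift′ {u} (no _)  _       = r x₁ + suc (Rg.idx P u)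

        r′ : Fin #V → ℕ
        r′ u = shift′ (u ∈? F) (r u ≤?ⁿ r x₁)

        r-low : ∀ {u} → u ∈ F → r u ≤ r x₁ → r′ u ≡ r u
        r-low {u} u∈ l with u ∈? F | r u ≤?ⁿ r x₁
        ... | yes _ | yes _ = refl
        ... | yes _ | no n  = ⊥-elim (n l)
        ... | no n  | _     = ⊥-elim (n u∈)

        r-high : ∀ {u} → u ∈ F → r x₁ < r u → r′ u ≡ r u + suc m
        r-high {u} u∈ l with u ∈? F | r u ≤?ⁿ r x₁
        ... | yes _ | yes n = ⊥-elim (<⇒≱ l n)
        ... | yes _ | no _  = refl
        ... | no n  | _     = ⊥-elim (n u∈)

        r-new : ∀ {u} → u ∉ F → r′ u ≡ r x₁ + suc (Rg.idx P u)
        r-new {u} u∉ with u ∈? F | r u ≤?ⁿ r x₁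
        ... | yes q | _ = ⊥-elim (u∉ q)
        ... | no _  | _ = refl

        split : ∀ u → r u ≤ r x₁ ⊎ r x₁ < r u
        split u with r u ≤?ⁿ r x₁
        ... | yes l = inj₁ l
        ... | no l  = inj₂ (≰⇒> l)

        r-mono : ∀ {u w} → u ∈ F → w ∈ F → r u < r w → r′ u < r′ w
        r-mono {u} {w} u∈ w∈ l with split u | split w
        ... | inj₁ a | inj₁ b rewrite r-low u∈ a | r-low w∈ b = l
        ... | inj₁ a | inj₂ b rewrite r-low u∈ a | r-high w∈ b = <-≤-trans l (m≤m+n _ _)
        ... | inj₂ a | inj₁ b = ⊥-elim (<⇒≱ (<-trans a l) b)
        ... | inj₂ a | inj₂ b rewrite r-high u∈ a | r-high w∈ b = +-monoˡ-< (suc m) l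

        F′? : ∀ u → Dec (u ∈ F ⊎ u ∈ˡ vs P)
        F′? u = (u ∈? F) ⊎-dec (u ∈ᵛ? vs P)

        F′ : Subset #V
        F′ = ⟦ F′? ⟧

        old : ∀ {u} → u ∈ F → u ∈ F′
        old = ∈⟦⟧⁺ F′? ∘ inj₁
        new : ∀ {u} → u ∈ˡ vs P → u ∈ F′
        new = ∈⟦⟧⁺ F′? ∘ inj₂

        new> : ∀ {u} → u ∈ˡ vs P → r x₁ < r′ u
        new> {u} u∈ rewrite r-new (proj₁ (proj₂ (onP u∈))) = ≤-trans (≤-reflexive (+-comm 1 (r x₁))) (+-monoʳ-≤ (r x₁) (s≤s z≤n))

        new≤ : ∀ {u} → u ∈ˡ vs P → r′ u ≤ r x₁ + suc m
        new≤ {u} u∈ rewrite r-new (proj₁ (proj₂ (onP u∈))) = +-monoʳ-≤ (r x₁) (s≤s (proj₂ (Rg.at-idx P u∈)))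

        new-old : ∀ {u w} → u ∈ F → w ∈ˡ vs P → r′ u ≢ r′ w
        new-old {u} {w} u∈ w∈ eq with split u
        ... | inj₁ a = <⇒≱ (new> w∈) (≤-trans (≤-reflexive (trans (sym eq) (r-low u∈ a))) a)
        ... | inj₂ a = <⇒≱ (+-monoˡ-< (suc m) a) (≤-trans (≤-reflexive (trans (sym (r-high u∈ a)) eq)) (new≤ w∈))

        inj : ∀ {u w} → u ∈ F ⊎ u ∈ˡ vs P → w ∈ F ⊎ w ∈ˡ vs P → r′ u ≡ r′ w → u ≡ w
        inj {u} {w} (inj₁ u∈) (inj₁ w∈) eq with <-cmpⁿ (r u) (r w)
        ... | tri< l _ _ = ⊥-elim (<⇒≢ (r-mono u∈ w∈ l) eq)
        ... | tri≈ _ e _ = r-injective u∈ w∈ e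
        ... | tri> _ _ l = ⊥-elim (<⇒≢ (r-mono w∈ u∈ l) (sym eq))
        inj (inj₁ u∈) (inj₂ w∈) eq = ⊥-elim (new-old u∈ w∈ eq)
        inj (inj₂ u∈) (inj₁ w∈) eq = ⊥-elim (new-old w∈ u∈ (sym eq))
        inj {u} {w} (inj₂ u∈) (inj₂ w∈) eq = trans (sym (proj₁ (Rg.at-idx P u∈))) (trans (cong (Rg.at P)
          (suc-injective (+-cancelˡ-≡ (r x₁) _ _ (trans (sym (r-new (proj₁ (proj₂ (onP u∈))))) (trans eq (r-new (proj₁ (proj₂ (onP w∈)))))))))
          (proj₁ (Rg.at-idx P w∈)))

        ζ′-old : ∀ {u} → u ∈ F → ζ′ u ≡ ζ u
        ζ′-old {u} = pick-yes (u ∈? F)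
        ζ′-new : ∀ {u} → u ∉ F → ζ′ u ≡ c₀ · κ u
        ζ′-new {u} = pick-no (u ∈? F)

        good-g₁ : Good ζ′ g₁
        good-g₁ = trans (switch-Jn ζ′ k₁) (trans (cong₂ (λ a b → a · σ g₁ · b) (ζ′-old x₁∈) (ζ′-new p∉)) (lem (ζ x₁) (σ g₁) (κ p)))
          where
          lem : ∀ a b c → a · b · (a · b · c · c) ≡ ⊕
          lem = from-yes (∀ˢ λ a → ∀ˢ λ b → ∀ˢ λ c → a · b · (a · b · c · c) ≟ˢ ⊕)

        good-P : ∀ {g} → g ∈ˡ es P → Good ζ′ g
        good-P {g} g∈ = trans (switch-cong {ζ′} {λ u → c₀ · κ u} λ i → ζ′-new (proj₂ (outP g∈) i)) (trans (switch-scale c₀ κ g) (κ-good g∈))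

        r-at : ∀ {i} → i ≤ m → r′ (Rg.at P i) ≡ r x₁ + suc i
        r-at {i} i≤ = trans (r-new (proj₁ (proj₂ (onP (Rg.at∈ P i))))) (cong (λ k → r x₁ + suc k) (Rg.idx-at P uP i≤))

        newLower : ∀ i → i ≤ m → ∃₂ λ g w → g ∈ E B × Jn g (Rg.at P i) w × w ∈ F′ × r′ w < r′ (Rg.at P i) × Good ζ′ g
        newLower zero i≤ = g₁ , x₁ , g₁∈ , subst (λ z → Jn g₁ z x₁) (sym (Rg.at-zero P)) (Jn-sym k₁) , old x₁∈ ,
          ≤-trans (s≤s (≤-reflexive (r-low x₁∈ ≤-refl))) (new> (Rg.at∈ P 0)) , good-g₁
        newLower (suc i) i< = Rg.ed g₁ P i , Rg.at P i , proj₁ (outP (Rg.ed∈ g₁ P i<)) , Jn-sym (Rg.ed-Jn g₁ P i<) , new (Rg.at∈ P i) ,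
          subst₂ _<_ (sym (r-at (<⇒≤ i<))) (sym (r-at i<)) (+-monoʳ-< (r x₁) (n<1+n (suc i))) , good-P (Rg.ed∈ g₁ P i<)

        newHigher : ∀ i → i ≤ m → ∃₂ λ g w → g ∈ E B × Jn g (Rg.at P i) w × w ∈ F′ × r′ (Rg.at P i) < r′ w
        newHigher i i≤ with m≤n⇒m<n∨m≡n i≤
        ... | inj₁ i< = Rg.ed g₁ P i , Rg.at P (suc i) , proj₁ (outP (Rg.ed∈ g₁ P i<)) , Rg.ed-Jn g₁ P i< , new (Rg.at∈ P (suc i)) ,
              subst₂ _<_ (sym (r-at (<⇒≤ i<))) (sym (r-at i<)) (+-monoʳ-< (r x₁) (n<1+n (suc i)))
        ... | inj₂ refl = g₂ , x₂ , g₂∈ , subst (λ z → Jn g₂ z x₂) (sym (Rg.at-len P)) k₂ , old x₂∈ ,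
              subst₂ _<_ (sym (r-at ≤-refl)) (sym (r-high x₂∈ x₁<x₂)) (+-monoˡ-< (suc m) x₁<x₂)

        s-low : r s ≤ r x₁
        s-low = least x₁∈
        t-high : r x₁ < r t
        t-high = <-≤-trans x₁<x₂ (greatest x₂∈)

      insert : Σ[ N′ ∈ Numbering ] ∣ F ∣ < ∣ Numbering.F N′ ∣
      insert = record
        { F = F′ ; r = r′ ; ζ = ζ′ ; s∈F = old s∈F ; t∈F = old t∈F
        ; F⊆ = λ u∈ → [ F⊆ , (λ q → proj₁ (onP q)) ]′ (∈⟦⟧⁻ F′? u∈)
        ; v∉F = λ v∈ → [ v∉F , (λ q → proj₂ (proj₂ (onP q)) refl) ]′ (∈⟦⟧⁻ F′? v∈)
        ; r-injective = λ u∈ w∈ → inj (∈⟦⟧⁻ F′? u∈) (∈⟦⟧⁻ F′? w∈)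
        ; lower = λ u∈ n₁ n₂ → low (∈⟦⟧⁻ F′? u∈) n₁ n₂
        ; higher = λ u∈ n₁ n₂ → high (∈⟦⟧⁻ F′? u∈) n₁ n₂
        ; least = λ u∈ → ≤-trans (≤-reflexive (r-low s∈F s-low)) (lst (∈⟦⟧⁻ F′? u∈))
        ; greatest = λ u∈ → ≤-trans (grt (∈⟦⟧⁻ F′? u∈)) (≤-reflexive (sym (r-high t∈F t-high)))
        ; neg-eᵥ = trans (cong₂ (λ a b → a · (σ e₁ · σ e₂) · b) (ζ′-old s∈F) (ζ′-old t∈F)) neg-eᵥ
        } , p⊂q⇒∣p∣<∣q∣ {p = F} {q = F′} (old , p , new (source∈ P) , p∉)
        where
        low : ∀ {u} → u ∈ F ⊎ u ∈ˡ vs P → u ≢ s → u ≢ t → ∃₂ λ g w → g ∈ E B × Jn g u w × w ∈ F′ × r′ w < r′ u × Good ζ′ g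
        low (inj₁ u∈) n₁ n₂ with lower u∈ n₁ n₂
        ... | g , w , g∈ , j , w∈ , l , gd = g , w , g∈ , j , old w∈ , r-mono w∈ u∈ l ,
              trans (switch-cong {ζ′} {ζ} λ i → [ (λ { refl → ζ′-old u∈ }) , (λ { refl → ζ′-old w∈ }) ]′ (Jn-only j i)) gd
        low {u} (inj₂ u∈) _ _ with Rg.at-idx P u∈
        ... | eq , l = subst (λ z → ∃₂ λ g w → g ∈ E B × Jn g z w × w ∈ F′ × r′ w < r′ z × Good ζ′ g) eq (newLower (Rg.idx P u) l)
        high : ∀ {u} → u ∈ F ⊎ u ∈ˡ vs P → u ≢ s → u ≢ t → ∃₂ λ g w → g ∈ E B × Jn g u w × w ∈ F′ × r′ u < r′ w
        high (inj₁ u∈) n₁ n₂ with higher u∈ n₁ n₂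
        ... | g , w , g∈ , j , w∈ , l = g , w , g∈ , j , old w∈ , r-mono u∈ w∈ l
        high {u} (inj₂ u∈) _ _ with Rg.at-idx P u∈
        ... | eq , l = subst (λ z → ∃₂ λ g w → g ∈ E B × Jn g z w × w ∈ F′ × r′ z < r′ w) eq (newHigher (Rg.idx P u) l)
        lst : ∀ {u} → u ∈ F ⊎ u ∈ˡ vs P → r s ≤ r′ u
        lst {u} (inj₁ u∈) with split u
        ... | inj₁ a rewrite r-low u∈ a = least u∈
        ... | inj₂ a rewrite r-high u∈ a = ≤-trans (least u∈) (m≤m+n _ _)
        lst (inj₂ u∈) = ≤-trans s-low (<⇒≤ (new> u∈))
        grt : ∀ {u} → u ∈ F ⊎ u ∈ˡ vs P → r′ u ≤ r t + suc m
        grt {u} (inj₁ u∈) with split u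
        ... | inj₁ a rewrite r-low u∈ a = ≤-trans (greatest u∈) (m≤m+n _ _)
        ... | inj₂ a rewrite r-high u∈ a = +-monoˡ-≤ (suc m) (greatest u∈)
        grt (inj₂ u∈) = ≤-trans (new≤ u∈) (+-monoˡ-≤ (suc m) (<⇒≤ t-high))

  Complete : Numbering → Set
  Complete N = ∀ {u} → u ∈ V B → u ≢ v → u ∈ Numbering.F N

  module Grow (s≢t : s ≢ t) (N : Numbering) where
    open Numbering N
    open Insert N

    Outside? : ∀ g → Dec (Outside g)
    Outside? g = map′ (λ (a , b , c) → a , λ { (inj₁ refl) → b ; (inj₂ refl) → c }) (λ (a , f) → a , f (inj₁ refl) , f (inj₂ refl))
      ((g ∈? E B) ×-dec ¬? (proj₁ (ends g) ∈? F) ×-dec ¬? (proj₂ (ends g) ∈? F))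

    Ear : Set
    Ear = Σ[ N′ ∈ Numbering ] ∣ F ∣ < ∣ Numbering.F N′ ∣

    ear : ∀ {x₁ x₂ p q g₁ g₂} → x₁ ∈ F → x₂ ∈ F → x₁ ≢ x₂ → g₁ ∈ E B → g₂ ∈ E B → Jn g₁ x₁ p → Jn g₂ q x₂ →
          p ∉ F → p ≢ v → q ∉ F → q ≢ v → Connects Outside p q → Ear
    ear {x₁} {x₂} x₁∈ x₂∈ x₁≢x₂ g₁∈ g₂∈ k₁ k₂ p∉ p≢v q∉ q≢v con with <-cmpⁿ (r x₁) (r x₂)
    ... | tri≈ _ eq _ = ⊥-elim (x₁≢x₂ (r-injective x₁∈ x₂∈ eq))
    ... | tri< l _ _ = let P , uP , out = simpleWalk con in
          insert x₁∈ x₂∈ l g₁∈ g₂∈ k₁ k₂ p∉ p≢v P uP out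
    ... | tri> _ _ l = let P , uP , out = simpleWalk (Connects-sym con) in
          insert x₂∈ x₁∈ l g₂∈ g₁∈ (Jn-sym k₂) (Jn-sym k₁) q∉ q≢v P uP out

    staysOff : ∀ {p u} → Connects Outside p u → p ∉ F × p ≢ v → u ∉ F × u ≢ v
    staysOff = Connects-invariant (λ u → u ∉ F × u ≢ v) λ (e∈ , out) j _ → out (Jn-Incʳ j) ,
      λ { refl → [ (λ { refl → out (Jn-Incʳ j₁) s∈F }) , (λ { refl → out (Jn-Incʳ j₂) t∈F }) ]′ (onlyTwo e∈ (Jn-Incʳ j)) }

    -- Let `R` be the part of `B` reached from `p` off `F`. If all edges from `R` to `F` ended in
    -- `x₁`, this vertex would separate `R` from `s` or from `t`, whichever differs from `x₁`. So
    -- another edge returns to `F` and completes an ear.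
    leave : ∀ {x₁ p g₁} → x₁ ∈ F → g₁ ∈ E B → Jn g₁ x₁ p → p ∉ F → p ≢ v → Ear
    leave {x₁} {p} {g₁} x₁∈ g₁∈ k₁ p∉ p≢v with reachableSet (Linked? {Outside} Outside?) p
    ... | R , (p∈R , sound) , cl with any? (λ g → any? λ q → any? λ x → (g ∈? E B) ×-dec (q ∈? R) ×-dec (x ∈? F) ×-dec ¬? (x₁ ≟ x) ×-dec Jn? g q x)
    ... | yes (g , q , x , g∈ , q∈ , x∈ , n , j) = ear x₁∈ x∈ n g₁∈ g∈ k₁ j p∉ p≢v (proj₁ (staysOff (sound q q∈) (p∉ , p≢v))) (proj₂ (staysOff (sound q q∈) (p∉ , p≢v))) (sound q q∈)
    ... | no none = ⊥-elim (contra (x₁ ≟ s))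
      where
      R∉F : ∀ {u} → u ∈ R → u ∉ F
      R∉F u∈ = Connects-invariant (_∉ F) (λ (_ , out) j _ → out (Jn-Incʳ j)) (sound _ u∈) p∉
      closedR : ∀ {u z g} → u ∈ R → g ∈ E B → ¬ Inc g x₁ → Jn g u z → z ∈ R
      closedR {u} {z} {g} u∈ g∈ n j with z ∈? F
      ... | yes z∈ = ⊥-elim (none (g , u , z , g∈ , u∈ , z∈ , (λ { refl → n (Jn-Incʳ j) }) , j))
      ... | no z∉ = cl u∈ (g , (g∈ , λ i → [ (λ { refl → R∉F u∈ }) , (λ { refl → z∉ }) ]′ (Jn-only j i)) , j)
      x₁∉R : x₁ ∉ R
      x₁∉R x∈ = R∉F x∈ x₁∈
      contra : Dec (x₁ ≡ s) → Absurd
      contra (yes refl) = closed-impossible {S = R} tight x₁∉R closedR (ends∈ {B} subgraph g₁∈ (Jn-Incʳ k₁)) p∈R t∈ (s≢t ∘ sym) (λ q → R∉F q t∈F)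
      contra (no n) = closed-impossible {S = R} tight x₁∉R closedR (ends∈ {B} subgraph g₁∈ (Jn-Incʳ k₁)) p∈R s∈ (n ∘ sym) (λ q → R∉F q s∈F)

    grow : Complete N ⊎ Ear
    grow with any? (λ g → any? λ x → any? λ p → (g ∈? E B) ×-dec (x ∈? F) ×-dec ¬? (p ∈? F) ×-dec ¬? (p ≟ v) ×-dec Jn? g x p)
    ... | yes (g , x , p , g∈ , x∈ , p∉ , p≢v , j) = inj₂ (leave x∈ g∈ j p∉ p≢v)
    ... | no none = inj₁ λ {u} u∈ u≢v → Connects-invariant (_∈ F)
            (λ {e} {x} {y} (e∈ , n) j x∈ → decidable-stable (y ∈? F) λ y∉ → none (e , x , y , e∈ , x∈ , y∉ , (λ { refl → n (Jn-Incʳ j) }) , j))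
            (remove-connected {B} tight s∈ (v≢s ∘ sym) u∈ u≢v) s∈F

  abstract
    completeNumbering : s ≢ t → ∃ Complete
    completeNumbering s≢t = saturate (λ N → ∣ Numbering.F N ∣) #V (λ N → ∣p∣≤n (Numbering.F N)) (Grow.grow s≢t) (initial s≢t)

  module AllPositive (N : Numbering) where
    open Numbering N

    private
      -- Prepares a downward induction on the upper end `y`, where `k` bounds its distance from the
      -- top: `k ≡ 0` concerns no edge, and `k ≡ suc (r t)` concerns all.
      PositiveAbove : ℕ → Set
      PositiveAbove k = ∀ {g x y} → g ∈ E B → Jn g x y → x ∈ F → y ∈ F → r x < r y → r t < k + r y → Good ζ g

    -- If g = xy with x < y were negative, but every edge with a higher upper
    -- end positive, then reversing ζ from y upwards makes positive a path
    -- that descends from x to s and ascends from y to t.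
    module Step {g x y} (g∈ : g ∈ E B) (j : Jn g x y) (x∈ : x ∈ F) (y∈ : y ∈ F) (x<y : r x < r y)
      (above : ∀ {f a b} → f ∈ E B → Jn f a b → a ∈ F → b ∈ F → r a < r b → r y < r b → Good ζ f)
      (bad : switch S ζ g ≡ ⊖) where

      ξ : Fin #V → Sign
      ξ u = pick (r y ≤?ⁿ r u) (opp (ζ u)) (ζ u)

      ξ-high : ∀ {u} → r y ≤ r u → ξ u ≡ opp (ζ u)
      ξ-high {u} = pick-yes (r y ≤?ⁿ r u)
      ξ-low : ∀ {u} → r u < r y → ξ u ≡ ζ u
      ξ-low {u} l = pick-no (r y ≤?ⁿ r u) (<⇒≱ l)

      U : Fin #E → Set
      U f = Inner f × Good ξ f

      inner : ∀ {f a b} → f ∈ E B → Jn f a b → a ∈ F → b ∈ F → Inner f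
      inner f∈ jf a∈ b∈ = f∈ , λ i → [ (λ { refl → v∉F a∈ }) , (λ { refl → v∉F b∈ }) ]′ (Jn-only jf i)

      down : ∀ k {u} → u ∈ F → r u < r y → r u < k → Connects U u s
      down (suc k) {u} u∈ u<y u<k with u ≟ s
      ... | yes refl = ε
      ... | no u≢s with lower u∈ u≢s (λ { refl → <⇒≱ u<y (greatest y∈) })
      ... | f , w , f∈ , jf , w∈ , w<u , gd = (f , (inner f∈ jf u∈ w∈ , trans (switch-cong {ξ} {ζ}
              (λ i → [ (λ { refl → ξ-low u<y }) , (λ { refl → ξ-low (<-trans w<u u<y) }) ]′ (Jn-only jf i))) gd) , jf)
            ◅ down k w∈ (<-trans w<u u<y) (<-≤-trans w<u (s≤s⁻¹ u<k))

      up : ∀ k {u} → u ∈ F → r y ≤ r u → r t < k + r u → Connects U u t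
      up zero u∈ _ l = ⊥-elim (<⇒≱ l (greatest u∈))
      up (suc k) {u} u∈ y≤u l with u ≟ t
      ... | yes refl = ε
      ... | no u≢t with higher u∈ (λ { refl → <⇒≱ x<y (≤-trans y≤u (least x∈)) }) u≢t
      ... | f , w , f∈ , jf , w∈ , u<w = (f , (inner f∈ jf u∈ w∈ , trans (switch-cong {ξ} {λ z → ⊖ · ζ z}
              (λ i → [ (λ { refl → ξ-high y≤u }) , (λ { refl → ξ-high (≤-trans y≤u (<⇒≤ u<w)) }) ]′ (Jn-only jf i)))
              (trans (switch-scale ⊖ ζ f) (above f∈ jf u∈ w∈ u<w (≤-<-trans y≤u u<w)))) , jf)
            ◅ up k w∈ (≤-trans y≤u (<⇒≤ u<w)) (<-≤-trans l (≤-trans (≤-reflexive (sym (+-suc k (r u)))) (+-monoʳ-≤ k u<w)))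

      g-good : Good ξ g
      g-good = trans (switch-Jn ξ j) (trans (cong₂ (λ a b → a · σ g · b) (ξ-low x<y) (ξ-high ≤-refl))
        (lem (ζ x) (σ g) (ζ y) (trans (sym (switch-Jn ζ j)) bad)))
        where
        lem : ∀ a b c → a · b · c ≡ ⊖ → a · b · opp c ≡ ⊕
        lem = from-yes (∀ˢ λ a → ∀ˢ λ b → ∀ˢ λ c → (a · b · c ≟ˢ ⊖) →-dec (a · b · opp c ≟ˢ ⊕))

      abstract
        absurd : Absurd
        absurd = viaV {U} {ξ} id
          (Connects-sym (up (suc (r t)) y∈ ≤-refl (m≤m+n (suc (r t)) (r y))) ◅◅
           edge {e = g} (inner g∈ j x∈ y∈ , g-good) (Jn-sym j) ◅◅ down (suc (r x)) x∈ x<y ≤-refl)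
          -- Since `y` lies above `s` and not above `t`, the reversal affects `t` but not `s`, and
          -- `eᵥ` becomes positive.
          (trans (cong₂ (λ a b → a · (σ e₁ · σ e₂) · b) (ξ-low (≤-<-trans (least x∈) x<y)) (ξ-high (greatest y∈)))
            (lem (ζ s) (σ e₁ · σ e₂) (ζ t) neg-eᵥ))
          where
          lem : ∀ a b c → a · b · c ≡ ⊖ → a · b · opp c ≡ ⊕
          lem = from-yes (∀ˢ λ a → ∀ˢ λ b → ∀ˢ λ c → (a · b · c ≟ˢ ⊖) →-dec (a · b · opp c ≟ˢ ⊕))

    positiveAbove : ∀ k → PositiveAbove k
    positiveAbove zero _ _ _ y∈ _ l = ⊥-elim (<⇒≱ l (greatest y∈))
    positiveAbove (suc k) {g} {x} {y} g∈ j x∈ y∈ x<y l with switch S ζ g in eq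
    ... | ⊕ = refl
    ... | ⊖ = ⊥-elim (Step.absurd g∈ j x∈ y∈ x<y (λ f∈ jf a∈ b∈ a<b y<b →
                positiveAbove k f∈ jf a∈ b∈ a<b (<-≤-trans l (≤-trans (≤-reflexive (sym (+-suc k (r y)))) (+-monoʳ-≤ k y<b)))) eq)

    allPositive : Complete N → ∀ {g} → g ∈ E B → g ≢ e₁ → g ≢ e₂ → Good ζ g
    allPositive complete {g} g∈ n₁ n₂ = order (<-cmpⁿ (r x) (r y))
      where
      x y : Fin #V
      x = proj₁ (ends g)
      y = proj₂ (ends g)
      ≢v : ∀ {u} → Inc g u → u ≢ v
      ≢v i refl = avoid g∈ n₁ n₂ i
      x∈ : x ∈ F
      x∈ = complete (ends∈ {B} subgraph g∈ (inj₁ refl)) (≢v (inj₁ refl))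
      y∈ : y ∈ F
      y∈ = complete (ends∈ {B} subgraph g∈ (inj₂ refl)) (≢v (inj₂ refl))
      order : _ → Good ζ g
      order (tri< l _ _) = positiveAbove (suc (r t)) g∈ (Jn-ends g) x∈ y∈ l (m≤m+n (suc (r t)) (r y))
      order (tri> _ _ l) = positiveAbove (suc (r t)) g∈ (Jn-sym (Jn-ends g)) y∈ x∈ l (m≤m+n (suc (r t)) (r x))
      order (tri≈ _ eq _) = ⊥-elim (n₁ (sym (loop-only {B} tight g∈ (r-injective x∈ y∈ eq) (proj₁ e₁-at))))

  abstract
    -- If `s ≡ t`, the ends of `e₁` and `e₂` are `v` and `s` only. Any further edge would have to
    -- meet these two at a vertex other than `s`, but `v` has no other edges.
    digon-edges : s ≡ t → ∀ {g} → g ∈ E B → g ≢ e₁ → g ≢ e₂ → Absurd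
    digon-edges s≡t {g} g∈ n₁ n₂ with mixing s (⁅ e₁ ⁆ ∪ ⁅ e₂ ⁆) (proj₁ e₁-at) (ends⁺ (inj₁ refl)) g∈ (λ q → [ n₁ , n₂ ]′ (ends⁻ q))
    ... | y , y≢s , (f , (_ , fX) , i) , (h , (h∈ , hX) , ih) = hX (ends⁺ (onlyTwo h∈ (subst (Inc h) (atV (ends⁻ fX)) ih)))
      where
      atV : f ≡ e₁ ⊎ f ≡ e₂ → y ≡ v
      atV (inj₁ refl) = [ id , ⊥-elim ∘ y≢s ]′ (Jn-only j₁ i)
      atV (inj₂ refl) = [ id , (λ eq → ⊥-elim (y≢s (trans eq (sym s≡t)))) ]′ (Jn-only j₂ i)

    isBalancing : IsBalancingEdge S↓ (↓ B) eᵥ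
    isBalancing with s ≟ t
    ... | no s≢t with completeNumbering s≢t
    ...   | N , complete = Sup.balancing (Numbering.ζ N) (AllPositive.allPositive N complete) (Numbering.neg-eᵥ N)
    isBalancing | yes s≡t = Sup.balancing (λ _ → ⊕) (λ g∈ n₁ n₂ → ⊥-elim (digon-edges s≡t g∈ n₁ n₂)) (minus
        (viaV {λ _ → Absurd} {λ _ → ⊕} (λ ()) (subst (Connects _ t) (sym s≡t) ε)))
      where
      minus : ∀ {a} → a ≢ ⊕ → a ≡ ⊖
      minus {⊕} n = ⊥-elim (n refl)
      minus {⊖} _ = refl


-- Vertex batteries

module Spokes (S : SignedGraph) {B : Sub (SignedGraph.graph S)} {v x₀ : Fin (SignedGraph.#V S)}
  (tight : Blocks.Tight (SignedGraph.graph S) B) (x₀∈ : x₀ ∈ V B) (x₀≢v : x₀ ≢ v) where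
  open SignedGraph S
  open Signed S
  open Tight tight

  private
    Inner : Fin #E → Set
    Inner g = g ∈ E B × ¬ Inc g v

  abstract
    κ : Fin #V → Sign
    κ = proj₁ (spanningPotential {Inner} (λ g → (g ∈? E B) ×-dec ¬? (incident? {graph} g v)) x₀)

    κ-connects : ∀ {x} → x ∈ V B → x ≢ v → Connects (λ g → Inner g × Good κ g) x₀ x
    κ-connects x∈ x≢v = proj₂ (spanningPotential {Inner} (λ g → (g ∈? E B) ×-dec ¬? (incident? {graph} g v)) x₀)
      (remove-connected {B} tight x₀∈ x₀≢v x∈ x≢v)

  τ : Fin #E → Sign
  τ g = κ (otherEnd {graph} g v) · σ g

  abstract
    -- Edges positive for `κ` connect `B` without `v`. The value `τ h` at `v` makes the spoke `h`
    -- positive, and equality of the signs does the same for `g`, which closes the circle.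
    spokes : ∀ {g h} → g ∈ E B → h ∈ E B → Inc g v → Inc h v → ¬ Loop g → ¬ Loop h → g ≢ h → τ g ≡ τ h →
             ∃[ D ] PositiveCircle S D × D ⊑ B × v ∈ V D × g ∈ E D
    spokes {g} {h} g∈ h∈ ig ih lg lh g≢h eq with circleThrough {U} {ξ} {g} good ¬Ug (Jn-sym jg)
        (edge {e = h} (inj₂ refl) jh ◅◅ Connects-sym (Connects-mono inj₁ (κ-connects (end∈ h∈ jh) (end≢ lh jh)))
         ◅◅ Connects-mono inj₁ (κ-connects (end∈ g∈ jg) (end≢ lg jg)))
      where
      U : Fin #E → Set
      U f = (Inner f × Good κ f) ⊎ f ≡ h
      ξ : Fin #V → Sign
      ξ = κ [ v ≔ τ h ]
      jg : Jn g v (otherEnd {graph} g v)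
      jg = otherEnd-Jn ig
      jh : Jn h v (otherEnd {graph} h v)
      jh = otherEnd-Jn ih
      end∈ : ∀ {f x} → f ∈ E B → Jn f v x → x ∈ V B
      end∈ f∈ j = ends∈ {B} subgraph f∈ (Jn-Incʳ j)
      end≢ : ∀ {f x} → ¬ Loop f → Jn f v x → x ≢ v
      end≢ l j refl = l (Loop-Jn j)
      good : ∀ {f} → U f → Good ξ f
      good (inj₁ ((_ , n) , gd)) = trans (switch-cong {ξ} {κ} λ i → ≔-other κ _ λ { refl → n i }) gd
      good (inj₂ refl) = trans (switch-Jn ξ jh) (trans (cong₂ (λ a b → a · σ h · b) (≔-same κ v _) (≔-other κ _ (end≢ lh jh)))
        (lem (κ (otherEnd {graph} h v)) (σ h)))
        where
        lem : ∀ a b → a · b · b · a ≡ ⊕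
        lem = from-yes (∀ˢ λ a → ∀ˢ λ b → a · b · b · a ≟ˢ ⊕)
      ¬Ug : ¬ U g
      ¬Ug (inj₁ ((_ , n) , _)) = n ig
      ¬Ug (inj₂ p) = g≢h p
    ... | D , circD , sgnD , g∈D , edgesD = D , (circD , trans sgnD positive) ,
          circle-⊑ {D} {B} circD subgraph (λ f∈ → [ (λ { refl → g∈ }) , [ proj₁ ∘ proj₁ , (λ { refl → h∈ }) ]′ ]′ (edgesD f∈)) ,
          ends∈ {D} (proj₁ (proj₁ circD)) g∈D ig , g∈D
      where
      positive : switch S (κ [ v ≔ τ h ]) g ≡ ⊕
      positive = trans (switch-Jn (κ [ v ≔ τ h ]) (otherEnd-Jn ig)) (trans (cong₂ (λ a b → a · σ g · b) (≔-same κ v _)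
        (≔-other κ _ λ q → lg (Loop-Jn (subst (Jn g v) q (otherEnd-Jn ig)))))
        (trans (cong (λ a → a · σ g · κ (otherEnd {graph} g v)) (sym eq)) (lem (κ (otherEnd {graph} g v)) (σ g))))
        where
        lem : ∀ a b → a · b · b · a ≡ ⊕
        lem = from-yes (∀ˢ λ a → ∀ˢ λ b → a · b · b · a ≟ˢ ⊕)

-- Circles that share edges

module CirclePair (G : Graph) where
  open Graph G
  open Rings G

  abstract
    -- If `D` had edges outside `C`, one of them would meet an edge of `C` at a vertex where `C`
    -- already takes up the whole valency 2 of `D`.
    circle-⊆ : ∀ {C D} → IsCircle {G} C → IsCircle {G} D → (∀ {g} → g ∈ E C → g ∈ E D) → C ≡ D
    circle-⊆ {C} {D} circC circD sub with proj₁ (proj₂ (proj₁ circC))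
    ... | u₀ , u₀∈ with valency-edge {C} (≤-trans (s≤s z≤n) (≤-reflexive (sym (proj₂ circC u₀ u₀∈))))
    ... | e , e∈ , _ = Sub-ext
        ((λ u∈ → let g , g∈ , i = cov C circC u∈ in ends∈ {D} (proj₁ (proj₁ circD)) (sub g∈) i) , sub)
        ((λ u∈ → let g , g∈ , i = cov D circD u∈ in ends∈ {C} (proj₁ (proj₁ circC)) (back g∈) i) , back)
      where
      cov : ∀ H → IsCircle {G} H → ∀ {u} → u ∈ V H → ∃[ g ] g ∈ E H × Inc g u
      cov H circH u∈ = valency-edge {H} (≤-trans (s≤s z≤n) (≤-reflexive (sym (proj₂ circH _ u∈))))
      back : ∀ {h} → h ∈ E D → h ∈ E C
      back {h} h∈ = decidable-stable (h ∈? E C) λ h∉ → contra (circle-Mixing {D} circD u₀ (E C) (sub e∈) e∈ h∈ h∉)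
        where
        contra : ¬ (∃[ y ] y ≢ u₀ × Mixed D (E C) y)
        contra (y , _ , (g , (_ , g∈C) , ig) , (f , (f∈ , f∉) , jf)) = f∉ (sameAt {C} {D} {y}
          (proj₂ circC y y∈) (proj₂ circD y (ends∈ {D} (proj₁ (proj₁ circD)) f∈ jf)) (λ k _ → sub k) f∈ jf)
          where
          y∈ : y ∈ V C
          y∈ = ends∈ {C} (proj₁ (proj₁ circC)) g∈C ig

    twoAt : ∀ {C v} → IsCircle {G} C → v ∈ V C → (∀ {ℓ} → ℓ ∈ E C → ¬ Loop ℓ) →
            ∃₂ λ g h → g ≢ h × (g ∈ E C × Inc g v) × (h ∈ E C × Inc h v)
    twoAt {C} {v} circC v∈ noL with valency-edge {C} (≤-trans (s≤s z≤n) (≤-reflexive (sym (proj₂ circC v v∈))))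
    ... | g , g∈ , i with val<valency {C} {g ∷ []} v ([] ∷ []) (λ { (here refl) → g∈ })
                            (≤-trans (s≤s (≤-reflexive one)) (≤-reflexive (sym (proj₂ circC v v∈))))
      where
      one : val (g ∷ []) v ≡ 1
      one with Inc-Jn i
      ... | y , j = trans (+-identityʳ _) (trans (ends#-Jn v j) (cong₂ _+_ (δ-refl v) (δ-≢ {y} {v} λ { refl → noL g∈ (Loop-Jn j) })))
    ... | h , h∈ , n , i′ = g , h , (λ { refl → n (here refl) }) , (g∈ , i) , (h∈ , i′)

    -- Outside v and w, the edges of B at C belong to C; so a circle that
    -- shares an edge with C follows C as far as v, or w.
    reaches : ∀ {B C D g v w} → IsCircle {G} C → IsCircle {G} D → D ⊑ B → v ∈ V C → w ∈ V C → v ≢ w →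
      (∀ {z h} → z ∈ V C → z ≢ v → z ≢ w → h ∈ E B → Inc h z → h ∈ E C) → g ∈ E C → g ∈ E D → v ∈ V D
    reaches {B} {C} {D} {g} {v} {w} circC circD D⊑B v∈ w∈ v≢w only g∈C g∈D
      with rootedAt {C} circC g∈C (Jn-ends g)
    ... | R , _ with Ring.at-pos R v∈ | Ring.at-pos R w∈
    ... | i , i≤n , refl | j , j≤n , refl with <-cmpⁿ i j
    ... | tri≈ _ refl _ = ⊥-elim (v≢w refl)
    -- On the ring rooted at `g` the direction is chosen in which `v` comes before `w`, so the
    -- vertices passed on the way differ from both.
    ... | tri< i<j _ _ = up i ≤-refl
      where
      open Ring R
      up : ∀ p → p ≤ i → c p ∈ V D
      up zero _ = ends∈ {D} (proj₁ (proj₁ circD)) g∈D (Jn-Incʳ close)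
      up (suc p) p<i = ends∈ {D} (proj₁ (proj₁ circD))
        (sameAt {D} {C} (proj₂ circD _ rec) (proj₂ circC _ (c∈ p≤n)) (λ h∈ → only (c∈ p≤n)
          (λ eq → <⇒≢ p<i (c-injective p≤n i≤n eq)) (λ eq → <⇒≢ (<-trans p<i i<j) (c-injective p≤n j≤n eq)) (proj₂ D⊑B h∈))
          (d∈ p<n) (Jn-Inc (join p<n))) (Jn-Incʳ (join p<n))
        where
        p<n : p < n
        p<n = ≤-trans p<i i≤n
        p≤n : p ≤ n
        p≤n = <⇒≤ p<n
        rec : c p ∈ V D
        rec = up p (<⇒≤ p<i)
    ... | tri> _ _ j<i = down (≤‴-from i≤n) ≤-refl
      where
      open Ring R
      down : ∀ {p} → p ≤‴ n → i ≤ p → c p ∈ V D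
      down (≤‴-reflexive refl) _ = ends∈ {D} (proj₁ (proj₁ circD)) g∈D (Jn-Inc close)
      down {p} (≤‴-step q) i≤p = ends∈ {D} (proj₁ (proj₁ circD))
        (sameAt {D} {C} (proj₂ circD _ rec) (proj₂ circC _ (c∈ p<n)) (λ h∈ → only (c∈ p<n)
          (λ eq → <⇒≢ (s≤s i≤p) (sym (c-injective p<n i≤n eq))) (λ eq → <⇒≢ (<-trans j<i (s≤s i≤p)) (sym (c-injective p<n j≤n eq))) (proj₂ D⊑B h∈))
          (d∈ p<n) (Jn-Incʳ (join p<n))) (Jn-Inc (join p<n))
        where
        p<n : p < n
        p<n = ≤‴⇒≤ q
        rec : c (suc p) ∈ V D
        rec = down q (≤-trans i≤p (n≤1+n p))

    layered-attachments : ∀ {B C D : Sub G} → Layered {G} B C → IsBridge {G} B C D →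
      ∃₂ λ x y → x ≢ y × attachments {G} C D ≡ ⁅ x ⁆ ∪ ⁅ y ⁆
    layered-attachments {C = C} (k , D′ , chords , (_ , _ , complete) , atts , _) br =
      proj₁ (chords i) , proj₂ (chords i) , proj₁ (atts i) ,
      trans (cong (attachments {G} C) (sym (proj₂ (complete _ br)))) (proj₂ (atts i))
      where
      i : Fin k
      i = proj₁ (complete _ br)

    soleBridge-only : ∀ {B C D v w} → Tight B → (circ : IsCircle {G} C) → C ⊑ B →
      (∀ D′ → IsBridge {G} B C D′ → D′ ≡ D) → attachments {G} C D ≡ ⁅ v ⁆ ∪ ⁅ w ⁆ →
      ∀ {z h} → z ∈ V C → z ≢ v → z ≢ w → h ∈ E B → Inc h z → h ∈ E C
    soleBridge-only {B} {C} {D} tight circ C⊑B sole att {z} {h} z∈ z≢v z≢w h∈ i = decidable-stable (h ∈? E C) contra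
      where
      module Br = Bridges G {B} {C} tight circ C⊑B
      contra : ¬ (h ∉ E C)
      contra h∉ with Br.bridgeThrough h∈ h∉ i z∈
      ... | D′ , br , h∈D with sole D′ br
      ... | refl = [ z≢v , z≢w ]′ (ends⁻ (subst (z ∈_) att (x∈p∩q⁺ (Br.bridge-Inc {D′} br h∈D i , z∈))))



-- Blocks at the vertex that contain no positive circle through it

module OtherBlock (S : SignedGraph) {v : Fin (SignedGraph.#V S)} (noNeg : NoNegativeLoopAt S v)
  {B : Sub (SignedGraph.graph S)} (tight : Blocks.Tight (SignedGraph.graph S) B) (v∈ : v ∈ V B)
  {D₁ : Sub (SignedGraph.graph S)} (circ₁ : IsCircle {SignedGraph.graph S} D₁) (D₁⊑B : D₁ ⊑ B)
  (noPos : ∀ D → PositiveCircle S D → D ⊑ B → v ∈ V D → Absurd) where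
  open SignedGraph S
  open Signed S
  open Tight tight

  abstract
    noLoopAt : ∀ {ℓ} → ℓ ∈ E B → Inc ℓ v → ¬ Loop ℓ
    noLoopAt {ℓ} ℓ∈ i l with Inc-Jn i
    ... | y , j with Jn-Loop l j
    ... | refl = noPos (closed ℓ (nil v)) (circℓ , trans (signOf-closed (nil v) ([] ∷ []) λ ()) (cong (_· ⊕) (noNeg ℓ i l)))
          (circle-⊑ {closed ℓ (nil v)} {B} circℓ subgraph λ g∈ → at-ℓ (∈E-mk⁻ {v ∷ []} {ℓ ∷ []} g∈))
          (∈V-mk⁺ {v ∷ []} {ℓ ∷ []} (here refl))
      where
      circℓ : IsCircle {graph} (closed ℓ (nil v))
      circℓ = closed-circle (nil v) ([] ∷ []) j λ ()
      at-ℓ : ∀ {g} → g ∈ˡ ℓ ∷ [] → g ∈ E B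
      at-ℓ (here refl) = ℓ∈

    notThree : ∀ {g₁ g₂ g₃} → g₁ ∈ E B × Inc g₁ v → g₂ ∈ E B × Inc g₂ v → g₃ ∈ E B × Inc g₃ v →
               g₁ ≢ g₂ → g₁ ≢ g₃ → g₂ ≢ g₃ → Absurd
    notThree {g₁} {g₂} {g₃} p₁ p₂ p₃ n₁₂ n₁₃ n₂₃ with Inc-Jn (proj₂ p₁)
    ... | x , j = [ clash p₁ p₂ n₁₂ , [ clash p₁ p₃ n₁₃ , clash p₂ p₃ n₂₃ ]′ ]′ (sign-pigeonhole (Sp.τ g₁) (Sp.τ g₂) (Sp.τ g₃))
      where
      x≢v : x ≢ v
      x≢v refl = noLoopAt (proj₁ p₁) (proj₂ p₁) (Loop-Jn j)
      module Sp = Spokes S {B} {v} {x} tight (ends∈ {B} subgraph (proj₁ p₁) (Jn-Incʳ j)) x≢v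
      clash : ∀ {g h} → g ∈ E B × Inc g v → h ∈ E B × Inc h v → g ≢ h → Sp.τ g ≡ Sp.τ h → Absurd
      clash (g∈ , ig) (h∈ , ih) g≢h eq with Sp.spokes g∈ h∈ ig ih (noLoopAt g∈ ig) (noLoopAt h∈ ih) g≢h eq
      ... | D , posD , D⊑ , v∈D , _ = noPos D posD D⊑ v∈D

    -- If `g` from `v` to `u` were the only edge at `v`, colouring it alone and prescribing `u`
    -- would leave the colours no vertex to meet. The second edge that this argument requires comes
    -- from the circle `D₁`.
    notOne : ∀ {g} → g ∈ E B → Inc g v → (∀ {h} → h ∈ E B → Inc h v → h ≡ g) → Absurd
    notOne {g} g∈ i only with Inc-Jn i
    ... | u , j with another
      where
      another : ∃[ h ] h ∈ E B × h ≢ g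
      another with circle-hasEdge {D₁} circ₁
      ... | f , f∈ with f ≟ g
      ...   | no n = f , proj₂ D₁⊑B f∈ , n
      ...   | yes refl with val<valency {D₁} {f ∷ []} v ([] ∷ []) (λ { (here refl) → f∈ })
              (≤-trans (s≤s (≤-reflexive one)) (≤-reflexive (sym (proj₂ circ₁ v (ends∈ {D₁} (proj₁ (proj₁ circ₁)) f∈ i)))))
        where
        one : val (f ∷ []) v ≡ 1
        one = trans (+-identityʳ _) (trans (ends#-Jn v j) (cong₂ _+_ (δ-refl v) (δ-≢ {u} {v} λ { refl → noLoopAt g∈ i (Loop-Jn j) })))
      ...     | h , h∈ , n , _ = h , proj₂ D₁⊑B h∈ , λ eq → n (here eq)
    ... | h , h∈ , h≢g with mixing u ⁅ g ⁆ g∈ (x∈⁅x⁆ g) h∈ (h≢g ∘ x∈⁅y⁆⇒x≡y g)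
    ... | y , y≢u , (g′ , (_ , g′∈) , ig) , (h′ , (h′∈ , h′∉) , ih) with x∈⁅y⁆⇒x≡y g g′∈
    ... | refl with Jn-only j ig
    ...   | inj₁ refl = h′∉ (subst (_∈ ⁅ g′ ⁆) (sym (only h′∈ ih)) (x∈⁅x⁆ g′))
    ...   | inj₂ eq = y≢u eq

    degree2 : deg {graph} B v ≡ 2
    degree2 with edgesAt {graph} B v in eq | edgesAt-Unique B v
    ... | [] | _ with covered v∈
    ...   | g , g∈ , i with subst (g ∈ˡ_) eq (∈-edgesAt⁺ {B} g∈ i)
    ...     | ()
    degree2 | g ∷ [] | _ = ⊥-elim (notOne (proj₁ at-g) (proj₂ at-g) λ h∈ i → single (subst (_ ∈ˡ_) eq (∈-edgesAt⁺ {B} h∈ i)))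
      where
      at-g : g ∈ E B × Inc g v
      at-g = ∈-edgesAt⁻ {B} (subst (g ∈ˡ_) (sym eq) (here refl))
      single : ∀ {h} → h ∈ˡ g ∷ [] → h ≡ g
      single (here p) = p
    degree2 | _ ∷ _ ∷ [] | _ = refl
    degree2 | g₁ ∷ g₂ ∷ g₃ ∷ gs | ((n₁₂ ∷ n₁₃ ∷ _) ∷ (n₂₃ ∷ _) ∷ _) = ⊥-elim (notThree (mem (here refl)) (mem (there (here refl))) (mem (there (there (here refl)))) n₁₂ n₁₃ n₂₃)
      where
      mem : ∀ {g} → g ∈ˡ g₁ ∷ g₂ ∷ g₃ ∷ gs → g ∈ E B × Inc g v
      mem q = ∈-edgesAt⁻ {B} (subst (_ ∈ˡ_) (sym eq) q)

  condition2 : Σ[ two ∈ deg {graph} B v ≡ 2 ] (let open Suppress S B v two in IsBalancingEdge S↓ (↓ B) eᵥ)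
  condition2 = degree2 , Balance.isBalancing S {B} {v} tight degree2 noPos


-- The block containing the unique positive circle

module MainBlock (S : SignedGraph) {v : Fin (SignedGraph.#V S)} {C : Sub (SignedGraph.graph S)} (pos : PositiveCircle S C) (v∈C : v ∈ V C)
  (uniq : ∀ D → PositiveCircle S D → v ∈ V D → D ≡ C)
  {B : Sub (SignedGraph.graph S)} (tight : Blocks.Tight (SignedGraph.graph S) B) (C⊑B : C ⊑ B) (B≢C : B ≢ C) where
  open SignedGraph S
  open Signed S
  open CirclePair (SignedGraph.graph S)

  private
    circ : IsCircle {graph} C
    circ = proj₁ pos

    ∉⇒≢ : ∀ {f g} → f ∈ E C → g ∉ E C → f ≢ g
    ∉⇒≢ f∈ g∉ refl = g∉ f∈

  open Tight tight
  private
    module Br = Bridges graph {B} {C} tight circ C⊑B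
    module Rg = Rings graph

  uniqueThrough : ∀ {g} → Inc g v → UniqueThrough S B C g
  uniqueThrough i D posD _ g∈ = uniq D posD (ends∈ {D} (proj₁ (proj₁ (proj₁ posD))) g∈ i)

  abstract
    noLoops : ∀ {ℓ} → ℓ ∈ E B → ¬ Loop ℓ
    noLoops {ℓ} ℓ∈ l with circle-hasEdge {C} circ
    ... | e , e∈ = B≢C (Sub-ext ((λ u∈ → let g , g∈ , i = covered u∈ in ends∈ {C} (proj₁ (proj₁ circ)) (inC g∈) i) , inC) C⊑B)
      where
      inC : ∀ {g} → g ∈ E B → g ∈ E C
      inC g∈ = subst (_∈ E C) (trans (loop-only {B} tight ℓ∈ l (proj₂ C⊑B e∈)) (sym (loop-only {B} tight ℓ∈ l g∈))) e∈

    two : ∃₂ λ g h → g ≢ h × (g ∈ E C × Inc g v) × (h ∈ E C × Inc h v)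
    two = twoAt {C} circ v∈C λ ℓ∈ → noLoops (proj₂ C⊑B ℓ∈)

  private
    e : Fin #E
    e = proj₁ two
    e∈ : e ∈ E C
    e∈ = proj₁ (proj₁ (proj₂ (proj₂ (proj₂ two))))
    e-at : Inc e v
    e-at = proj₂ (proj₁ (proj₂ (proj₂ (proj₂ two))))

  abstract
    ring : Σ[ R ∈ Rg.Ring C e ] Rg.Ring.c R 0 ≡ v
    ring with Rg.rootedAt {C} {e} circ e∈ (Jn-sym (otherEnd-Jn e-at))
    ... | R , eq , _ = R , eq

  private
    R : Rg.Ring C e
    R = proj₁ ring
    module Ri = Rg.Ring R
    c0≡v : Ri.c 0 ≡ v
    c0≡v = proj₂ ring
    module Co = Core S {B} {C} tight pos C⊑B {e} R
    module Ne = Nesting S {B} {C} tight pos C⊑B {e} R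

    uniq-e : UniqueThrough S B C e
    uniq-e = uniqueThrough e-at

  abstract
    unbalanced : Unbalanced S B
    unbalanced bal with Br.bridge-exists B≢C
    ... | D , br with Co.span uniq-e {D} br
    ... | sp with Co.negativeCircle {D} br (Co.Span.a<b sp) (Co.Span.b≤n sp) (Co.Span.lnk sp)
    ... | N , circN , N⊑B , neg with trans (sym neg) (bal N circN N⊑B)
    ...   | ()

    -- Of the spokes `e`, `g` and `h` two have equal signs and lie on a positive circle through `v`.
    -- At least one of the two is off `C`, so this circle is not `C`.
    offPair : ∀ {g h} → g ∈ E B × Inc g v → h ∈ E B × Inc h v → g ∉ E C → h ∉ E C → g ≡ h
    offPair {g} {h} (g∈ , ig) (h∈ , ih) g∉ h∉ = decidable-stable (g ≟ h) λ g≢h →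
      [ (λ eq → clash g∈ ig (proj₂ C⊑B e∈) e-at (∉⇒≢ e∈ g∉ ∘ sym) g∉ (sym eq)) ,
      [ (λ eq → clash h∈ ih (proj₂ C⊑B e∈) e-at (∉⇒≢ e∈ h∉ ∘ sym) h∉ (sym eq)) , (λ eq → clash g∈ ig h∈ ih g≢h g∉ eq) ]′ ]′
        (sign-pigeonhole (Sp.τ e) (Sp.τ g) (Sp.τ h))
      where
      jg : Jn g v (otherEnd {graph} g v)
      jg = otherEnd-Jn ig
      module Sp = Spokes S {B} {v} {otherEnd {graph} g v} tight (ends∈ {B} subgraph g∈ (Jn-Incʳ jg))
                    (λ eq → noLoops g∈ (Loop-Jn (subst (Jn g v) eq jg)))
      clash : ∀ {x y} → x ∈ E B → Inc x v → y ∈ E B → Inc y v → x ≢ y → x ∉ E C → Sp.τ x ≡ Sp.τ y → Absurd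
      clash x∈ ix y∈ iy x≢y x∉ eq with Sp.spokes x∈ y∈ ix iy (noLoops x∈) (noLoops y∈) x≢y eq
      ... | D , posD , _ , v∈D , x∈D = x∉ (subst (λ T → _ ∈ E T) (uniq D posD v∈D) x∈D)

    inC-no3 : ∀ {g₁ g₂ g₃} → g₁ ∈ E C → g₂ ∈ E C → g₃ ∈ E C → Inc g₁ v → Inc g₂ v → Inc g₃ v →
              g₁ ≢ g₂ → g₁ ≢ g₃ → g₂ ≢ g₃ → Absurd
    inC-no3 = Rg.circle-no3 {C} (proj₂ circ v v∈C)

    degree : deg {graph} B v ≡ 2 ⊎ (deg {graph} B v ≡ 3 × ∃[ f ] (f ∈ E B × Inc f v) × f ∉ E C)
    degree with two | edgesAt {graph} B v in eq | edgesAt-Unique B v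
    ... | x , y , x≢y , (x∈ , ix) , (y∈ , iy) | [] | _ with subst (x ∈ˡ_) eq (∈-edgesAt⁺ {B} (proj₂ C⊑B x∈) ix)
    ...   | ()
    degree | x , y , x≢y , (x∈ , ix) , (y∈ , iy) | g ∷ [] | _ with subst (x ∈ˡ_) eq (∈-edgesAt⁺ {B} (proj₂ C⊑B x∈) ix)
               | subst (y ∈ˡ_) eq (∈-edgesAt⁺ {B} (proj₂ C⊑B y∈) iy)
    ...   | here refl | here refl = ⊥-elim (x≢y refl)
    degree | _ | _ ∷ _ ∷ [] | _ = inj₁ refl
    degree | _ | g₁ ∷ g₂ ∷ g₃ ∷ [] | ((n₁₂ ∷ n₁₃ ∷ []) ∷ (n₂₃ ∷ []) ∷ _) = inj₂ (refl , off)
      where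
      mem : ∀ {g} → g ∈ˡ g₁ ∷ g₂ ∷ g₃ ∷ [] → g ∈ E B × Inc g v
      mem q = ∈-edgesAt⁻ {B} (subst (_ ∈ˡ_) (sym eq) q)
      m₁ : g₁ ∈ E B × Inc g₁ v
      m₁ = mem (here refl)
      m₂ : g₂ ∈ E B × Inc g₂ v
      m₂ = mem (there (here refl))
      m₃ : g₃ ∈ E B × Inc g₃ v
      m₃ = mem (there (there (here refl)))
      off : ∃[ f ] (f ∈ E B × Inc f v) × f ∉ E C
      off with g₁ ∈? E C | g₂ ∈? E C | g₃ ∈? E C
      ... | no n | _ | _ = g₁ , m₁ , n
      ... | _ | no n | _ = g₂ , m₂ , n
      ... | _ | _ | no n = g₃ , m₃ , n
      ... | yes p₁ | yes p₂ | yes p₃ = ⊥-elim (inC-no3 p₁ p₂ p₃ (proj₂ m₁) (proj₂ m₂) (proj₂ m₃) n₁₂ n₁₃ n₂₃)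
    degree | _ | g₁ ∷ g₂ ∷ g₃ ∷ g₄ ∷ gs | ((n₁₂ ∷ n₁₃ ∷ n₁₄ ∷ _) ∷ (n₂₃ ∷ n₂₄ ∷ _) ∷ (n₃₄ ∷ _) ∷ _) = ⊥-elim absurd
      where
      mem : ∀ {g} → g ∈ˡ g₁ ∷ g₂ ∷ g₃ ∷ g₄ ∷ gs → g ∈ E B × Inc g v
      mem q = ∈-edgesAt⁻ {B} (subst (_ ∈ˡ_) (sym eq) q)
      m₁ : g₁ ∈ E B × Inc g₁ v
      m₁ = mem (here refl)
      m₂ : g₂ ∈ E B × Inc g₂ v
      m₂ = mem (there (here refl))
      m₃ : g₃ ∈ E B × Inc g₃ v
      m₃ = mem (there (there (here refl)))
      m₄ : g₄ ∈ E B × Inc g₄ v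
      m₄ = mem (there (there (there (here refl))))
      off : ∀ {g h} → g ∈ E B × Inc g v → h ∈ E B × Inc h v → g ≢ h → g ∉ E C → h ∈ E C
      off {g} {h} mg mh n g∉ = decidable-stable (h ∈? E C) λ h∉ → n (offPair mg mh g∉ h∉)
      three : ∀ {x y z} → x ∈ E B × Inc x v → y ∈ E B × Inc y v → z ∈ E B × Inc z v → x ≢ y → x ≢ z → y ≢ z →
              x ∈ E C → y ∈ E C → z ∈ E C → Absurd
      three mx my mz a b c x∈ y∈ z∈ = inC-no3 x∈ y∈ z∈ (proj₂ mx) (proj₂ my) (proj₂ mz) a b c
      absurd : Absurd
      absurd with g₁ ∈? E C | g₂ ∈? E C | g₃ ∈? E C
      ... | no q | _ | _ = three m₂ m₃ m₄ n₂₃ n₂₄ n₃₄ (off m₁ m₂ n₁₂ q) (off m₁ m₃ n₁₃ q) (off m₁ m₄ n₁₄ q)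
      ... | yes p | no q | _ = three m₁ m₃ m₄ n₁₃ n₁₄ n₃₄ p (off m₂ m₃ n₂₃ q) (off m₂ m₄ n₂₄ q)
      ... | yes p | yes p′ | no q = three m₁ m₂ m₄ n₁₂ n₁₄ n₂₄ p p′ (off m₃ m₄ n₃₄ q)
      ... | yes p | yes p′ | yes p″ = three m₁ m₂ m₃ n₁₂ n₁₃ n₂₃ p p′ p″

    -- Layeredness is proved in `B↓v` with root `eᵥ`: circles of `B↓v` through `eᵥ` expand to
    -- circles through `v` of the same sign, so uniqueness at `v` becomes uniqueness through `eᵥ`.
    conditionB : deg {graph} B v ≡ 2 → ConditionB S v C B
    conditionB deg2 = unbalanced , deg2 , layered ,
      (↓ C , (pos↓ , ⊑↓ , here) , λ { (posD , D⊑ , e∈D) → sym (uniq↓ _ posD D⊑ e∈D) }) , pos↓ , ⊑↓ , here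
      where
      open Suppress S B v deg2
      module Su = Suppression S {B} {v} tight deg2
      pos↓ : PositiveCircle S↓ (↓ C)
      pos↓ = let circ↓ , eq = Su.↓-circle {C} circ C⊑B v∈C in circ↓ , trans (sym eq) (proj₂ pos)
      ⊑↓ : ↓ C ⊑ ↓ B
      ⊑↓ = Su.↓-⊑ {C} C⊑B
      uniq↓ : UniqueThrough S↓ (↓ B) (↓ C) eᵥ
      uniq↓ = Su.↓-unique uniq
      layered : Layered (↓ B) (↓ C)
      layered = Nesting.layered S↓ {↓ B} {↓ C} Su.↓-tight pos↓ ⊑↓
        (proj₁ (Rings.rootedAt (SignedGraph.graph S↓) {↓ C} {eᵥ} (proj₁ pos↓) here (inj₁ refl))) uniq↓
        (B≢C ∘ Su.↓-reflect {C} circ C⊑B v∈C)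

    -- Position 0 is `v`, so the span of `D` starts there. A second bridge starting at 0 would bring
    -- a second edge off `C` to `v`; any other is confined to the span of `D` by `nested`, and then
    -- `noSecond` applies.
    soleBridge : ∀ {f D} → f ∈ E B × Inc f v → f ∉ E C → IsBridge {graph} B C D → f ∈ E D →
                 Σ[ sp ∈ Co.Span uniq-e D ] Co.Span.a sp ≡ 0 × (∀ {D′} → IsBridge {graph} B C D′ → D ≡ D′)
    soleBridge {f} {D} (f∈ , if) f∉ br f∈D = sp , a≡0 , same
      where
      sp : Co.Span uniq-e D
      sp = Co.span uniq-e {D} br
      module Sp = Co.Span sp
      a≤n : Sp.a ≤ Ri.n
      a≤n = ≤-trans (<⇒≤ Sp.a<b) Sp.b≤n
      a≡0 : Sp.a ≡ 0
      a≡0 with ends⁻ (subst (v ∈_) Sp.attach (x∈p∩q⁺ (Br.bridge-Inc {D} br f∈D if , v∈C)))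
      ... | inj₁ eq = Ri.c-injective a≤n z≤n (trans (sym eq) (sym c0≡v))
      ... | inj₂ eq = ⊥-elim (<⇒≱ (≤-<-trans z≤n Sp.a<b) (≤-reflexive (Ri.c-injective Sp.b≤n z≤n (trans (sym eq) (sym c0≡v)))))
      same : ∀ {D′} → IsBridge {graph} B C D′ → D ≡ D′
      same {D′} br′ with Co.span uniq-e {D′} br′
      ... | sp′ = decidable-stable (D ≟ₛ D′) (λ D≢D′ → contra D≢D′ (Sp′.a ≟ⁿ 0))
        where
        module Sp′ = Co.Span sp′
        lnk₀ : Co.Link D 0 Sp.b
        lnk₀ = subst (λ a → Co.Link D a Sp.b) a≡0 Sp.lnk
        0<b : 0 < Sp.b
        0<b = ≤-<-trans z≤n Sp.a<b
        contra : D ≢ D′ → Dec (Sp′.a ≡ 0) → Absurd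
        contra D≢D′ (yes a′≡0) with Br.bridge-edgeAt {D′} br′ (subst (_∈ V D′) (trans (cong Ri.c a′≡0) c0≡v) Sp′.a∈) v∈C
        ... | f′ , f′∈ , if′ with offPair (f∈ , if) (proj₁ (Br.bridge-E {D′} br′ f′∈) , if′) f∉ (proj₂ (Br.bridge-E {D′} br′ f′∈))
        ...   | refl = D≢D′ (Br.bridge-unique-E {D} {D′} br br′ f∈D f′∈)
        contra D≢D′ (no a′≢0) = Ne.noSecond
          (λ { 0<n refl → uniqueThrough (subst (Inc (Ri.d 0)) c0≡v (Jn-Inc (Ri.join 0<n))) }) br br′ D≢D′ lnk₀ Sp′.lnk Sp.b≤n
          0<a′ Sp′.a<b (≮⇒≥ λ l → Ne.nested uniq-e br br′ D≢D′ lnk₀ Sp′.lnk 0<b Sp.b≤n Sp′.a<b Sp′.b≤n (0<a′ , l))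
          where
          0<a′ : 0 < Sp′.a
          0<a′ = ≤∧≢⇒< z≤n (a′≢0 ∘ sym)

    -- Away from `v` and the other attachment, every edge at a vertex of `C` belongs to `C`. This
    -- spreads uniqueness from `v` to all edges of `C`.
    soleBridge-reaches : ∀ {D} (sp : Co.Span uniq-e D) → Co.Span.a sp ≡ 0 → (∀ {D′} → IsBridge {graph} B C D′ → D ≡ D′) →
      ∀ {D′ g} → IsCircle {graph} D′ → D′ ⊑ B → g ∈ E C → g ∈ E D′ → v ∈ V D′
    soleBridge-reaches {D} sp a≡0 sole {D′} {g} circD D⊑ g∈ g∈D = reaches {B} {C} {D′} {g} {v} {Ri.c Sp.b} circ circD D⊑ v∈C (Ri.c∈ Sp.b≤n)
      (λ eq → <⇒≢ Sp.a<b (Ri.c-injective (≤-trans (<⇒≤ Sp.a<b) Sp.b≤n) Sp.b≤n (trans ca≡v eq)))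
      (soleBridge-only {B} {C} {D} tight circ C⊑B (λ D″ br″ → sym (sole br″)) (trans Sp.attach (cong (λ z → ⁅ z ⁆ ∪ ⁅ Ri.c Sp.b ⁆) ca≡v)))
      g∈ g∈D
      where
      module Sp = Co.Span sp
      ca≡v : Ri.c Sp.a ≡ v
      ca≡v = trans (cong Ri.c a≡0) c0≡v

    conditionC : deg {graph} B v ≡ 3 → ∃[ f ] (f ∈ E B × Inc f v) × f ∉ E C → ConditionC S v C B
    conditionC deg3 (f , (f∈ , if) , f∉) = fromBridge (Br.bridgeThrough f∈ f∉ if v∈C)
      where
      fromBridge : (∃[ D ] IsBridge {graph} B C D × f ∈ E D) → ConditionC S v C B
      fromBridge (D , br , f∈D) = unbalanced , deg3 , Ne.layered uniq-e B≢C , (D , br , sole) ,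
        (λ D′ br′ → subst (λ T → v ∈ attachments {graph} C T) (sole br′) (x∈p∩q⁺ (Br.bridge-Inc {D} br f∈D if , v∈C))) ,
        λ g g∈ → C , (pos , C⊑B , g∈) , λ { {D′} (posD , D⊑ , g∈D) → sym (uniq D′ posD
          (soleBridge-reaches {D} (proj₁ sb) (proj₁ (proj₂ sb)) sole (proj₁ posD) D⊑ g∈ g∈D)) }
        where
        sb : Σ[ sp ∈ Co.Span uniq-e D ] Co.Span.a sp ≡ 0 × (∀ {D′} → IsBridge {graph} B C D′ → D ≡ D′)
        sb = soleBridge {f} {D} (f∈ , if) f∉ br f∈D
        sole : ∀ {D′} → IsBridge {graph} B C D′ → D ≡ D′
        sole = proj₂ (proj₂ sb)

    cases : ConditionB S v C B ⊎ ConditionC S v C B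
    cases = map⊎ conditionB (uncurry conditionC) degree


-- From a vertex battery to the conditions

module Forward (S : SignedGraph) {v : Fin (SignedGraph.#V S)} (noNeg : NoNegativeLoopAt S v)
  {C : Sub (SignedGraph.graph S)} (pos : PositiveCircle S C) (v∈C : v ∈ V C)
  (uniq : ∀ D → PositiveCircle S D → v ∈ V D → D ≡ C) where
  open SignedGraph S
  open Signed S

  private
    circ : IsCircle {graph} C
    circ = proj₁ pos

    module _ {B₀ : Sub graph} (block₀ : IsBlock {graph} B₀) (C⊑B₀ : C ⊑ B₀) where

      e∈B₀ : proj₁ (circle-hasEdge {C} circ) ∈ E B₀
      e∈B₀ = proj₂ C⊑B₀ (proj₂ (circle-hasEdge {C} circ))

      sameBlock : ∀ {B D} → IsBlock {graph} B → PositiveCircle S D → D ⊑ B → v ∈ V D → B ≡ B₀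
      sameBlock {B} {D} block posD D⊑ v∈D = block-unique block block₀
        (proj₂ D⊑ (subst (λ T → _ ∈ E T) (sym (uniq D posD v∈D)) (proj₂ (circle-hasEdge {C} circ)))) e∈B₀

      condition1 : Condition1 S v C B₀
      condition1 = (C , (pos , C⊑B₀ , v∈C) , λ { {D} (posD , _ , v∈D) → sym (uniq D posD v∈D) }) ,
        (λ { B block _ (D , (posD , D⊑ , v∈D) , _) → sameBlock {B} {D} block posD D⊑ v∈D }) , shape (B₀ ≟ₛ C)
        where
        shape : Dec (B₀ ≡ C) → ConditionA S v C B₀ ⊎ ConditionB S v C B₀ ⊎ ConditionC S v C B₀
        shape (yes eq) = inj₁ (eq , pos)
        shape (no neq) = inj₂ (MainBlock.cases S pos v∈C uniq (nonseparable-Tight (proj₁ block₀) e∈B₀) C⊑B₀ neq)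

      condition2 : (∀ B → IsBlock {graph} B → v ∈ V B → ∃[ D ] (IsCircle {graph} D × D ⊑ B)) → Condition2 S v C B₀
      condition2 circles B block v∈B B≢B₀ = OtherBlock.condition2 S {v} noNeg {B}
        (nonseparable-Tight (proj₁ block) (proj₂ D₁⊑B (proj₂ (circle-hasEdge {D₁} circ₁)))) v∈B {D₁} circ₁ D₁⊑B
        (λ D posD D⊑ v∈D → B≢B₀ (sameBlock {B} {D} block posD D⊑ v∈D))
        where
        D₁ : Sub graph
        D₁ = proj₁ (circles B block v∈B)
        circ₁ : IsCircle {graph} D₁
        circ₁ = proj₁ (proj₂ (circles B block v∈B))
        D₁⊑B : D₁ ⊑ B
        D₁⊑B = proj₂ (proj₂ (circles B block v∈B))

  forward : (∀ B → IsBlock {graph} B → v ∈ V B → ∃[ D ] (IsCircle {graph} D × D ⊑ B)) →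
            ∃[ B₀ ] (IsBlock {graph} B₀ × C ⊑ B₀ × Condition1 S v C B₀ × Condition2 S v C B₀)
  forward circles = fromBlock (blockAbove {C} (circle-nonseparable {C} circ))
    where
    fromBlock : (∃[ B₀ ] IsBlock {graph} B₀ × C ⊑ B₀) →
                ∃[ B₀ ] (IsBlock {graph} B₀ × C ⊑ B₀ × Condition1 S v C B₀ × Condition2 S v C B₀)
    fromBlock (B₀ , block₀ , C⊑B₀) = B₀ , block₀ , C⊑B₀ , condition1 block₀ C⊑B₀ , condition2 block₀ C⊑B₀ circles


-- From the conditions to a vertex battery

module Backward (S : SignedGraph) {v : Fin (SignedGraph.#V S)} {C B₀ D₀ : Sub (SignedGraph.graph S)}
  (circ : IsCircle {SignedGraph.graph S} C) (v∈C : v ∈ V C) (block₀ : IsBlock {SignedGraph.graph S} B₀) (C⊑B₀ : C ⊑ B₀)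
  (pos₀ : PositiveCircle S D₀) (uniq₀ : ∀ {D} → PositiveCircle S D → D ⊑ B₀ → v ∈ V D → D₀ ≡ D) where
  open SignedGraph S
  open Signed S
  open CirclePair (SignedGraph.graph S)

  private
    tight : Tight B₀
    tight = nonseparable-Tight (proj₁ block₀) (proj₂ C⊑B₀ (proj₂ (circle-hasEdge {C} circ)))

  abstract
    positiveB : ConditionB S v C B₀ → signOf S C ≡ ⊕
    positiveB (_ , two , _ , _ , (_ , pos↓) , _) =
      trans (proj₂ (Suppression.↓-circle S {B₀} {v} tight two {C} circ C⊑B₀ v∈C)) pos↓

    -- Every edge of `C` lies in some positive circle, which follows `C` to `v` and is therefore
    -- `D₀`. So all edges of `C` belong to the circle `D₀`, and a circle contains no smaller one.
    soleBridge-positive : ∀ {D w} → (∀ D′ → IsBridge {graph} B₀ C D′ → D′ ≡ D) →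
      attachments {graph} C D ≡ ⁅ v ⁆ ∪ ⁅ w ⁆ → v ≢ w →
      (∀ g → g ∈ E C → UniquePositiveThrough S B₀ g) → signOf S C ≡ ⊕
    soleBridge-positive {D} {w} sole att v≢w unique =
      subst (λ T → signOf S T ≡ ⊕) (sym (circle-⊆ {C} {D₀} circ (proj₁ pos₀) inD₀)) (proj₂ pos₀)
      where
      w∈ : w ∈ V C
      w∈ = proj₂ (x∈p∩q⁻ (V D) (V C) (subst (w ∈_) (sym att) (ends⁺ (inj₂ refl))))
      inD₀ : ∀ {g} → g ∈ E C → g ∈ E D₀
      inD₀ {g} g∈ with unique g g∈
      ... | D′ , (pos′ , D′⊑ , g∈′) , _ = subst (λ T → g ∈ E T) (sym (uniq₀ pos′ D′⊑
              (reaches {B₀} {C} {D′} {g} {v} {w} circ (proj₁ pos′) D′⊑ v∈C w∈ v≢w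
                (soleBridge-only {B₀} {C} {D} tight circ C⊑B₀ sole att) g∈ g∈′))) g∈′

    attachedBridge-positive : ∀ {D} → (∀ D′ → IsBridge {graph} B₀ C D′ → D′ ≡ D) → v ∈ attachments {graph} C D →
      (∀ g → g ∈ E C → UniquePositiveThrough S B₀ g) →
      (∃₂ λ x y → x ≢ y × attachments {graph} C D ≡ ⁅ x ⁆ ∪ ⁅ y ⁆) → signOf S C ≡ ⊕
    attachedBridge-positive {D} sole v∈att unique (x , y , x≢y , att) =
      [ (λ { refl → soleBridge-positive {D} {y} sole att x≢y unique }) ,
        (λ { refl → soleBridge-positive {D} {x} sole
              (trans att (⊆-antisym (λ z∈ → ends⁺ (swap⊎ (ends⁻ z∈))) (λ z∈ → ends⁺ (swap⊎ (ends⁻ z∈))))) (x≢y ∘ sym) unique }) ]′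
      (ends⁻ (subst (v ∈_) att v∈att))

    positiveC : ConditionC S v C B₀ → signOf S C ≡ ⊕
    positiveC (_ , _ , layered , (D , br , sole) , v∈att , unique) = attachedBridge-positive {D} (λ D′ br′ → sym (sole br′))
      (v∈att D br) unique (layered-attachments {B₀} {C} {D} layered br)

  positive : ConditionA S v C B₀ ⊎ ConditionB S v C B₀ ⊎ ConditionC S v C B₀ → PositiveCircle S C
  positive = [ proj₂ , [ (λ b → circ , positiveB b) , (λ c → circ , positiveC c) ]′ ]′

  battery : PositiveCircle S C → (∀ {B D} → IsBlock {graph} B → B ≢ B₀ → PositiveCircle S D → D ⊑ B → v ∈ V D → Absurd) →
            IsPositiveVertexBattery S v C
  battery pos noOther = pos , v∈C , sole
    where
    sole : ∀ D → PositiveCircle S D → v ∈ V D → D ≡ C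
    sole D posD v∈D with blockAbove {D} (circle-nonseparable {D} (proj₁ posD))
    ... | B , block , D⊑B with B ≟ₛ B₀
    ...   | yes eq = trans (sym (uniq₀ posD (subst (D ⊑_) eq D⊑B) v∈D)) (uniq₀ pos C⊑B₀ v∈C)
    ...   | no B≢B₀ = ⊥-elim (noOther {B} {D} block B≢B₀ posD D⊑B v∈D)

  otherBlock-negative : Condition2 S v C B₀ →
    ∀ {B D} → IsBlock {graph} B → B ≢ B₀ → PositiveCircle S D → D ⊑ B → v ∈ V D → Absurd
  otherBlock-negative cond2 {B} {D} block B≢B₀ posD D⊑B v∈D = case trans (sym (proj₂ posD)) neg of λ ()
    where
    neg : signOf S D ≡ ⊖
    neg = Suppression.balancing⇒negative S {B} {v}
      (nonseparable-Tight (proj₁ block) (proj₂ D⊑B (proj₂ (circle-hasEdge {D} (proj₁ posD)))))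
      (proj₁ (cond2 B block (proj₁ D⊑B v∈D) B≢B₀)) (proj₂ (cond2 B block (proj₁ D⊑B v∈D) B≢B₀)) {D} (proj₁ posD) D⊑B v∈D


mainTheorem14 :
    (S : SignedGraph) (let open SignedGraph S) (v : Fin #V) →
    NoNegativeLoopAt S v →
    (∀ B → IsBlock B → v ∈ V B → ∃[ D ] (IsCircle {graph} D × D ⊑ B)) →
    ∀ C → IsCircle {graph} C → v ∈ V C →
    IsPositiveVertexBattery S v C
      ⇔
    (∃[ B₀ ] (IsBlock B₀ × C ⊑ B₀ ×
              Condition1 S v C B₀ × Condition2 S v C B₀))
mainTheorem14 S v noNeg circles C circ v∈C = mk⇔
  (λ { (pos , _ , uniq) → Forward.forward S noNeg {C} pos v∈C uniq circles })
  (λ { (B₀ , block₀ , C⊑B₀ , ((D₀ , (pos₀ , _) , uniq₀) , _ , shape) , cond2) →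
    let module Bw = Backward S {v} {C} {B₀} {D₀} circ v∈C block₀ C⊑B₀ pos₀ (λ {D} p s v∈ → uniq₀ {D} (p , s , v∈))
    in Bw.battery (Bw.positive shape) (Bw.otherBlock-negative cond2) })
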